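{- There exists a constant $c > 0$ such that, unless $\mathsf{P} = \mathsf{NP}$, the problem Min-Quasi-Kernel cannot be approximated in polynomial time to within a factor of $c \ln(|V|)$, where $V$ is the vertex set of the input digraph. This holds even when the input is restricted to acyclic orientations of bipartite graphs.
   Context: Min-Quasi-Kernel is the problem of finding a quasi-kernel of minimum size in a given finite digraph $D=(V,A)$. A subset of vertices of $D$ is independent if all pairs of distinct vertices in it are non-adjacent. The directed distance $d(v,w)$ is the minimum length of a directed path from $v$ to $w$. A quasi-kernel of $D$ is an independent subset $Q \subseteq V$ such that for every $v \in V \setminus Q$ there exists $w \in Q$ with $d(v,w) \leq 2$. Approximating within a factor $\rho$ means outputting, for every input $D$, a quasi-kernel of size at most $\rho$ times the minimum size of a quasi-kernel of $D$. An orientation of an undirected graph is a digraph obtained by giving each edge exactly one of its two possible directions; it is acyclic if it has no directed cycle. -}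

module Defs where

open import Level using (0ℓ)
open import Data.Bool.Base using (Bool; true; false; T)
open import Data.Fin.Base using (Fin; zero)
open import Data.Fin.Subset using (Subset; _∈_; _∉_; ∣_∣)
open import Data.Integer.Base using (+_)
open import Data.List.Base as List using (List; []; _∷_; _++_; [_]; length; replicate)
open import Data.List.Relation.Unary.Unique.Propositional using (Unique)
open import Data.Maybe.Base using (Maybe; just; nothing)
open import Data.Nat.Base as ℕ using (ℕ; zero; suc)
open import Data.Product.Base using (Σ; _×_; _,_; ∃; ∃-syntax)
open import Data.Rational.Base as ℚ using (ℚ; 0ℚ; 1ℚ; _/_)
open import Data.Sum.Base using (_⊎_)
open import Data.Vec.Base as Vec using (Vec)
open import Function.Bundles using (_⇔_)
open import Relation.Binary.Construct.Closure.ReflexiveTransitive using (Star; ε; _◅_)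
open import Relation.Binary.PropositionalEquality.Core using (_≡_; _≢_)
open import Relation.Nullary.Negation.Core using (¬_)
open import Relation.Unary using (Pred; _≐_)

Word : Set
Word = List Bool

------------------------------------------------------------------------
-- Deterministic Turing machines with one two-way infinite tape

data Symbol (k : ℕ) : Set where
  blank : Symbol k
  bit   : Bool → Symbol k
  work  : Fin k → Symbol k

data Move : Set where
  left stay right : Move

-- The initial state is zero; the machine halts where δ is nothing.

record TM : Set where
  field
    states-1 : ℕ
    extra    : ℕ
  State  = Fin (suc states-1)
  Letter = Symbol extra
  field
    δ : State → Letter → Maybe (State × Letter × Move)

-- `before` lists the cells to the left of the head, nearest first, and
-- `after` those to its right, nearest first; cells not listed are blank.

record Tape (A : Set) : Set where
  constructor tape
  field
    before : List A
    here   : A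
    after  : List A

module _ {k : ℕ} where

  load : List (Symbol k) → Tape (Symbol k)
  load []       = tape [] blank []
  load (a ∷ as) = tape [] a as

  write : Symbol k → Tape (Symbol k) → Tape (Symbol k)
  write a (tape ls _ rs) = tape ls a rs

  move : Move → Tape (Symbol k) → Tape (Symbol k)
  move stay  t                     = t
  move left  (tape []       a rs)  = tape [] blank (a ∷ rs)
  move left  (tape (l ∷ ls) a rs)  = tape ls l (a ∷ rs)
  move right (tape ls a [])        = tape (a ∷ ls) blank []
  move right (tape ls a (r ∷ rs))  = tape (a ∷ ls) r rs

  leadingBits : List (Symbol k) → Word
  leadingBits (bit b ∷ as) = b ∷ leadingBits as
  leadingBits _            = []

  -- The output is the maximal block of bits starting at the head.

  output : Tape (Symbol k) → Word
  output (tape _ a rs) = leadingBits (a ∷ rs)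

module _ (M : TM) where
  open TM M

  Config : Set
  Config = State × Tape Letter

  initial : Word → Config
  initial w = zero , load (List.map bit w)

  step : Config → Maybe Config
  step (q , t) with δ q (Tape.here t)
  ... | nothing            = nothing
  ... | just (q′ , a , m)  = just (q′ , move m (write a t))

  data HaltsFrom : Config → ℕ → Config → Set where
    halt : ∀ {c} → step c ≡ nothing → HaltsFrom c 0 c
    next : ∀ {c c′ d t} → step c ≡ just c′ → HaltsFrom c′ t d → HaltsFrom c (suc t) d

  Computes : Word → ℕ → Word → Set
  Computes w t o = ∃[ q ] ∃[ s ] HaltsFrom (initial w) t (q , s) × output s ≡ o

------------------------------------------------------------------------
-- Polynomial time, P and NP

poly : ℕ → ℕ → ℕ → ℕ
poly a k n = a ℕ.+ a ℕ.* n ℕ.^ k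

-- The instances of a problem are the elements of I, given to the machine
-- through enc; Good i o says that o is a correct answer on i.  Nothing is
-- required of the machine on words that do not encode an instance.

PolyTimeSolvable : {I : Set} (enc : I → Word) (Good : I → Word → Set) → Set
PolyTimeSolvable {I} enc Good =
  ∃[ M ] ∃[ a ] ∃[ k ] ((i : I) →
    ∃[ t ] ∃[ o ] t ℕ.≤ poly a k (length (enc i)) × Computes M (enc i) t o × Good i o)

Language : Set₁
Language = Pred Word 0ℓ

Decision : Language → Word → Word → Set
Decision L w o = (L w × o ≡ [ true ]) ⊎ (¬ L w × o ≡ [ false ])

P : Language → Set
P L = PolyTimeSolvable (λ w → w) (Decision L)

-- Injective: each bit of the first word is preceded by true, and false
-- marks the start of the second word.

pair : Word → Word → Word
pair []      y = false ∷ y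
pair (b ∷ x) y = true ∷ b ∷ pair x y

NP : Language → Set₁
NP L = ∃[ V ] P V × ∃[ a ] ∃[ k ] (∀ w →
  L w ⇔ (∃[ y ] length y ℕ.≤ poly a k (length w) × V (pair w y)))

P=NP : Set₁
P=NP = P ≐ NP

------------------------------------------------------------------------
-- Digraphs

record Digraph : Set where
  field
    order  : ℕ
    matrix : Vec (Vec Bool order) order
  Vertex : Set
  Vertex = Fin order
  Arc : Vertex → Vertex → Set
  Arc u v = T (Vec.lookup (Vec.lookup matrix u) v)

-- The order in unary, then the adjacency matrix row by row.

encode : Digraph → Word
encode D = replicate order true ++ false ∷ Vec.toList (Vec.concat matrix)
  where open Digraph D

module _ (D : Digraph) where
  open Digraph D

  Walk : Vertex → Vertex → Set
  Walk = Star Arc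

  walkLength : ∀ {u v} → Walk u v → ℕ
  walkLength ε       = 0
  walkLength (_ ◅ p) = suc (walkLength p)

  vertices : ∀ {u v} → Walk u v → List Vertex
  vertices {u} ε       = [ u ]
  vertices {u} (_ ◅ p) = u ∷ vertices p

  IsPath : ∀ {u v} → Walk u v → Set
  IsPath p = Unique (vertices p)

  -- No d satisfies this when there is no path from u to v.

  IsDistance : Vertex → Vertex → ℕ → Set
  IsDistance u v d =
    (Σ (Walk u v) λ p → IsPath p × walkLength p ≡ d) ×
    ((p : Walk u v) → IsPath p → d ℕ.≤ walkLength p)

  -- A directed cycle is an arc from u to v closed by a path from v to u.

  Acyclic : Set
  Acyclic = ∀ {u v} → Arc u v → (p : Walk v u) → ¬ IsPath p

  Independent : Subset order → Set
  Independent Q = ∀ {u v} → u ∈ Q → v ∈ Q → u ≢ v → ¬ (Arc u v ⊎ Arc v u)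

  IsQuasiKernel : Subset order → Set
  IsQuasiKernel Q = Independent Q ×
    (∀ v → v ∉ Q → ∃[ w ] w ∈ Q × (∃[ d ] IsDistance v w d × d ℕ.≤ 2))

  IsMinQuasiKernelSize : ℕ → Set
  IsMinQuasiKernelSize m =
    (∃[ Q ] IsQuasiKernel Q × ∣ Q ∣ ≡ m) ×
    (∀ Q → IsQuasiKernel Q → m ℕ.≤ ∣ Q ∣)

record Graph (n : ℕ) : Set where
  field
    edge : Fin n → Fin n → Bool
  Edge : Fin n → Fin n → Set
  Edge u v = T (edge u v)
  field
    symmetric   : ∀ {u v} → Edge u v → Edge v u
    irreflexive : ∀ {v} → ¬ Edge v v

Bipartite : ∀ {n} → Graph n → Set
Bipartite {n} G = Σ (Fin n → Bool) λ side → ∀ {u v} → Edge u v → side u ≢ side v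
  where open Graph G

IsOrientationOf : (D : Digraph) → Graph (Digraph.order D) → Set
IsOrientationOf D G =
  (∀ u v → Edge u v ⇔ (Arc u v ⊎ Arc v u)) × (∀ u v → ¬ (Arc u v × Arc v u))
  where open Digraph D; open Graph G

AcyclicBipartiteOrientation : Pred Digraph 0ℓ
AcyclicBipartiteOrientation D = Acyclic D × (∃[ G ] Bipartite G × IsOrientationOf D G)

------------------------------------------------------------------------
-- The approximation factor

expTerm : ℚ → ℕ → ℚ
expTerm s zero    = 1ℚ
expTerm s (suc i) = expTerm s i ℚ.* s ℚ.* (+ 1 / suc i)

expSum : ℚ → ℕ → ℚ
expSum s zero    = 0ℚ
expSum s (suc k) = expSum s k ℚ.+ expTerm s k

-- For s ≥ 0 the partial sums of Σᵢ sⁱ / i! increase to exp s, so all of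
-- them are at most n exactly when s ≤ ln n.

_≤ln_ : ℚ → ℕ → Set
s ≤ln n = 0ℚ ℚ.≤ s × (∀ k → expSum s k ℚ.≤ + n / 1)

-- A real factor is given by (enough of) its lower cut.  This one is
-- max(1, c ln n), c > 0.  An approximation factor is by convention at
-- least 1: the bare factor c ln n is below 1 for small n (and is 0 for
-- n = 1), where not even an optimal solution would be within it.

LogFactor : ℚ → ℕ → Pred ℚ 0ℓ
LogFactor c n r = r ℚ.≤ 1ℚ ⊎ (∃[ s ] s ≤ln n × r ℚ.≤ c ℚ.* s)

-- x ≤ ρ m for ρ = max(1, c ln n) with c rational.  A rational r suffices
-- as intermediate value: take r = x / m if m > 0, and r = 1 if m = 0.

WithinFactor : Pred ℚ 0ℓ → ℕ → ℕ → Set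
WithinFactor ρ x m = ∃[ r ] ρ r × (+ x / 1) ℚ.≤ r ℚ.* (+ m / 1)

-- A subset is output as its characteristic bit vector.

IsApproximation : (ℕ → Pred ℚ 0ℓ) → Digraph → Word → Set
IsApproximation ρ D o =
  ∃[ Q ] o ≡ Vec.toList Q × IsQuasiKernel D Q ×
    (∃[ m ] IsMinQuasiKernelSize D m × WithinFactor (ρ (Digraph.order D)) ∣ Q ∣ m)

MinQuasiKernelApproximable : Pred Digraph 0ℓ → (ℕ → Pred ℚ 0ℓ) → Set
MinQuasiKernelApproximable C ρ =
  PolyTimeSolvable {I = ∃ C} (λ (D , _) → encode D) (λ (D , _) → IsApproximation ρ D)

module Submission where

-- Independence makes quasi-kernels as hard as minimum independent domination,
-- so the gap needs no PCP: c = 1 works, and much larger factors would too.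
-- A variable is a pair of optional vertices, one for each truth value, joined
-- by an arc so that at most one is chosen.  Every clause comes in K copies,
-- each of which must reach a chosen literal within two steps or cost a vertex
-- of its own.  Positive literals are reached through a private link, negative
-- ones directly; this keeps the digraph bipartite and stops a clause from
-- reaching a variable's other value.  A satisfying assignment gives a
-- quasi-kernel with one vertex per variable and two sinks, while fewer than K
-- vertices leave some copy of all clauses unused, so that the chosen literals
-- satisfy them.  The factor enters only through s ^ 2 / 2 ≤ exp s.
--
-- The clauses say that the verifier's tableau, with its rows of length W laid
-- end to end, does not reject: square j + W + 1 is a function of the squares
-- j, j + 1 and j + 2.  The clauses of square j are thus a shift of fixed
-- patterns, which lets a program write the adjacency matrix row by row by
-- shifting strings.  Programs work on stacks and have only loops over the
-- padded input, hence run in polynomial time whatever they do.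

-- The obstacle is that `P` and `NP` speak of concrete machines, so the whole reduction must run on
-- one. No intermediate problem such as satisfiability appears: an arbitrary verifier is translated
-- directly, and the approximating machine is simulated inside the decider. To spare that machine
-- all arithmetic, the input is padded by a constant `C` that dominates every coefficient in sight.
-- With m the padded length, each polynomial is then bounded by a power of m. The margin of the rows
-- and the numbers E of squares, J of clause indices and K of copies are taken to be such powers,
-- and e nested loops make exactly m ^ e rounds.
--
-- K can be chosen large enough because the order N of the digraph is only linear in K. Let q be the
-- size of the quasi-kernel that comes from a satisfying assignment; it does not depend on K. An
-- answer of size x within the factor satisfies x ^ 2 ≤ 2 N q ^ 2. For fixed E and J this bound is
-- linear in K, so K ^ 2 overtakes it.
--
-- `P=NP` is an equality of classes, so the inclusion of `P` in `NP` also has to be realised by a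
-- machine.

open import Defs
open import Data.Bool.Base using (Bool; true; false; T; not; _∧_; _∨_; if_then_else_)
open import Data.Empty using (⊥; ⊥-elim)
open import Data.Fin.Base as Fin using (Fin; zero; suc; toℕ; fromℕ<; _↑ˡ_; _↑ʳ_)
open import Data.Fin.Patterns
open import Data.Fin.Properties as Finₚ using (splitAt-join; remQuot-combine)
open import Data.Fin.Subset as Subset using (Subset; ∣_∣)
open import Data.Fin.Subset.Properties as Subsetₚ using ()
open import Data.Integer.Base as ℤ using (ℤ; -[1+_])
open import Data.Integer.Properties as ℤₚ using ()
open import Data.List.Base as List using (List; []; _∷_; _++_; [_]; _∷ʳ_; length; replicate; reverse; _ʳ++_; foldl)
open import Data.List.Membership.Propositional using (_∈_)
open import Data.List.Membership.Propositional.Properties as ∈ₚ using ()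
open import Data.List.Properties as Listₚ using ()
open import Data.List.Relation.Unary.All as All using (All; []; _∷_)
open import Data.List.Relation.Unary.All.Properties as Allₚ using ()
open import Data.List.Relation.Unary.AllPairs using ([]; _∷_)
open import Data.List.Relation.Unary.Any as Any using (Any)
open import Data.Maybe.Base as Maybe using (Maybe; just; nothing; maybe)
open import Data.Nat.Base as ℕ using (ℕ; zero; suc; _+_; _*_; _∸_; _^_; _≤_; _<_; z≤n; s≤s)
open import Data.Nat.DivMod using (_/_; _%_; m%n<n; m≡m%n+[m/n]*n; [m+kn]%n≡m%n; m<n⇒m%n≡m; m<n⇒m/n≡0; +-distrib-/-∣ʳ; m*n/n≡m)
open import Data.Nat.Coprimality as Coprime using ()
open import Data.Nat.Divisibility using (divides)
open import Data.Nat.Properties as ℕₚ using (+-assoc; +-comm; +-identityʳ; +-suc; *-comm; *-assoc; *-identityʳ; ≤-refl; ≤-reflexive; ≤-trans; m≤m+n; m≤n+m; +-mono-≤; +-monoˡ-≤; +-monoʳ-≤; *-mono-≤; *-monoˡ-≤; *-monoʳ-≤; ^-monoʳ-≤; ^-monoˡ-≤; n≤1+n; module ≤-Reasoning)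
open import Data.Nat.Tactic.RingSolver using (solve-∀)
open import Data.Product.Base using (Σ; ∃; ∃₂; ∃-syntax; _×_; _,_; proj₁; proj₂; map₁)
open import Data.Rational.Base as ℚ using (ℚ; 0ℚ; 1ℚ)
open import Data.Rational.Properties as ℚₚ using ()
import Data.Rational.Solver as ℚSolver
open import Data.Sum.Base as Sum using (_⊎_; inj₁; inj₂)
open import Data.Unit.Base using (⊤; tt)
open import Data.Vec.Base as Vec using (Vec; []; _∷_; lookup; _[_]≔_)
open import Data.Vec.Properties as Vecₚ using ()
open import Function.Base using (id; _∘_)
open import Function.Bundles using (_⇔_; mk⇔; Equivalence)
open import Relation.Binary.Construct.Closure.ReflexiveTransitive using (ε; _◅_)
open import Relation.Binary.PropositionalEquality hiding ([_]; J)
open import Relation.Nullary.Decidable.Core using (Dec; yes; no; ⌊_⌋)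
open import Relation.Nullary.Negation.Core using (¬_; contradiction)
open import Relation.Unary using (U)

-- Finite types

-- A retraction from an initial segment of the numbers: `element` may repeat values. This already
-- gives decidable equality and a complete list of elements, and it passes along any map with a
-- one-sided inverse.
record Finite (A : Set) : Set where
  field
    card          : ℕ
    index         : A → Fin card
    element       : Fin card → A
    element-index : ∀ x → element (index x) ≡ x

  elements : List A
  elements = List.tabulate element

  ∈-elements : ∀ x → x ∈ elements
  ∈-elements x = subst (_∈ elements) (element-index x) (∈ₚ.∈-tabulate⁺ (index x))

  _≟_ : (x y : A) → Dec (x ≡ y)
  x ≟ y with index x Finₚ.≟ index y
  ... | yes p = yes (trans (sym (element-index x)) (trans (cong element p) (element-index y)))
  ... | no ¬p = no (¬p ∘ cong index)

  infix 4 _==_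
  _==_ : A → A → Bool
  x == y = ⌊ x ≟ y ⌋

  ==-refl : ∀ x → (x == x) ≡ true
  ==-refl x with x ≟ x
  ... | yes _ = refl
  ... | no ¬p = contradiction refl ¬p

  ==⇒≡ : ∀ {x y} → T (x == y) → x ≡ y
  ==⇒≡ {x} {y} t with x ≟ y
  ... | yes p = p

module _ {A B : Set} where

  finite-retract : (f : A → B) (g : B → A) → (∀ x → g (f x) ≡ x) → Finite B → Finite A
  finite-retract f g gf F = record
    { card          = card
    ; index         = index ∘ f
    ; element       = g ∘ element
    ; element-index = λ x → trans (cong g (element-index (f x))) (gf x)
    } where open Finite F

  finite-⊎ : Finite A → Finite B → Finite (A ⊎ B)
  finite-⊎ F G = record
    { card          = card F + card G
    ; index         = Fin.join (card F) (card G) ∘ Sum.map (index F) (index G)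
    ; element       = Sum.map (element F) (element G) ∘ Fin.splitAt (card F)
    ; element-index = λ where
        (inj₁ x) → trans (cong (Sum.map (element F) (element G)) (splitAt-join (card F) (card G) (inj₁ (index F x)))) (cong inj₁ (element-index F x))
        (inj₂ y) → trans (cong (Sum.map (element F) (element G)) (splitAt-join (card F) (card G) (inj₂ (index G y)))) (cong inj₂ (element-index G y))
    } where open Finite

  finite-× : Finite A → Finite B → Finite (A × B)
  finite-× F G = record
    { card          = card F * card G
    ; index         = λ (x , y) → Fin.combine (index F x) (index G y)
    ; element       = λ i → let (j , k) = Fin.remQuot (card G) i in element F j , element G k
    ; element-index = λ (x , y) → trans
        (cong (λ (j , k) → element F j , element G k) (remQuot-combine (index F x) (index G y)))
        (cong₂ _,_ (element-index F x) (element-index G y))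
    } where open Finite

finite-Fin : ∀ n → Finite (Fin n)
finite-Fin n = record { card = n ; index = id ; element = id ; element-index = λ _ → refl }

finite-⊤ : Finite ⊤
finite-⊤ = record { card = 1 ; index = λ _ → zero ; element = λ _ → tt ; element-index = λ _ → refl }

finite-Maybe : ∀ {A} → Finite A → Finite (Maybe A)
finite-Maybe F = finite-retract (maybe inj₂ (inj₁ tt)) Sum.[ (λ _ → nothing) , just ]′
  (λ { nothing → refl ; (just _) → refl }) (finite-⊎ finite-⊤ F)

finite-Bool : Finite Bool
finite-Bool = record
  { card          = 2
  ; index         = λ { false → 0F ; true → 1F }
  ; element       = λ { 0F → false ; 1F → true }
  ; element-index = λ { false → refl ; true → refl }
  }

finite-Symbol : ∀ k → Finite (Symbol k)
finite-Symbol k = finite-retract to from (λ { blank → refl ; (bit _) → refl ; (work _) → refl })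
  (finite-Maybe (finite-⊎ finite-Bool (finite-Fin k)))
  where
  to : Symbol k → Maybe (Bool ⊎ Fin k)
  to blank    = nothing
  to (bit b)  = just (inj₁ b)
  to (work i) = just (inj₂ i)
  from : Maybe (Bool ⊎ Fin k) → Symbol k
  from nothing         = blank
  from (just (inj₁ b)) = bit b
  from (just (inj₂ i)) = work i

-- Machines that exit, and their sequential composition, branching and iteration

module Machines (k : ℕ) where

  Letter : Set
  Letter = Symbol k

  -- A machine leaves by a transition into `nothing`, which still writes and moves, whereas a `TM`
  -- stops in a configuration without transition. Composition thus only redirects the leaving
  -- transitions, and running times add up exactly.
  record Machine : Set₁ where
    no-eta-equality
    field
      State  : Set
      finite : Finite State
      start  : State
      δ      : State → Letter → Maybe State × Letter × Move

  open Machine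
  open Tape using (here)

  act : Letter × Move → Tape Letter → Tape Letter
  act (a , m) t = move m (write a t)

  -- A run from a state, or from nothing once the machine has exited.
  data Run (M : Machine) : Maybe (State M) → Tape Letter → ℕ → Tape Letter → Set where
    exit : ∀ {t} → Run M nothing t 0 t
    more : ∀ {s t n t′} →
           Run M (proj₁ (δ M s (here t))) (act (proj₂ (δ M s (here t))) t) n t′ →
           Run M (just s) t (suc n) t′

  infix 3 _∶_⟶_within_
  _∶_⟶_within_ : Machine → Tape Letter → Tape Letter → ℕ → Set
  M ∶ t ⟶ t′ within n = ∃[ n′ ] n′ ≤ n × Run M (just (start M)) t n′ t′

  relax : ∀ {M t t′ n n′} → n ≤ n′ → M ∶ t ⟶ t′ within n → M ∶ t ⟶ t′ within n′
  relax n≤ (_ , p , r) = _ , ≤-trans p n≤ , r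

  once : (Letter → Letter × Move) → Machine
  once g = record { State = ⊤ ; finite = finite-⊤ ; start = tt ; δ = λ _ a → nothing , g a }

  once-run : ∀ g t → once g ∶ t ⟶ act (g (here t)) t within 1
  once-run g t = 1 , ≤-refl , more exit

  infixr 5 _▹_
  _▹_ : Machine → Machine → Machine
  M ▹ N = record
    { State  = State M ⊎ State N
    ; finite = finite-⊎ (finite M) (finite N)
    ; start  = inj₁ (start M)
    ; δ      = λ { (inj₁ s) a → map₁ (just ∘ maybe inj₁ (inj₂ (start N))) (δ M s a)
                 ; (inj₂ s) a → map₁ (Maybe.map inj₂) (δ N s a) }
    }

  module _ {M N : Machine} where

    private
      second : ∀ {s t n t′} → Run N s t n t′ → Run (M ▹ N) (Maybe.map inj₂ s) t n t′
      second exit     = exit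
      second (more r) = more (second r)

      first : ∀ {s t n t′ n′ t″} → Run M s t n t′ → Run N (just (start N)) t′ n′ t″ →
              Run (M ▹ N) (just (maybe inj₁ (inj₂ (start N)) s)) t (n + n′) t″
      first exit     q = second q
      first (more r) q = more (first r q)

    infixr 5 _▹-run_
    _▹-run_ : ∀ {t t′ t″ n n′} → M ∶ t ⟶ t′ within n → N ∶ t′ ⟶ t″ within n′ → M ▹ N ∶ t ⟶ t″ within n + n′
    (_ , p , r) ▹-run (_ , q , s) = _ , +-mono-≤ p q , first r s

  branch : (Letter → Bool) → Machine → Machine → Machine
  branch c M N = record
    { State  = ⊤ ⊎ (State M ⊎ State N)
    ; finite = finite-⊎ finite-⊤ (finite-⊎ (finite M) (finite N))
    ; start  = inj₁ tt
    ; δ      = λ { (inj₁ _)        a → just (inj₂ (if c a then inj₁ (start M) else inj₂ (start N))) , a , stay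
                 ; (inj₂ (inj₁ s)) a → map₁ (Maybe.map (inj₂ ∘ inj₁)) (δ M s a)
                 ; (inj₂ (inj₂ s)) a → map₁ (Maybe.map (inj₂ ∘ inj₂)) (δ N s a) }
    }

  module _ {c : Letter → Bool} {M N : Machine} where

    private
      then-run : ∀ {s t n t′} → Run M s t n t′ → Run (branch c M N) (Maybe.map (inj₂ ∘ inj₁) s) t n t′
      then-run exit     = exit
      then-run (more r) = more (then-run r)

      else-run : ∀ {s t n t′} → Run N s t n t′ → Run (branch c M N) (Maybe.map (inj₂ ∘ inj₂) s) t n t′
      else-run exit     = exit
      else-run (more r) = more (else-run r)

    branch-true : ∀ {t t′ n} → c (here t) ≡ true → M ∶ t ⟶ t′ within n → branch c M N ∶ t ⟶ t′ within suc n
    branch-true {t} e (_ , p , r) = _ , s≤s p , more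
      (subst (λ b → Run (branch c M N) (just (inj₂ (if b then inj₁ (start M) else inj₂ (start N)))) t _ _) (sym e) (then-run r))

    branch-false : ∀ {t t′ n} → c (here t) ≡ false → N ∶ t ⟶ t′ within n → branch c M N ∶ t ⟶ t′ within suc n
    branch-false {t} e (_ , p , r) = _ , s≤s p , more
      (subst (λ b → Run (branch c M N) (just (inj₂ (if b then inj₁ (start M) else inj₂ (start N)))) t _ _) (sym e) (else-run r))

  while : (Letter → Bool) → Machine → Machine
  while c M = record
    { State  = ⊤ ⊎ State M
    ; finite = finite-⊎ finite-⊤ (finite M)
    ; start  = inj₁ tt
    ; δ      = λ { (inj₁ _) a → (if c a then just (inj₂ (start M)) else nothing) , a , stay
                 ; (inj₂ s) a → map₁ (just ∘ maybe inj₂ (inj₁ tt)) (δ M s a) }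
    }

  module _ {c : Letter → Bool} {M : Machine} where

    while-stop : ∀ {t} → c (here t) ≡ false → while c M ∶ t ⟶ t within 1
    while-stop {t} e = 1 , ≤-refl , more
      (subst (λ b → Run (while c M) (if b then just (inj₂ (start M)) else nothing) t 0 t) (sym e) exit)

    private
      loop : ∀ {s t n t′ n′ t″} → Run M s t n t′ → Run (while c M) (just (inj₁ tt)) t′ n′ t″ →
             Run (while c M) (just (maybe inj₂ (inj₁ tt) s)) t (n + n′) t″
      loop exit     q = q
      loop (more r) q = more (loop r q)

    while-step : ∀ {t t′ t″ n n′} → c (here t) ≡ true → M ∶ t ⟶ t′ within n → while c M ∶ t′ ⟶ t″ within n′ →
                 while c M ∶ t ⟶ t″ within suc (n + n′)
    while-step {t} e (_ , p , r) (_ , q , s) = _ , s≤s (+-mono-≤ p q) , more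
      (subst (λ b → Run (while c M) (if b then just (inj₂ (start M)) else nothing) t _ _) (sym e) (loop r s))

  private
    pred′ : ∀ {n} → Fin (suc (suc n)) → Fin (suc n)
    -- A dummy value: `switch` consults `pred′` only after the branch for zero has been ruled out.
    pred′ zero    = zero
    pred′ (suc i) = i

    isZero : ∀ {n} → Fin n → Bool
    isZero zero    = true
    isZero (suc _) = false

  switch : ∀ n → (Letter → Fin (suc n)) → (Fin (suc n) → Machine) → Machine
  switch zero    h M = M zero
  switch (suc n) h M = branch (isZero ∘ h) (M zero) (switch n (pred′ ∘ h) (M ∘ suc))

  switch-run : ∀ n {h M t t′ m} → M (h (here t)) ∶ t ⟶ t′ within m → switch n h M ∶ t ⟶ t′ within (n + m)
  switch-run zero {h} {t = t} r with h (here t)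
  ... | zero = r
  switch-run (suc n) {h} {M} {t} {t′} {m} r with h (here t) in eq
  ... | zero  = relax (s≤s (m≤n+m m n)) (branch-true (cong isZero eq) r)
  ... | suc i = branch-false (cong isZero eq) (switch-run n {M = M ∘ suc}
                  (subst (λ j → M (suc j) ∶ t ⟶ t′ within m) (sym (cong pred′ eq)) r))

  -- The additional first state only makes the initial state number zero.
  toTM : Machine → TM
  toTM M = record
    { states-1 = Finite.card states
    ; extra    = k
    ; δ        = λ { zero a → just (suc (index (just (start M))) , a , stay)
                   ; (suc i) a → next-state (element i) a }
    }
    where
    states = finite-Maybe (finite M)
    open Finite states
    next-state : Maybe (State M) → Letter → Maybe (Fin (suc card) × Letter × Move)
    next-state nothing  a = nothing
    next-state (just s) a = just (map₁ (suc ∘ index) (δ M s a))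

  module _ (M : Machine) where
    open Finite (finite-Maybe (finite M))

    private
      haltsFrom : ∀ {s t n t′} → Run M s t n t′ →
                  HaltsFrom (toTM M) (suc (index s) , t) n (suc (index nothing) , t′)
      haltsFrom exit = halt refl
      haltsFrom {just s} {t} (more r) = next
        (stepped {i = index (just s)} (element-index (just s))) (haltsFrom r)
        where
        stepped : ∀ {i} → element i ≡ just s →
                  Defs.step (toTM M) (suc i , t) ≡
                  just (suc (index (proj₁ (δ M s (here t)))) , act (proj₂ (δ M s (here t))) t)
        stepped e rewrite e = refl

    toTM-run : ∀ {t t′ n} → M ∶ t ⟶ t′ within n →
               ∃[ n′ ] ∃[ q ] n′ ≤ suc n × HaltsFrom (toTM M) (zero , t) n′ (q , t′)
    toTM-run (_ , p , r) = _ , _ , s≤s p , next refl (haltsFrom r)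

-- Polynomially bounded functions

-- The base `suc x` is positive, so powers increase with the exponent even at x = 0, and two bounds
-- can be brought to a common exponent in a sum.
PolyBounded : (ℕ → ℕ) → Set
PolyBounded f = ∃₂ λ a k → ∀ x → f x ≤ a * suc x ^ k

private
  ^-positive : ∀ x k → 1 ≤ suc x ^ k
  ^-positive x zero    = ≤-refl
  ^-positive x (suc k) = *-mono-≤ (s≤s (z≤n {x})) (^-positive x k)

  swap-middle : ∀ a b c d → (a * c) * (b * d) ≡ (a * b) * (c * d)
  swap-middle = solve-∀

^-distribʳ-* : ∀ k a b → (a * b) ^ k ≡ a ^ k * b ^ k
^-distribʳ-* zero    a b = refl
^-distribʳ-* (suc k) a b = trans (cong (a * b *_) (^-distribʳ-* k a b)) (swap-middle a (a ^ k) b (b ^ k))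

const-poly : ∀ c → PolyBounded (λ _ → c)
const-poly c = c , 0 , λ x → ≤-reflexive (sym (*-identityʳ c))

id-poly : PolyBounded id
id-poly = 1 , 1 , λ x → ≤-trans (n≤1+n x) (≤-reflexive (sym (trans (ℕₚ.*-identityˡ _) (*-identityʳ (suc x)))))

*-poly : ∀ {f g} → PolyBounded f → PolyBounded g → PolyBounded (λ x → f x * g x)
*-poly {f} {g} (a , k , p) (b , l , q) = a * b , k + l , λ x → begin
  f x * g x                         ≤⟨ *-mono-≤ (p x) (q x) ⟩
  (a * suc x ^ k) * (b * suc x ^ l) ≡⟨ swap-middle a b (suc x ^ k) (suc x ^ l) ⟩
  (a * b) * (suc x ^ k * suc x ^ l) ≡⟨ cong (a * b *_) (sym (ℕₚ.^-distribˡ-+-* (suc x) k l)) ⟩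
  (a * b) * suc x ^ (k + l)         ∎
  where open ≤-Reasoning

+-poly : ∀ {f g} → PolyBounded f → PolyBounded g → PolyBounded (λ x → f x + g x)
+-poly {f} {g} (a , k , p) (b , l , q) = a + b , k + l , λ x → begin
  f x + g x                                     ≤⟨ +-mono-≤ (p x) (q x) ⟩
  a * suc x ^ k + b * suc x ^ l                 ≤⟨ +-mono-≤ (*-monoʳ-≤ a (^-monoʳ-≤ (suc x) (m≤m+n k l)))
                                                            (*-monoʳ-≤ b (^-monoʳ-≤ (suc x) (m≤n+m l k))) ⟩
  a * suc x ^ (k + l) + b * suc x ^ (k + l)     ≡⟨ sym (ℕₚ.*-distribʳ-+ _ a b) ⟩
  (a + b) * suc x ^ (k + l)                     ∎
  where open ≤-Reasoning

^-poly : ∀ {f} k → PolyBounded f → PolyBounded (λ x → f x ^ k)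
^-poly zero    p = const-poly 1
^-poly (suc k) p = *-poly p (^-poly k p)

∘-poly : ∀ {f g} → PolyBounded f → PolyBounded g → PolyBounded (f ∘ g)
∘-poly {f} {g} (a , k , p) q =
  let (b , l , r) = *-poly (const-poly a) (^-poly k (+-poly (const-poly 1) q))
  in b , l , λ x → ≤-trans (p (g x)) (r x)

-- For x ≥ 1 one has 1 + x ≤ 2 x, hence the factor 2 ^ k; the summand 1 beside x ^ k takes care of x
-- = 0.
poly-bound : ∀ {f} → PolyBounded f → ∃₂ λ a k → ∀ x → f x ≤ poly a k x
poly-bound {f} (a , k , p) = a * 2 ^ k , k , λ x → begin
  f x                          ≤⟨ p x ⟩
  a * suc x ^ k                ≤⟨ *-monoʳ-≤ a (suc-^ x) ⟩
  a * (2 ^ k * (1 + x ^ k))    ≡⟨ expand a (2 ^ k) (x ^ k) ⟩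
  poly (a * 2 ^ k) k x         ∎
  where
  open ≤-Reasoning
  expand : ∀ a b c → a * (b * (1 + c)) ≡ a * b + a * b * c
  expand = solve-∀
  suc-^ : ∀ x → suc x ^ k ≤ 2 ^ k * (1 + x ^ k)
  suc-^ zero    = begin
    1 ^ k             ≤⟨ ^-monoˡ-≤ k (s≤s (z≤n {1})) ⟩
    2 ^ k             ≤⟨ ℕₚ.m≤m*n (2 ^ k) (1 + 0 ^ k) ⟩
    2 ^ k * (1 + 0 ^ k) ∎
  suc-^ x@(suc y) = begin
    suc x ^ k           ≤⟨ ^-monoˡ-≤ k (≤-trans (≤-reflexive (+-comm 1 x)) (+-monoʳ-≤ x (s≤s z≤n))) ⟩
    (2 * x) ^ k         ≡⟨ ^-distribʳ-* k 2 x ⟩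
    2 ^ k * x ^ k       ≤⟨ *-monoʳ-≤ (2 ^ k) (n≤1+n _) ⟩
    2 ^ k * (1 + x ^ k) ∎

sumFin : ∀ n → (Fin n → ℕ) → ℕ
sumFin zero    f = 0
sumFin (suc n) f = f zero + sumFin n (f ∘ suc)

sumFin-≥ : ∀ {n} (f : Fin n → ℕ) i → f i ≤ sumFin n f
sumFin-≥ f zero    = m≤m+n (f zero) _
sumFin-≥ f (suc i) = ≤-trans (sumFin-≥ (f ∘ suc) i) (m≤n+m _ (f zero))

sumFin-poly : ∀ n {f : ℕ → Fin n → ℕ} → (∀ i → PolyBounded (λ x → f x i)) → PolyBounded (λ x → sumFin n (f x))
sumFin-poly zero    p = const-poly 0
sumFin-poly (suc n) p = +-poly (p zero) (sumFin-poly n (p ∘ suc))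

-- Stack programs whose loops all run over one fixed word, the clock

module Programs (Γ : Set) (F : Finite Γ) (s : ℕ) where

  open Finite F

  infixr 5 _⨾_

  -- `case` pops; its branch gets the popped symbol, or nothing if the stack is empty.
  data Prog : Set where
    skip : Prog
    push : Fin s → Γ → Prog
    case : Fin s → (Maybe Γ → Prog) → Prog
    _⨾_  : Prog → Prog → Prog
    each : (Γ → Prog) → Prog

  Store : Set
  Store = Vec (List Γ) s

  pop : List Γ → List Γ
  pop []       = []
  pop (_ ∷ as) = as

  exec : List Γ → Prog → Store → Store
  exec c skip       v = v
  exec c (push i a) v = v [ i ]≔ (a ∷ lookup v i)
  exec c (case i f) v = exec c (f (List.head (lookup v i))) (v [ i ]≔ pop (lookup v i))
  exec c (p ⨾ q)    v = exec c q (exec c p v)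
  exec c (each f)   v = foldl (λ v a → exec c (f a) v) v c

  -- Every primitive lengthens the used part of the tape by at most one cell
  -- for each operation counted here.
  ops : Prog → ℕ → ℕ
  ops skip       c = 1
  ops (push i a) c = 1
  ops (case i f) c = 1 + (ops (f nothing) c + sumFin card (λ x → ops (f (just (element x))) c))
  ops (p ⨾ q)    c = ops p c + ops q c
  ops (each f)   c = 1 + (c * (2 + sumFin card (λ x → ops (f (element x)) c)) + 1)

  ops-poly : ∀ p → PolyBounded (ops p)
  ops-poly skip       = const-poly 1
  ops-poly (push i a) = const-poly 1
  ops-poly (case i f) = +-poly (const-poly 1) (+-poly (ops-poly (f nothing)) (sumFin-poly card (λ x → ops-poly (f (just (element x))))))
  ops-poly (p ⨾ q)    = +-poly (ops-poly p) (ops-poly q)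
  ops-poly (each f)   = +-poly (const-poly 1) (+-poly (*-poly id-poly (+-poly (const-poly 2) (sumFin-poly card (λ x → ops-poly (f (element x)))))) (const-poly 1))

  -- Bounds the nesting depth of the loops.
  depth : Prog → ℕ
  depth skip       = 0
  depth (push i a) = 0
  depth (case i f) = depth (f nothing) + sumFin card (λ x → depth (f (just (element x))))
  depth (p ⨾ q)    = depth p + depth q
  depth (each f)   = suc (sumFin card (λ x → depth (f (element x))))

-- Compilation of stack programs

++-cancelˡ-length : ∀ {A : Set} (as bs : List A) {cs ds} → length as ≡ length bs → as ++ cs ≡ bs ++ ds → cs ≡ ds
++-cancelˡ-length []       []       _ e = e
++-cancelˡ-length (a ∷ as) (b ∷ bs) p e = ++-cancelˡ-length as bs (ℕₚ.suc-injective p) (Listₚ.∷-injectiveʳ e)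

map-++⁻ : ∀ {A B : Set} (f : A → B) cs as {bs} → List.map f cs ≡ as ++ bs →
          ∃₂ λ xs ys → cs ≡ xs ++ ys × List.map f xs ≡ as × List.map f ys ≡ bs
map-++⁻ f cs       []       e = [] , cs , refl , refl , e
map-++⁻ f (c ∷ cs) (a ∷ as) e with map-++⁻ f cs as (Listₚ.∷-injectiveʳ e)
... | xs , ys , p , q , r = c ∷ xs , ys , cong (c ∷_) p , cong₂ _∷_ (Listₚ.∷-injectiveˡ e) q , r

replicate-+ : ∀ {A : Set} m n {a : A} → replicate (m + n) a ≡ replicate m a ++ replicate n a
replicate-+ zero    n = refl
replicate-+ (suc m) n = cong (_ ∷_) (replicate-+ m n)

encodeVec : ∀ {b n} → Vec (Fin b) n → Fin (b ^ n)
encodeVec []       = zero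
encodeVec (x ∷ xs) = Fin.combine x (encodeVec xs)

decodeVec : ∀ {b} n → Fin (b ^ n) → Vec (Fin b) n
decodeVec         zero    _ = []
decodeVec {b = b} (suc n) i = proj₁ (Fin.remQuot {b} (b ^ n) i) ∷ decodeVec n (proj₂ (Fin.remQuot {b} (b ^ n) i))

decode-encode : ∀ {b n} (xs : Vec (Fin b) n) → decodeVec n (encodeVec xs) ≡ xs
decode-encode             []       = refl
decode-encode {n = suc n} (x ∷ xs) = cong₂ _∷_ (cong proj₁ e) (trans (cong (decodeVec n ∘ proj₂) e) (decode-encode xs))
  where e = remQuot-combine x (encodeVec xs)

-- The right half of the tape holds one cell per position, with a track for
-- the clock, for each of the D loop positions and for each stack.  A stack
-- lies in its track with its bottom in the first cell.  The cell to the left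
-- of all others is blank, and between operations the head is there.

module Compile (Γ : Set) (F : Finite Γ) (s : ℕ) (mark : Γ) (D k : ℕ)
  (code : Vec (Fin (suc (Finite.card F))) (suc (D + s)) → Fin k)
  (decode : Fin k → Vec (Fin (suc (Finite.card F))) (suc (D + s)))
  (decode-code : ∀ c → decode (code c) ≡ c) where

  open Programs Γ F s
  open Finite F

  tracks : ℕ
  tracks = suc (D + s)

  Cell : Set
  Cell = Vec (Fin (suc card)) tracks

  open Machines k public
  open Machine

  symbol : Γ → Fin (suc card)
  symbol a = suc (index a)

  empty : Cell
  empty = Vec.replicate tracks zero

  letter : Cell → Letter
  letter c = work (code c)

  cell : Letter → Cell
  cell (work i) = decode i
  cell _        = empty

  cell-letter : ∀ c → cell (letter c) ≡ c
  cell-letter = decode-code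

  clockTrack : Fin tracks
  clockTrack = zero

  loopTrack : Fin D → Fin tracks
  loopTrack d = suc (d ↑ˡ s)

  stackTrack : Fin s → Fin tracks
  stackTrack i = suc (D ↑ʳ i)

  column : Fin tracks → List Cell → List (Fin (suc card))
  column i = List.map (λ c → lookup c i)

  Column : List (Fin (suc card)) → List Γ → Set
  Column xs as = ∃[ z ] xs ≡ List.map symbol (reverse as) ++ replicate z zero

  Stored : List Cell → Vec (List Γ) tracks → Set
  Stored cs v = ∀ i → Column (column i cs) (lookup v i)

  home : List Cell → Tape Letter
  home cs = tape [] blank (List.map letter cs)

  at : List Cell → Cell → List Cell → Tape Letter
  at xs y ys = tape (List.map letter xs ʳ++ [ blank ]) (letter y) (List.map letter ys)

  isCell : Letter → Bool
  isCell blank = false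
  isCell _     = true

  track : Fin tracks → Letter → Fin (suc card)
  track i a = lookup (cell a) i

  nonzero : Fin (suc card) → Bool
  nonzero zero    = false
  nonzero (suc _) = true

  occupied : Fin tracks → Letter → Bool
  occupied i = nonzero ∘ track i

  goLeft goRight idle : Machine
  goLeft  = once (λ a → a , left)
  goRight = once (λ a → a , right)
  idle    = once (λ a → a , stay)

  -- The last step turns the blank beyond the used tape into an empty cell, so that the head ends on
  -- a cell in every case. On a letter that already represents a cell it changes nothing.
  seek : Fin tracks → Machine
  seek i = goRight ▹ while (occupied i) goRight ▹ once (λ a → letter (cell a) , stay)

  put : Fin tracks → Fin (suc card) → Machine
  put i x = once (λ a → letter (cell a [ i ]≔ x) , stay)

  homeward : Machine
  homeward = while isCell goLeft

  clear : Fin tracks → Machine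
  clear i = while isCell (put i zero ▹ goLeft)

  place : List Letter → List Letter → Tape Letter
  place ls []       = tape ls blank []
  place ls (a ∷ as) = tape ls a as

  move-right : ∀ ls a rs → move right (tape ls a rs) ≡ place (a ∷ ls) rs
  move-right ls a []       = refl
  move-right ls a (_ ∷ rs) = refl

  goRight-run : ∀ ls a rs → goRight ∶ tape ls a rs ⟶ place (a ∷ ls) rs within 1
  goRight-run ls a rs = subst (λ t → goRight ∶ tape ls a rs ⟶ t within 1) (move-right ls a rs) (once-run _ _)

  goLeft-run : ∀ xs x y ys → goLeft ∶ at (xs ∷ʳ x) y ys ⟶ at xs x (y ∷ ys) within 1
  goLeft-run xs x y ys = subst (λ ls → goLeft ∶ tape ls (letter y) (List.map letter ys) ⟶ at xs x (y ∷ ys) within 1)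
    (sym (trans (cong (_ʳ++ [ blank ]) (Listₚ.map-++ letter xs [ x ])) (Listₚ.++-ʳ++ (List.map letter xs))))
    (once-run _ _)

  skip-occupied : ∀ i ls xs zs → All (λ c → nonzero (lookup c i) ≡ true) xs →
                  (∀ t → t ≡ place (List.map letter xs ʳ++ ls) zs → occupied i (Tape.here t) ≡ false) →
                  while (occupied i) goRight ∶ place ls (List.map letter xs ++ zs)
                    ⟶ place (List.map letter xs ʳ++ ls) zs within length xs * 2 + 1
  skip-occupied i ls []       zs []       stop = while-stop (stop _ refl)
  skip-occupied i ls (x ∷ xs) zs (p ∷ ps) stop = while-step
    (trans (cong (λ c → nonzero (lookup c i)) (cell-letter x)) p)
    (goRight-run ls (letter x) (List.map letter xs ++ zs))
    (skip-occupied i (letter x ∷ ls) xs zs ps stop)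

  all-occupied : ∀ i xs as → column i xs ≡ List.map symbol as → All (λ c → nonzero (lookup c i) ≡ true) xs
  all-occupied i []       []       e = []
  all-occupied i (x ∷ xs) (a ∷ as) e = cong nonzero (Listₚ.∷-injectiveˡ e) ∷ all-occupied i xs as (Listₚ.∷-injectiveʳ e)

  replicate-∷ʳ : ∀ {A : Set} n (a : A) → replicate n a ∷ʳ a ≡ replicate (suc n) a
  replicate-∷ʳ zero    a = refl
  replicate-∷ʳ (suc n) a = cong (a ∷_) (replicate-∷ʳ n a)

  replicate-++⁻ : ∀ {A : Set} n {a : A} {x xs} → x ∷ xs ≡ replicate n a → x ≡ a × ∃[ m ] xs ≡ replicate m a
  replicate-++⁻ (suc n) e = Listₚ.∷-injectiveˡ e , n , Listₚ.∷-injectiveʳ e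

  Stored-empty : ∀ {cs v} → Stored cs v → Stored (cs ∷ʳ empty) v
  Stored-empty {cs} {v} st i = let (z , e) = st i in suc z , (begin
    column i (cs ∷ʳ empty)                                    ≡⟨ Listₚ.map-++ _ cs [ empty ] ⟩
    column i cs ∷ʳ lookup empty i                             ≡⟨ cong₂ _∷ʳ_ e (Vecₚ.lookup-replicate i zero) ⟩
    (List.map symbol (reverse (lookup v i)) ++ replicate z zero) ∷ʳ zero
                                                              ≡⟨ Listₚ.++-assoc (List.map symbol (reverse (lookup v i))) _ _ ⟩
    List.map symbol (reverse (lookup v i)) ++ (replicate z zero ∷ʳ zero)
                                                              ≡⟨ cong (List.map symbol (reverse (lookup v i)) ++_) (replicate-∷ʳ z zero) ⟩
    List.map symbol (reverse (lookup v i)) ++ replicate (suc z) zero ∎)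
    where open ≡-Reasoning

  -- The head is on the first cell that is free in track i.
  record Sought (i : Fin tracks) (v : Vec (List Γ) tracks) (xs : List Cell) (y : Cell) (ys : List Cell) : Set where
    constructor sought
    field
      stored : Stored (xs ++ y ∷ ys) v
      below  : column i xs ≡ List.map symbol (reverse (lookup v i))
      free   : lookup y i ≡ zero
      above  : ∃[ z ] column i ys ≡ replicate z zero

  size : List Cell → Cell → List Cell → ℕ
  size xs y ys = length (xs ++ y ∷ ys)

  seekTime homeTime clearTime : ℕ → ℕ
  seekTime  B = 1 + ((B * 2 + 1) + 1)
  homeTime  B = B * 2 + 1
  clearTime B = B * 3 + 1

  seek-run : ∀ i cs v → Stored cs v →
             ∃[ xs ] ∃[ y ] ∃[ ys ] Sought i v xs y ys × size xs y ys ≤ suc (length cs) ×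
               (∀ {B} → length cs ≤ B → seek i ∶ home cs ⟶ at xs y ys within seekTime B)
  seek-run i cs v st with st i
  ... | z , e with map-++⁻ (λ c → lookup c i) cs (List.map symbol (reverse (lookup v i))) e
  ... | xs , zs , refl , p , q = found zs q st
    where
    reach : ∀ {B} zs → length (xs ++ zs) ≤ B → (∀ t → t ≡ place (List.map letter xs ʳ++ [ blank ]) (List.map letter zs) → occupied i (Tape.here t) ≡ false) →
            ∀ {t} → once (λ a → letter (cell a) , stay) ∶ place (List.map letter xs ʳ++ [ blank ]) (List.map letter zs) ⟶ t within 1 →
            seek i ∶ home (xs ++ zs) ⟶ t within seekTime B
    reach {B} zs le stop r =
      subst (λ as → goRight ∶ home (xs ++ zs) ⟶ place [ blank ] as within 1)
            (Listₚ.map-++ letter xs zs) (goRight-run [] blank (List.map letter (xs ++ zs))) ▹-run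
      relax (+-monoˡ-≤ 1 (*-monoˡ-≤ 2 (≤-trans (m≤m+n _ (length zs)) (≤-trans (≤-reflexive (sym (Listₚ.length-++ xs))) le))))
        (skip-occupied i [ blank ] xs (List.map letter zs) (all-occupied i xs _ p) stop) ▹-run
      r

    found : ∀ zs → column i zs ≡ replicate z zero → Stored (xs ++ zs) v →
            ∃[ xs′ ] ∃[ y ] ∃[ ys ] Sought i v xs′ y ys × size xs′ y ys ≤ suc (length (xs ++ zs)) ×
              (∀ {B} → length (xs ++ zs) ≤ B → seek i ∶ home (xs ++ zs) ⟶ at xs′ y ys within seekTime B)
    found [] q st = xs , empty , [] ,
      sought (subst (λ cs → Stored (cs ∷ʳ empty) v) (Listₚ.++-identityʳ xs) (Stored-empty {v = v} st)) p (Vecₚ.lookup-replicate i zero) (0 , refl) ,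
      ≤-reflexive (trans (Listₚ.length-++ xs) (trans (+-comm _ 1) (cong (suc ∘ length) (sym (Listₚ.++-identityʳ xs))))) ,
      λ le → reach [] le (λ { _ refl → cong nonzero (Vecₚ.lookup-replicate i zero) }) (once-run _ _)
    found (y ∷ ys) q st with replicate-++⁻ z q
    ... | y0 , ys0 = xs , y , ys , sought st p y0 ys0 , n≤1+n _ ,
      λ le → reach (y ∷ ys) le (λ { _ refl → cong nonzero (trans (cong (λ c → lookup c i) (cell-letter y)) y0) })
        (subst (λ c → once (λ a → letter (cell a) , stay) ∶ at xs y ys ⟶ tape (List.map letter xs ʳ++ [ blank ]) (letter c) (List.map letter ys) within 1)
               (cell-letter y) (once-run _ _))

  put-run : ∀ i x xs y ys → put i x ∶ at xs y ys ⟶ at xs (y [ i ]≔ x) ys within 1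
  put-run i x xs y ys = subst (λ c → put i x ∶ at xs y ys ⟶ at xs (c [ i ]≔ x) ys within 1) (cell-letter y) (once-run _ _)

  homeward-run′ : ∀ ls a as → (∀ t → t ≡ a → isCell t ≡ true) → All (λ l → isCell l ≡ true) ls →
                  homeward ∶ tape (ls ++ [ blank ]) a as ⟶ tape [] blank (ls ʳ++ a ∷ as) within suc (length ls) * 2 + 1
  homeward-run′ []       a as p _        = while-step (p a refl) (once-run _ _) (while-stop refl)
  homeward-run′ (l ∷ ls) a as p (q ∷ qs) = while-step (p a refl) (once-run _ _)
    (homeward-run′ ls l (a ∷ as) (λ { _ refl → q }) qs)

  letters-isCell : ∀ xs → All (λ l → isCell l ≡ true) (List.map letter xs)
  letters-isCell []       = []
  letters-isCell (x ∷ xs) = refl ∷ letters-isCell xs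

  homeward-run : ∀ {B} xs y ys → size xs y ys ≤ B → homeward ∶ at xs y ys ⟶ home (xs ++ y ∷ ys) within homeTime B
  homeward-run {B} xs y ys le = relax (+-monoˡ-≤ 1 (*-monoˡ-≤ 2 short)) (subst₂ (λ ls rs → homeward ∶ tape ls (letter y) (List.map letter ys) ⟶ tape [] blank rs within suc (length (reverse (List.map letter xs))) * 2 + 1)
      (sym (Listₚ.ʳ++-defn (List.map letter xs)))
      (trans (Listₚ.ʳ++-ʳ++ (List.map letter xs)) (sym (Listₚ.map-++ letter xs (y ∷ ys))))
      (homeward-run′ (reverse (List.map letter xs)) (letter y) (List.map letter ys) (λ { _ refl → refl }) (subst (All (λ l → isCell l ≡ true)) (Listₚ.reverse-map letter xs) (letters-isCell (reverse xs)))))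
    where
    short : suc (length (reverse (List.map letter xs))) ≤ B
    short = ≤-trans (s≤s (≤-trans (≤-reflexive (trans (Listₚ.length-reverse (List.map letter xs)) (Listₚ.length-map letter xs))) (m≤m+n (length xs) (length ys))))
      (≤-trans (≤-reflexive (trans (sym (+-suc (length xs) (length ys))) (sym (Listₚ.length-++ xs)))) le)

  column-put-other : ∀ {i j} x xs y ys → j ≢ i → column j (xs ++ (y [ i ]≔ x) ∷ ys) ≡ column j (xs ++ y ∷ ys)
  column-put-other x []       y ys j≢i = cong (_∷ column _ ys) (Vecₚ.lookup∘update′ j≢i y x)
  column-put-other x (_ ∷ xs) y ys j≢i = cong (_ ∷_) (column-put-other x xs y ys j≢i)

  column-put : ∀ i x xs y ys → column i (xs ++ (y [ i ]≔ x) ∷ ys) ≡ column i xs ++ x ∷ column i ys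
  column-put i x []       y ys = cong (_∷ column i ys) (Vecₚ.lookup∘update i y x)
  column-put i x (_ ∷ xs) y ys = cong (_ ∷_) (column-put i x xs y ys)

  size-put : ∀ i x xs y ys → size xs (y [ i ]≔ x) ys ≡ size xs y ys
  size-put i x xs y ys = trans (Listₚ.length-++ xs) (sym (Listₚ.length-++ xs))

  Stored-put : ∀ i x xs y ys v as → Stored (xs ++ y ∷ ys) v → Column (column i xs ++ x ∷ column i ys) as →
               Stored (xs ++ (y [ i ]≔ x) ∷ ys) (v [ i ]≔ as)
  Stored-put i x xs y ys v as st col j with j Finₚ.≟ i
  ... | yes refl = subst₂ Column (sym (column-put i x xs y ys)) (sym (Vecₚ.lookup∘update i v as)) col
  ... | no j≢i   = subst₂ Column (sym (column-put-other x xs y ys j≢i)) (sym (Vecₚ.lookup∘update′ j≢i v as)) (st j)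

  symbols-∷ : ∀ a as → List.map symbol (reverse (a ∷ as)) ≡ List.map symbol (reverse as) ∷ʳ symbol a
  symbols-∷ a as = trans (cong (List.map symbol) (Listₚ.unfold-reverse a as)) (Listₚ.map-++ symbol (reverse as) [ a ])

  Stored-push : ∀ {i v xs y ys} a → Sought i v xs y ys →
                Stored (xs ++ (y [ i ]≔ symbol a) ∷ ys) (v [ i ]≔ (a ∷ lookup v i))
  Stored-push {i} {v} {xs} {y} {ys} a (sought st below _ (z , above)) =
    Stored-put i (symbol a) xs y ys v (a ∷ lookup v i) st (z , (begin
      column i xs ++ symbol a ∷ column i ys                              ≡⟨ cong₂ (λ as bs → as ++ symbol a ∷ bs) below above ⟩
      List.map symbol (reverse (lookup v i)) ++ symbol a ∷ replicate z zero ≡⟨ Listₚ.++-assoc (List.map symbol (reverse (lookup v i))) [ symbol a ] _ ⟨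
      (List.map symbol (reverse (lookup v i)) ∷ʳ symbol a) ++ replicate z zero ≡⟨ cong (_++ replicate z zero) (symbols-∷ a (lookup v i)) ⟨
      List.map symbol (reverse (a ∷ lookup v i)) ++ replicate z zero     ∎))
    where open ≡-Reasoning

  Stored-pop : ∀ {i v xs y ys a as} → lookup v i ≡ a ∷ as → Sought i v xs y ys →
               ∃₂ λ xs′ x → xs ≡ xs′ ∷ʳ x × lookup x i ≡ symbol a × Stored (xs′ ++ (x [ i ]≔ zero) ∷ y ∷ ys) (v [ i ]≔ as)
  Stored-pop {i} {v} {xs} {y} {ys} {a} {as} e (sought st below free (z , above))
    with map-++⁻ (λ c → lookup c i) xs (List.map symbol (reverse as)) (trans below (trans (cong (List.map symbol ∘ reverse) e) (symbols-∷ a as)))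
  ... | xs′ , x ∷ [] , refl , p , q = xs′ , x , refl , Listₚ.∷-injectiveˡ q ,
    Stored-put i zero xs′ x (y ∷ ys) v as (subst (λ cs → Stored cs v) (Listₚ.++-assoc xs′ [ x ] (y ∷ ys)) st)
      (suc (suc z) , cong₂ _++_ p (cong (zero ∷_) (cong₂ _∷_ free above)))

  push-run : ∀ i a cs v → Stored cs v →
             ∃[ cs′ ] Stored cs′ (v [ i ]≔ (a ∷ lookup v i)) × length cs′ ≤ suc (length cs) ×
               (∀ {B} → suc (length cs) ≤ B →
                 seek i ▹ put i (symbol a) ▹ homeward ∶ home cs ⟶ home cs′ within seekTime B + (1 + homeTime B))
  push-run i a cs v st with seek-run i cs v st
  ... | xs , y , ys , so , le , r = _ , Stored-push a so , ≤-trans (≤-reflexive (size-put i (symbol a) xs y ys)) le ,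
    λ b → r (≤-trans (n≤1+n _) b) ▹-run put-run i (symbol a) xs y ys ▹-run
      homeward-run xs (y [ i ]≔ symbol a) ys (≤-trans (≤-reflexive (size-put i (symbol a) xs y ys)) (≤-trans le b))

  clearCell : Fin tracks → Cell → Cell
  clearCell i c = c [ i ]≔ zero

  clear-run′ : ∀ i ls y as →
               clear i ∶ tape (List.map letter ls ++ [ blank ]) (letter y) as
                 ⟶ tape [] blank (List.map letter (List.map (clearCell i) ls) ʳ++ letter (clearCell i y) ∷ as) within suc (length ls) * 3 + 1
  clear-run′ i [] y as = while-step refl
    (subst (λ c → put i zero ∶ tape [ blank ] (letter y) as ⟶ tape [ blank ] (letter (clearCell i c)) as within 1) (cell-letter y) (once-run _ _) ▹-run once-run _ _)
    (while-stop refl)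
  clear-run′ i (l ∷ ls) y as = while-step refl
    (subst (λ c → put i zero ∶ tape (letter l ∷ List.map letter ls ++ [ blank ]) (letter y) as ⟶ tape (letter l ∷ List.map letter ls ++ [ blank ]) (letter (clearCell i c)) as within 1) (cell-letter y) (once-run _ _) ▹-run once-run _ _)
    (clear-run′ i ls l (letter (clearCell i y) ∷ as))

  clear-run : ∀ {B} i xs x zs → suc (length xs) ≤ B →
              clear i ∶ at xs x zs ⟶ home (List.map (clearCell i) (xs ∷ʳ x) ++ zs) within clearTime B
  clear-run i xs x zs le = relax (+-monoˡ-≤ 1 (*-monoˡ-≤ 3 (≤-trans (≤-reflexive (cong suc (Listₚ.length-reverse xs))) le)))
    (subst₂ (λ ls rs → clear i ∶ tape ls (letter x) (List.map letter zs) ⟶ tape [] blank rs within suc (length (reverse xs)) * 3 + 1)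
      (trans (cong (_++ [ blank ]) (Listₚ.reverse-map letter xs)) (sym (Listₚ.ʳ++-defn (List.map letter xs))))
      (begin
        List.map letter (List.map (clearCell i) (reverse xs)) ʳ++ List.map letter (clearCell i x ∷ zs)
          ≡⟨ Listₚ.map-ʳ++ letter (List.map (clearCell i) (reverse xs)) ⟨
        List.map letter (List.map (clearCell i) (reverse xs) ʳ++ clearCell i x ∷ zs)
          ≡⟨ cong (λ as → List.map letter (as ʳ++ clearCell i x ∷ zs)) (Listₚ.reverse-map (clearCell i) xs) ⟩
        List.map letter (reverse (List.map (clearCell i) xs) ʳ++ clearCell i x ∷ zs)
          ≡⟨ cong (List.map letter) (Listₚ.ʳ++-ʳ++ (List.map (clearCell i) xs)) ⟩
        List.map letter (List.map (clearCell i) xs ++ clearCell i x ∷ zs)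
          ≡⟨ cong (List.map letter) (trans (cong (_++ zs) (Listₚ.map-++ (clearCell i) xs [ x ])) (Listₚ.++-assoc (List.map (clearCell i) xs) [ clearCell i x ] zs)) ⟨
        List.map letter (List.map (clearCell i) (xs ∷ʳ x) ++ zs) ∎)
      (clear-run′ i (reverse xs) x (List.map letter zs)))
    where open ≡-Reasoning

  column-clear : ∀ i xs → column i (List.map (clearCell i) xs) ≡ replicate (length xs) zero
  column-clear i []       = refl
  column-clear i (x ∷ xs) = cong₂ _∷_ (Vecₚ.lookup∘update i x zero) (column-clear i xs)

  column-clear-other : ∀ {i j} xs → j ≢ i → column j (List.map (clearCell i) xs) ≡ column j xs
  column-clear-other []       j≢i = refl
  column-clear-other (x ∷ xs) j≢i = cong₂ _∷_ (Vecₚ.lookup∘update′ j≢i x zero) (column-clear-other xs j≢i)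

  Stored-clear : ∀ {i v xs y ys} → Sought i v xs y ys → Stored (List.map (clearCell i) xs ++ y ∷ ys) (v [ i ]≔ [])
  Stored-clear {i} {v} {xs} {y} {ys} (sought st _ free (z , above)) j with j Finₚ.≟ i
  ... | yes refl = subst (Column _) (sym (Vecₚ.lookup∘update i v [])) (length xs + suc z , (begin
      column i (List.map (clearCell i) xs ++ y ∷ ys)       ≡⟨ Listₚ.map-++ _ (List.map (clearCell i) xs) (y ∷ ys) ⟩
      column i (List.map (clearCell i) xs) ++ column i (y ∷ ys) ≡⟨ cong₂ _++_ (column-clear i xs) (cong₂ _∷_ free above) ⟩
      replicate (length xs) zero ++ replicate (suc z) zero  ≡⟨ replicate-+ (length xs) (suc z) ⟨
      replicate (length xs + suc z) zero                    ∎))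
    where open ≡-Reasoning
  ... | no j≢i = subst₂ Column
    (trans (Listₚ.map-++ _ xs (y ∷ ys)) (sym (trans (Listₚ.map-++ _ (List.map (clearCell i) xs) (y ∷ ys)) (cong (_++ column j (y ∷ ys)) (column-clear-other xs j≢i)))))
    (sym (Vecₚ.lookup∘update′ j≢i v [])) (st j)

-- Correctness and running time of compiled programs

module Correctness (Γ : Set) (F : Finite Γ) (s : ℕ) (mark : Γ) (D k : ℕ)
  (code : Vec (Fin (suc (Finite.card F))) (suc (D + s)) → Fin k)
  (decode : Fin k → Vec (Fin (suc (Finite.card F))) (suc (D + s)))
  (decode-code : ∀ c → decode (code c) ≡ c) where

  open Programs Γ F s
  open Finite F
  open Compile Γ F s mark D k code decode decode-code

  cases : ∀ {n} {A : Set₁} → A → (Fin n → A) → Fin (suc n) → A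
  cases a f zero    = a
  cases a f (suc x) = f x

  compile : ∀ p → depth p ≤ D → Machine
  compile skip       _ = idle
  compile (push i a) _ = seek (stackTrack i) ▹ put (stackTrack i) (symbol a) ▹ homeward
  compile (case i f) d = seek (stackTrack i) ▹ goLeft ▹ switch card (track (stackTrack i)) (cases
    (compile (f nothing) (≤-trans (m≤m+n _ _) d))
    (λ x → put (stackTrack i) zero ▹ homeward ▹
           compile (f (just (element x))) (≤-trans (≤-trans (sumFin-≥ (λ x → depth (f (just (element x)))) x) (m≤n+m _ _)) d)))
  compile (p ⨾ q)    d = compile p (≤-trans (m≤m+n _ _) d) ▹ compile q (≤-trans (m≤n+m _ _) d)
  compile (each f)   d =
    seek (loopTrack (fromℕ< d)) ▹
    while (occupied clockTrack) (switch card (track clockTrack) (cases idle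
      (λ x → put (loopTrack (fromℕ< d)) (symbol mark) ▹ homeward ▹
             compile (f (element x)) (≤-trans (sumFin-≥ (λ x → depth (f (element x))) x) (ℕₚ.<⇒≤ d)) ▹
             seek (loopTrack (fromℕ< d))))) ▹
    goLeft ▹ clear (loopTrack (fromℕ< d))

  pushTime caseTime iterTime eachTime : ℕ → ℕ
  pushTime B = seekTime B + (1 + homeTime B)
  caseTime B = seekTime B + (1 + (card + (1 + homeTime B)))
  iterTime B = suc (card + (1 + (homeTime B + seekTime B)))
  eachTime B = seekTime B + (1 + (1 + clearTime B))

  abstract
    -- A common bound for the overhead of every primitive on a tape of at most B cells. Kept
    -- abstract, it enters the later estimates as a single number, and a program takes at most `ops`
    -- many units.
    unit : ℕ → ℕ
    unit B = 1 + (pushTime B + (caseTime B + (iterTime B + eachTime B)))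

    unit-≡ : ∀ B → unit B ≡ 1 + (pushTime B + (caseTime B + (iterTime B + eachTime B)))
    unit-≡ B = refl

    1≤unit : ∀ B → 1 ≤ unit B
    1≤unit B = s≤s z≤n
    push≤unit : ∀ B → pushTime B ≤ unit B
    push≤unit B = ≤-trans (m≤m+n _ _) (n≤1+n _)
    case≤unit : ∀ B → caseTime B ≤ unit B
    case≤unit B = ≤-trans (≤-trans (m≤m+n _ _) (m≤n+m _ (pushTime B))) (n≤1+n _)
    iter≤unit : ∀ B → iterTime B ≤ unit B
    iter≤unit B = ≤-trans (≤-trans (≤-trans (m≤m+n _ _) (m≤n+m _ (caseTime B))) (m≤n+m _ (pushTime B))) (n≤1+n _)
    each≤unit : ∀ B → eachTime B ≤ unit B
    each≤unit B = ≤-trans (≤-trans (≤-trans (m≤n+m _ (iterTime B)) (m≤n+m _ (caseTime B))) (m≤n+m _ (pushTime B))) (n≤1+n _)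

  private
    switch-to : ∀ {n h M t t′ m} x → h (Tape.here t) ≡ x → M x ∶ t ⟶ t′ within m → switch n h M ∶ t ⟶ t′ within (n + m)
    switch-to {n} {h} {M} {t} {t′} {m} x e r = switch-run n {M = M} (subst (λ y → M y ∶ t ⟶ t′ within m) (sym e) r)

    case-of : ∀ {A B : Set} → A → (A → B) → B
    case-of a f = f a

  Loops : Set
  Loops = Vec (List Γ) D

  -- A loop of depth `suc d` keeps its position in loop track d, and its body, of depth at most d,
  -- works in the tracks below d. So a program of depth d must find the first d loop tracks empty;
  -- since it restores all loop tracks, programs in sequence can share them.
  Free : ℕ → Loops → Set
  Free d ls = ∀ i → toℕ i < d → lookup ls i ≡ []

  module _ (c : List Γ) where

    private
      n = length c

    -- The clock is stored as the stack `reverse c`: a track shows a stack from its bottom upwards,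
    -- and the first symbol of the clock belongs in the first cell.
    full : Loops → Store → Vec (List Γ) tracks
    full ls v = reverse c ∷ (ls Vec.++ v)

    private
      full-stack : ∀ ls v i → lookup (full ls v) (stackTrack i) ≡ lookup v i
      full-stack ls v i = Vecₚ.lookup-++ʳ ls v i

      full-loop : ∀ ls v d → lookup (full ls v) (loopTrack d) ≡ lookup ls d
      full-loop ls v d = Vecₚ.lookup-++ˡ ls v d

      full-stack≔ : ∀ ls v i as → full ls v [ stackTrack i ]≔ as ≡ full ls (v [ i ]≔ as)
      full-stack≔ ls v i as = cong (reverse c ∷_) (Vecₚ.[]≔-++-↑ʳ ls v i)

      full-loop≔ : ∀ ls v d as → full ls v [ loopTrack d ]≔ as ≡ full (ls [ d ]≔ as) v
      full-loop≔ ls v d as = cong (reverse c ∷_) (Vecₚ.[]≔-++-↑ˡ ls v d)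

    Result : Machine → Loops → Store → ℕ → ℕ → ℕ → List Cell → Set
    Result M ls v o t m cs = ∃[ cs′ ] Stored cs′ (full ls v) × length cs′ ≤ m + o × M ∶ home cs ⟶ home cs′ within t

    -- One count serves twice: `ops` bounds the number of new cells and, times `unit B`, the running
    -- time. The bound B on the final number of cells stays the same throughout the induction, so
    -- the units of different parts of a program can be added.
    Correct : ∀ p → depth p ≤ D → Set
    Correct p d = ∀ {B} ls v cs → Free (depth p) ls → Stored cs (full ls v) → length cs + ops p n ≤ B →
                  Result (compile p d) ls (exec c p v) (ops p n) (ops p n * unit B) (length cs) cs

    push-correct : ∀ i a d → Correct (push i a) d
    push-correct i a d {B} ls v cs free st b with push-run (stackTrack i) a cs (full ls v) st
    ... | cs′ , st′ , le , r = cs′ ,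
      subst (Stored cs′) (trans (cong (λ as → full ls v [ stackTrack i ]≔ (a ∷ as)) (full-stack ls v i)) (full-stack≔ ls v i _)) st′ ,
      ≤-trans le (≤-reflexive (+-comm 1 _)) ,
      relax (≤-trans (push≤unit B) (≤-reflexive (sym (+-identityʳ _)))) (r (≤-trans (≤-reflexive (+-comm 1 _)) b))

    case-correct : ∀ i f d → (∀ d′ → Correct (f nothing) d′) → (∀ x d′ → Correct (f (just (element x))) d′) → Correct (case i f) d
    case-correct i f d hn hj {B} ls v cs free st b with seek-run (stackTrack i) cs (full ls v) st
    ... | xs , y , ys , so , le , r = split (lookup v i) refl
      where
      sums = sumFin card (λ x → ops (f (just (element x))) n)

      b′ : size xs y ys + (ops (f nothing) n + sums) ≤ B
      b′ = ≤-trans (+-monoˡ-≤ _ le) (≤-trans (≤-reflexive (sym (+-suc (length cs) _))) b)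

      fits : ∀ {o} → o ≤ ops (f nothing) n + sums → size xs y ys + o ≤ B
      fits le′ = ≤-trans (+-monoʳ-≤ _ le′) b′

      small : length cs ≤ B
      small = ≤-trans (m≤m+n _ _) b

      grown : ∀ {o m} → m ≤ size xs y ys + o → o ≤ ops (f nothing) n + sums → m ≤ length cs + suc (ops (f nothing) n + sums)
      grown m≤ le′ = ≤-trans m≤ (≤-trans (+-mono-≤ le le′) (≤-reflexive (sym (+-suc (length cs) _))))

      regroup : ∀ a b c d → a + (1 + (b + (1 + (c + d)))) ≡ (a + (1 + (b + (1 + c)))) + d
      regroup = solve-∀

      time : ∀ {o} → o ≤ ops (f nothing) n + sums →
             seekTime B + (1 + (card + (1 + (homeTime B + o * unit B)))) ≤ (1 + (ops (f nothing) n + sums)) * unit B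
      time {o} le′ = ≤-trans (≤-reflexive (regroup (seekTime B) card (homeTime B) (o * unit B)))
        (+-mono-≤ (case≤unit B) (*-monoˡ-≤ (unit B) le′))

      no-cells : ∀ xs → column (stackTrack i) xs ≡ [] → xs ≡ []
      no-cells [] _ = refl

      split : ∀ as → lookup v i ≡ as → Result (compile (case i f) d) ls (exec c (case i f) v) (ops (case i f) n) (ops (case i f) n * unit B) (length cs) cs
      -- For an empty stack the free cell is the first one. Then `goLeft` reaches the blank at home,
      -- which reads as the empty cell and so selects the branch for `nothing`, with the head
      -- already in place.
      split [] e with no-cells xs (trans (Sought.below so) (cong (List.map symbol ∘ reverse) (trans (full-stack ls v i) e)))
      ... | refl =
        case-of (hn _ ls v (y ∷ ys) (λ j j< → free j (≤-trans j< (m≤m+n _ _))) (Sought.stored so) (fits (m≤m+n _ _))) λ (cs′ , st′ , le″ , r′) →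
           cs′ , subst (Stored cs′ ∘ full ls) (exec-empty e) st′ , grown le″ (m≤m+n _ _) ,
           relax (≤-trans (+-monoʳ-≤ (seekTime B) (+-monoʳ-≤ 1 (+-monoʳ-≤ card (≤-trans (m≤n+m _ (homeTime B)) (n≤1+n _))))) (time (m≤m+n _ sums)))
             (r small ▹-run once-run _ _ ▹-run switch-to zero (Vecₚ.lookup-replicate (stackTrack i) zero) r′)
        where
        exec-empty : lookup v i ≡ [] → exec c (f nothing) v ≡ exec c (case i f) v
        exec-empty e = trans (cong (exec c (f nothing)) (sym (trans (cong (v [ i ]≔_) (sym e)) (Vecₚ.[]≔-lookup v i))))
          (cong (λ as → exec c (f (List.head as)) (v [ i ]≔ pop as)) (sym e))
      split (a ∷ as) e with Stored-pop {i = stackTrack i} (trans (full-stack ls v i) e) so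
      ... | xs′ , x , refl , xa , st₁ =
        let e₁ = Listₚ.++-assoc xs′ [ x ] (y ∷ ys)
            sz = trans (size-put′ xs′) (cong length (sym e₁))
            le₁ = ≤-trans (sumFin-≥ (λ x → ops (f (just (element x))) n) (index a)) (m≤n+m _ (ops (f nothing) n))
        in case-of (hj (index a) (≤-trans (≤-trans (sumFin-≥ (λ x → depth (f (just (element x)))) (index a)) (m≤n+m _ _)) d)
               ls (v [ i ]≔ as) (xs′ ++ (x [ stackTrack i ]≔ zero) ∷ y ∷ ys)
               (λ j j< → free j (≤-trans j< (≤-trans (sumFin-≥ (λ x → depth (f (just (element x)))) (index a)) (m≤n+m _ (depth (f nothing))))))
               (subst (Stored _) (full-stack≔ ls v i as) st₁)
               (≤-trans (≤-reflexive (cong (_+ _) sz)) (fits le₁))) λ (cs′ , st′ , le″ , r′) →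
           cs′ , subst (Stored cs′ ∘ full ls) (exec-cons e) st′ , grown (≤-trans le″ (≤-reflexive (cong (_+ _) sz))) le₁ ,
           relax (time le₁)
             (r small ▹-run goLeft-run xs′ x y ys ▹-run
              switch-to (symbol a) (trans (cong (λ c → lookup c (stackTrack i)) (cell-letter x)) xa)
                (put-run (stackTrack i) zero xs′ x (y ∷ ys) ▹-run
                 homeward-run xs′ (x [ stackTrack i ]≔ zero) (y ∷ ys) (≤-trans (≤-reflexive sz) (≤-trans (m≤m+n _ _) b′)) ▹-run
                 r′))
        where
        size-put′ : ∀ xs′ → length (xs′ ++ (x [ stackTrack i ]≔ zero) ∷ y ∷ ys) ≡ length (xs′ ++ x ∷ y ∷ ys)
        size-put′ xs′ = size-put (stackTrack i) zero xs′ x (y ∷ ys)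
        exec-cons : ∀ {a as} → lookup v i ≡ a ∷ as → exec c (f (just (element (index a)))) (v [ i ]≔ as) ≡ exec c (case i f) v
        exec-cons {a} {as} e = trans (cong (λ a → exec c (f (just a)) (v [ i ]≔ as)) (element-index a))
          (cong (λ as → exec c (f (List.head as)) (v [ i ]≔ pop as)) (sym e))

    -- The loop track holds one mark for each clock symbol already treated, so its first free cell
    -- is the cell of the next symbol, where the clock track is read. The mark is set before the
    -- body runs; afterwards a new `seek` finds the place again, wherever the body has been on the
    -- tape.
    each-correct : ∀ f d → (∀ x d′ → Correct (f (element x)) d′) → Correct (each f) d
    each-correct f d h {B} ls v cs free st b = case-of (seek-run tr cs (full ls v) st) λ where
        (xs , y , ys , so , le , r) → case-of (iterate c [] [] v xs y ys refl refl (subst (λ ls → Sought tr (full ls v) xs y ys) (sym unchanged) so) (fits le)) λ where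
          (as′ , xs′ , y′ , ys′ , so′ , le′ , r′) →
            List.map (λ x → x [ tr ]≔ zero) xs′ ++ y′ ∷ ys′ ,
            restored as′ xs′ y′ ys′ so′ ,
            ≤-trans (cleared xs′ (y′ ∷ ys′)) (≤-trans le′ (≤-trans (+-monoˡ-≤ (n * w) le) (one-less (length cs) (n * w)))) ,
            relax total (r (≤-trans (m≤m+n (length cs) (1 + (n * w + 1))) b) ▹-run r′ ▹-run finish xs′ y′ ys′ (≤-trans le′ (fits le)))
      where
      tr = loopTrack (fromℕ< d)
      w = 2 + sumFin card (λ x → ops (f (element x)) n)

      one-less : ∀ a b → suc a + b ≤ a + (1 + (b + 1))
      one-less a b = ≤-trans (≤-reflexive (sym (+-suc a b))) (+-monoʳ-≤ a (s≤s (m≤m+n b 1)))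

      fits : ∀ {m} → m ≤ suc (length cs) → m + n * w ≤ B
      fits le = ≤-trans (+-monoˡ-≤ (n * w) le) (≤-trans (one-less (length cs) (n * w)) b)

      unchanged : ls [ fromℕ< d ]≔ [] ≡ ls
      unchanged = trans (cong (ls [ fromℕ< d ]≔_) (sym (free (fromℕ< d) (≤-reflexive (cong suc (Finₚ.toℕ-fromℕ< d)))))) (Vecₚ.[]≔-lookup ls (fromℕ< d))

      restored : ∀ as xs y ys → Sought tr (full (ls [ fromℕ< d ]≔ as) (exec c (each f) v)) xs y ys →
                 Stored (List.map (λ x → x [ tr ]≔ zero) xs ++ y ∷ ys) (full ls (exec c (each f) v))
      restored as xs y ys so = subst (Stored (List.map (λ x → x [ tr ]≔ zero) xs ++ y ∷ ys))
        (trans (full-loop≔ (ls [ fromℕ< d ]≔ as) (exec c (each f) v) (fromℕ< d) [])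
          (cong (λ ls → full ls (exec c (each f) v)) (trans (Vecₚ.[]≔-idempotent ls (fromℕ< d)) unchanged)))
        (Stored-clear so)

      cleared : ∀ xs zs → length (List.map (λ x → x [ tr ]≔ zero) xs ++ zs) ≤ length (xs ++ zs)
      cleared xs zs = ≤-reflexive (trans (Listₚ.length-++ (List.map (λ x → x [ tr ]≔ zero) xs))
        (trans (cong (_+ length zs) (Listₚ.length-map (λ x → x [ tr ]≔ zero) xs)) (sym (Listₚ.length-++ xs))))

      regroup : ∀ a b c → a + ((b + 1) + (1 + c)) ≡ (a + (1 + (1 + c))) + b
      regroup = solve-∀

      collect : ∀ a u → (u + a * u) + u ≡ (1 + (a + 1)) * u
      collect = solve-∀

      total : seekTime B + ((n * w * unit B + 1) + (1 + clearTime B)) ≤ (1 + (n * w + 1)) * unit B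
      total = begin
        seekTime B + ((n * w * unit B + 1) + (1 + clearTime B)) ≡⟨ regroup (seekTime B) (n * w * unit B) (clearTime B) ⟩
        eachTime B + n * w * unit B                             ≤⟨ +-monoˡ-≤ (n * w * unit B) (each≤unit B) ⟩
        unit B + n * w * unit B                                 ≤⟨ m≤m+n (unit B + n * w * unit B) (unit B) ⟩
        (unit B + n * w * unit B) + unit B                      ≡⟨ collect (n * w) (unit B) ⟩
        (1 + (n * w + 1)) * unit B                              ∎
        where open ≤-Reasoning

      body : Machine
      body = switch card (track clockTrack) (cases idle
        (λ x → put tr (symbol mark) ▹ homeward ▹
               compile (f (element x)) (≤-trans (sumFin-≥ (λ x → depth (f (element x))) x) (ℕₚ.<⇒≤ d)) ▹ seek tr))

      clock-cell : ∀ xs y ys pre rest → pre ++ rest ≡ c → length xs ≡ length pre → ∀ {z} →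
                   column clockTrack (xs ++ y ∷ ys) ≡ List.map symbol (reverse (reverse c)) ++ replicate z zero →
                   lookup y clockTrack ∷ column clockTrack ys ≡ List.map symbol rest ++ replicate z zero
      clock-cell xs y ys pre rest refl len {z} e = ++-cancelˡ-length (column clockTrack xs) (List.map symbol pre)
        (trans (Listₚ.length-map _ xs) (trans len (sym (Listₚ.length-map symbol pre))))
        (trans (sym (Listₚ.map-++ _ xs (y ∷ ys))) (trans e (trans (cong (λ as → List.map symbol as ++ replicate z zero) (Listₚ.reverse-involutive (pre ++ rest)))
          (trans (cong (_++ replicate z zero) (Listₚ.map-++ symbol pre rest)) (Listₚ.++-assoc (List.map symbol pre) _ _)))))

      loop-length : ∀ as v xs y ys → Sought tr (full (ls [ fromℕ< d ]≔ as) v) xs y ys → length xs ≡ length as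
      loop-length as v xs y ys so = trans (sym (Listₚ.length-map _ xs)) (trans (cong length (Sought.below so))
        (trans (Listₚ.length-map symbol (reverse below)) (trans (Listₚ.length-reverse below)
          (cong length (trans (full-loop (ls [ fromℕ< d ]≔ as) v (fromℕ< d)) (Vecₚ.lookup∘update (fromℕ< d) ls as))))))
        where below = lookup (full (ls [ fromℕ< d ]≔ as) v) tr

      finish : ∀ xs y ys → size xs y ys ≤ B →
               goLeft ▹ clear tr ∶ at xs y ys ⟶ home (List.map (λ x → x [ tr ]≔ zero) xs ++ y ∷ ys) within 1 + clearTime B
      finish xs y ys le with List.initLast xs
      ... | []          = once-run _ _ ▹-run relax (m≤n+m 1 (B * 3)) (while-stop refl)
      ... | xs₀ List.∷ʳ′ x₀ = goLeft-run xs₀ x₀ y ys ▹-run clear-run tr xs₀ x₀ (y ∷ ys)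
        (≤-trans (≤-trans (≤-reflexive (trans (+-comm 1 (length xs₀)) (sym (Listₚ.length-++ xs₀)))) (≤-trans (m≤m+n _ _) (≤-reflexive (sym (Listₚ.length-++ (xs₀ ∷ʳ x₀)))))) le)

      iterate : ∀ rest pre as v xs y ys → pre ++ rest ≡ c → length pre ≡ length as →
                Sought tr (full (ls [ fromℕ< d ]≔ as) v) xs y ys → size xs y ys + length rest * w ≤ B →
                ∃[ as′ ] ∃[ xs′ ] ∃[ y′ ] ∃[ ys′ ] Sought tr (full (ls [ fromℕ< d ]≔ as′) (foldl (λ v a → exec c (f a) v) v rest)) xs′ y′ ys′ ×
                  size xs′ y′ ys′ ≤ size xs y ys + length rest * w ×
                  while (occupied clockTrack) body ∶ at xs y ys ⟶ at xs′ y′ ys′ within length rest * w * unit B + 1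
      -- All symbols are marked off. The head is on a cell beyond the clock, which exists because
      -- `seek` always ends on a cell; there the clock track reads zero and the loop stops.
      iterate [] pre as v xs y ys e len so b with Sought.stored so clockTrack
      ... | suc z , col = as , xs , y , ys , so , m≤m+n _ _ , while-stop (cong nonzero
        (trans (cong (λ c → lookup c clockTrack) (cell-letter y))
          (Listₚ.∷-injectiveˡ (clock-cell xs y ys pre [] e (trans (loop-length as v xs y ys so) (sym len)) col))))
      ... | zero , col with () ← clock-cell xs y ys pre [] e (trans (loop-length as v xs y ys so) (sym len)) col
      iterate (a ∷ rest) pre as v xs y ys e len so b =
        let (z , col) = Sought.stored so clockTrack
            here-a = trans (cong (λ c → lookup c clockTrack) (cell-letter y))
              (Listₚ.∷-injectiveˡ (clock-cell xs y ys pre (a ∷ rest) e (trans (loop-length as v xs y ys so) (sym len)) col))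
            y⁺ = y [ tr ]≔ symbol mark
            sz = size-put tr (symbol mark) xs y ys
            o = ops (f (element (index a))) n
            o≤ = sumFin-≥ (λ x → ops (f (element x)) n) (index a)
            st₁ = subst (Stored (xs ++ y⁺ ∷ ys))
              (trans (cong (λ as′ → full (ls [ fromℕ< d ]≔ as) v [ tr ]≔ (mark ∷ as′)) (trans (full-loop (ls [ fromℕ< d ]≔ as) v (fromℕ< d)) (Vecₚ.lookup∘update (fromℕ< d) ls as)))
                (trans (full-loop≔ (ls [ fromℕ< d ]≔ as) v (fromℕ< d) (mark ∷ as)) (cong (λ ls → full ls v) (Vecₚ.[]≔-idempotent ls (fromℕ< d)))))
              (Stored-push mark so)
            bs = ≤-trans (+-monoʳ-≤ (size xs y ys) (m≤m+n w (length rest * w))) b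
        in case-of (h (index a) (≤-trans (sumFin-≥ (λ x → depth (f (element x))) (index a)) (ℕₚ.<⇒≤ d))
              (ls [ fromℕ< d ]≔ (mark ∷ as)) v (xs ++ y⁺ ∷ ys) (still-free (index a)) st₁
              (≤-trans (≤-trans (≤-reflexive (cong (_+ o) sz)) (+-monoʳ-≤ _ (≤-trans o≤ (m≤n+m _ 2)))) bs)) λ (cs₁ , st₂ , le₁ , r₁) →
        let st₃ = subst (λ a → Stored cs₁ (full (ls [ fromℕ< d ]≔ (mark ∷ as)) (exec c (f a) v))) (element-index a) st₂
        in case-of (seek-run tr cs₁ _ st₃) λ (xs₂ , y₂ , ys₂ , so₂ , le₂ , r₂) →
        let cs₁≤ = ≤-trans le₁ (≤-trans (≤-reflexive (cong (_+ o) sz)) (+-monoʳ-≤ (size xs y ys) o≤))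
            sz₂ = ≤-trans le₂ (≤-trans (s≤s cs₁≤) (≤-trans (≤-reflexive (sym (+-suc (size xs y ys) _))) (+-monoʳ-≤ (size xs y ys) (n≤1+n _))))
            sz₃ = ≤-trans (+-monoˡ-≤ (length rest * w) sz₂) (≤-reflexive (+-assoc (size xs y ys) w (length rest * w)))
        in case-of (
              iterate rest (pre ∷ʳ a) (mark ∷ as) (exec c (f a) v) xs₂ y₂ ys₂
                (trans (Listₚ.++-assoc pre [ a ] rest) e) (trans (Listₚ.length-++ pre) (trans (+-comm _ 1) (cong suc len))) so₂ (≤-trans sz₃ b)) λ (as₄ , xs₄ , y₄ , ys₄ , so₄ , le₄ , r₄) →
           as₄ , xs₄ , y₄ , ys₄ , so₄ , ≤-trans le₄ sz₃ ,
           relax (time o (length rest) o≤)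
             (while-step (cong nonzero here-a)
               (switch-to (symbol a) here-a
                 (put-run tr (symbol mark) xs y ys ▹-run
                  homeward-run xs y⁺ ys (≤-trans (≤-reflexive sz) (≤-trans (m≤m+n _ _) b)) ▹-run
                  r₁ ▹-run r₂ (≤-trans cs₁≤ (≤-trans (+-monoʳ-≤ (size xs y ys) (m≤n+m _ 2)) bs))))
               r₄)
        where
        still-free : ∀ x {as} → Free (depth (f (element x))) (ls [ fromℕ< d ]≔ as)
        still-free x {as} i i< = trans (Vecₚ.lookup∘update′ i≢d ls as) (free i (ℕₚ.<-trans i<d (ℕₚ.n<1+n _)))
          where
          i<d : toℕ i < sumFin card (λ x → depth (f (element x)))
          i<d = ≤-trans i< (sumFin-≥ (λ x → depth (f (element x))) x)
          i≢d : i ≢ fromℕ< d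
          i≢d refl = ℕₚ.<-irrefl (Finₚ.toℕ-fromℕ< d) i<d
        time : ∀ o l → o ≤ sumFin card (λ x → ops (f (element x)) n) →
               suc ((card + (1 + (homeTime B + (o * unit B + seekTime B)))) + (l * w * unit B + 1)) ≤ (w + l * w) * unit B + 1
        time o l o≤ = ≤-trans (≤-reflexive (gather card (homeTime B) (o * unit B) (seekTime B) (l * w * unit B)))
          (≤-trans (+-monoˡ-≤ 1 (+-monoˡ-≤ (l * w * unit B) (+-mono-≤ (≤-trans (iter≤unit B) (m≤m+n _ (unit B))) (*-monoˡ-≤ (unit B) o≤))))
            (≤-reflexive (spread (unit B) (sumFin card (λ x → ops (f (element x)) n)) (l * w))))
          where
          gather : ∀ g h o s r → suc ((g + (1 + (h + (o + s)))) + (r + 1)) ≡ ((suc (g + (1 + (h + s))) + o) + r) + 1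
          gather = solve-∀
          spread : ∀ u s r → (((u + u) + s * u) + r * u) + 1 ≡ ((2 + s) + r) * u + 1
          spread = solve-∀

    correct : ∀ p d → Correct p d
    correct skip       d {B} ls v cs free st b = cs , st , m≤m+n _ _ , relax (≤-trans (1≤unit B) (≤-reflexive (sym (+-identityʳ (unit B))))) (once-run _ _)
    correct (push i a) d = push-correct i a d
    correct (case i f) d = case-correct i f d (correct (f nothing)) (λ x → correct (f (just (element x))))
    correct (p ⨾ q)    d {B} ls v cs free st b =
      case-of (correct p (≤-trans (m≤m+n _ _) d) ls v cs (λ i i< → free i (≤-trans i< (m≤m+n _ _))) st
                                     (≤-trans (+-monoʳ-≤ (length cs) (m≤m+n _ (ops q n))) b)) λ (cs₁ , st₁ , le₁ , r₁) →
      let assoc = ≤-reflexive (+-assoc (length cs) (ops p n) (ops q n))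
      in case-of (correct q (≤-trans (m≤n+m _ _) d) ls (exec c p v) cs₁ (λ i i< → free i (≤-trans i< (m≤n+m _ _))) st₁
                                     (≤-trans (≤-trans (+-monoˡ-≤ (ops q n) le₁) assoc) b)) λ (cs₂ , st₂ , le₂ , r₂) →
         cs₂ , st₂ , ≤-trans le₂ (≤-trans (+-monoˡ-≤ (ops q n) le₁) assoc) ,
         relax (≤-reflexive (sym (ℕₚ.*-distribʳ-+ (unit B) (ops p n) (ops q n)))) (r₁ ▹-run r₂)
    correct (each f)   d = each-correct f d (λ x → correct (f (element x)))

-- The padded input as a clock, and deciders made from programs

module _ {Γ : Set} (inBit : Bool → Γ) (pad : Γ) where

  -- The word comes first, so a loop over the clock also reads the input. The last `pad` stands
  -- apart because the preparing machine ends on its cell before it walks home.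
  paddedClock : ℕ → Word → List Γ
  paddedClock C w = (List.map inBit w ++ replicate C pad) ∷ʳ pad

  length-paddedClock : ∀ C w → length (paddedClock C w) ≡ length w + suc C
  length-paddedClock C w = begin
    length (paddedClock C w)                                ≡⟨ Listₚ.length-++ (List.map inBit w ++ replicate C pad) ⟩
    length (List.map inBit w ++ replicate C pad) + 1        ≡⟨ cong (_+ 1) (Listₚ.length-++ (List.map inBit w)) ⟩
    length (List.map inBit w) + length (replicate C pad) + 1 ≡⟨ cong₂ (λ a b → a + b + 1) (Listₚ.length-map inBit w) (Listₚ.length-replicate C) ⟩
    length w + C + 1                                        ≡⟨ trans (+-assoc (length w) C 1) (cong (length w +_) (+-comm C 1)) ⟩
    length w + suc C                                        ∎
    where open ≡-Reasoning

module Deciding (Γ : Set) (F : Finite Γ) (s : ℕ) (inBit : Bool → Γ) (pad : Γ) (D k : ℕ)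
  (code : Vec (Fin (suc (Finite.card F))) (suc (D + s)) → Fin k)
  (decode : Fin k → Vec (Fin (suc (Finite.card F))) (suc (D + s)))
  (decode-code : ∀ c → decode (code c) ≡ c) where

  open Programs Γ F s
  open Compile Γ F s pad D k code decode decode-code
  open Correctness Γ F s pad D k code decode decode-code

  clockCell : Γ → Cell
  clockCell a = empty [ clockTrack ]≔ symbol a

  isBit : Letter → Bool
  isBit (bit _) = true
  isBit _       = false

  recordBit : Letter → Letter × Move
  recordBit (bit b) = letter (clockCell (inBit b)) , right
  recordBit a       = a , right

  pads : ℕ → Machine
  pads zero    = once (λ _ → letter (clockCell pad) , stay)
  pads (suc C) = once (λ _ → letter (clockCell pad) , right) ▹ pads C

  -- One step to the left and one back make the blank to the left of the word explicit, in the way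
  -- in which `at` lists it.
  prepare : ℕ → Machine
  prepare C = goLeft ▹ goRight ▹ while isBit (once recordBit) ▹ pads C ▹ homeward

  -- The bit is written on the blank at home. Only cells follow there, and their letters are not
  -- bits, so the output is that single bit. An empty stack means acceptance.
  verdict : Fin s → Machine
  verdict r = seek (stackTrack r) ▹ goLeft ▹ branch (nonzero ∘ track (stackTrack r))
    (homeward ▹ once (λ _ → bit false , stay)) (once (λ _ → bit true , stay))

  prepareTime : ℕ → ℕ → ℕ
  prepareTime C n = 1 + (1 + ((n * 2 + 1) + (suc C + homeTime (n + suc C))))

  verdictTime : ℕ → ℕ
  verdictTime B = seekTime B + (1 + (1 + (homeTime (suc B) + 1)))

  private
    bits-run : ∀ ls w → while isBit (once recordBit) ∶ place ls (List.map bit w)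
               ⟶ tape (List.map (letter ∘ clockCell ∘ inBit) w ʳ++ ls) blank [] within length w * 2 + 1
    bits-run ls []      = while-stop refl
    bits-run ls (b ∷ w) = while-step refl
      (subst (λ t → once recordBit ∶ tape ls (bit b) (List.map bit w) ⟶ t within 1) (move-right ls (letter (clockCell (inBit b))) (List.map bit w)) (once-run _ _))
      (bits-run (letter (clockCell (inBit b)) ∷ ls) w)

    pads-run : ∀ ls C → pads C ∶ tape ls blank [] ⟶ tape (List.map (letter ∘ clockCell) (replicate C pad) ʳ++ ls) (letter (clockCell pad)) [] within suc C
    pads-run ls zero    = once-run _ _
    pads-run ls (suc C) = once-run _ _ ▹-run pads-run (letter (clockCell pad) ∷ ls) C

    padded : ∀ C w → List.map (letter ∘ clockCell) (replicate C pad) ʳ++ List.map (letter ∘ clockCell ∘ inBit) w ʳ++ [ blank ]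
             ≡ List.map letter (List.map clockCell (List.map inBit w ++ replicate C pad)) ʳ++ [ blank ]
    padded C w = begin
      List.map (letter ∘ clockCell) (replicate C pad) ʳ++ List.map (letter ∘ clockCell ∘ inBit) w ʳ++ [ blank ]
        ≡⟨ cong (λ as → List.map (letter ∘ clockCell) (replicate C pad) ʳ++ as ʳ++ [ blank ]) (Listₚ.map-∘ w) ⟩
      List.map (letter ∘ clockCell) (replicate C pad) ʳ++ List.map (letter ∘ clockCell) (List.map inBit w) ʳ++ [ blank ]
        ≡⟨ Listₚ.++-ʳ++ (List.map (letter ∘ clockCell) (List.map inBit w)) ⟨
      (List.map (letter ∘ clockCell) (List.map inBit w) ++ List.map (letter ∘ clockCell) (replicate C pad)) ʳ++ [ blank ]
        ≡⟨ cong (_ʳ++ [ blank ]) (Listₚ.map-++ (letter ∘ clockCell) (List.map inBit w) (replicate C pad)) ⟨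
      List.map (letter ∘ clockCell) (List.map inBit w ++ replicate C pad) ʳ++ [ blank ]
        ≡⟨ cong (_ʳ++ [ blank ]) (Listₚ.map-∘ (List.map inBit w ++ replicate C pad)) ⟩
      List.map letter (List.map clockCell (List.map inBit w ++ replicate C pad)) ʳ++ [ blank ] ∎
      where open ≡-Reasoning

  prepare-run : ∀ C w → prepare C ∶ load (List.map bit w) ⟶ home (List.map clockCell (paddedClock inBit pad C w)) within prepareTime C (length w)
  prepare-run C w =
    start (List.map bit w)
      (bits-run [ blank ] w ▹-run
       subst (λ ls → pads C ∶ _ ⟶ tape ls (letter (clockCell pad)) [] within suc C) (padded C w) (pads-run _ C) ▹-run
       subst (λ cs → homeward ∶ at (List.map clockCell (List.map inBit w ++ replicate C pad)) (clockCell pad) [] ⟶ home cs within homeTime (length w + suc C))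
         (sym (Listₚ.map-++ clockCell (List.map inBit w ++ replicate C pad) [ pad ]))
         (homeward-run (List.map clockCell (List.map inBit w ++ replicate C pad)) (clockCell pad) []
           (≤-reflexive (trans (cong length (sym (Listₚ.map-++ clockCell (List.map inBit w ++ replicate C pad) [ pad ])))
             (trans (Listₚ.length-map clockCell (paddedClock inBit pad C w)) (length-paddedClock inBit pad C w))))))
    where
    start : ∀ as {M t n} → M ∶ place [ blank ] as ⟶ t within n → goLeft ▹ goRight ▹ M ∶ load as ⟶ t within 1 + (1 + n)
    start []       r = once-run _ _ ▹-run once-run _ _ ▹-run r
    start (a ∷ as) r = once-run _ _ ▹-run once-run _ _ ▹-run r

  private
    replicate-Vec-++ : ∀ m n → Vec.replicate {A = List Γ} m [] Vec.++ Vec.replicate n [] ≡ Vec.replicate (m + n) []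
    replicate-Vec-++ zero    n = refl
    replicate-Vec-++ (suc m) n = cong ([] ∷_) (replicate-Vec-++ m n)

    column-clock : ∀ c → column clockTrack (List.map clockCell c) ≡ List.map symbol c
    column-clock []      = refl
    column-clock (a ∷ c) = cong (symbol a ∷_) (column-clock c)

    column-other : ∀ j c → column (suc j) (List.map clockCell c) ≡ replicate (length c) zero
    column-other j []      = refl
    column-other j (a ∷ c) = cong₂ _∷_ (Vecₚ.lookup-replicate j zero) (column-other j c)

  Stored-clock : ∀ c → Stored (List.map clockCell c) (full c (Vec.replicate D []) (Vec.replicate s []))
  Stored-clock c zero    = 0 , trans (column-clock c) (sym (trans (Listₚ.++-identityʳ _) (cong (List.map symbol) (Listₚ.reverse-involutive c))))
  Stored-clock c (suc j) = subst (Column (column (suc j) (List.map clockCell c)))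
    (sym (trans (cong (λ v → lookup v j) (replicate-Vec-++ D s)) (Vecₚ.lookup-replicate j [])))
    (length c , column-other j c)

  private
    leadingBits-letters : ∀ cs → leadingBits (List.map letter cs) ≡ []
    leadingBits-letters []       = refl
    leadingBits-letters (_ ∷ cs) = refl

  verdict-run : ∀ r c ls v cs {B} → Stored cs (full c ls v) → length cs ≤ B →
                ∃[ t ] output t ≡ [ List.null (lookup v r) ] × verdict r ∶ home cs ⟶ t within verdictTime B
  verdict-run r c ls v cs {B} st le =
    case-of (seek-run (stackTrack r) cs (full c ls v) st) λ (xs , y , ys , so , sz , run) →
      finish xs y ys so (≤-trans sz (s≤s le)) (run le) (lookup v r) refl
    where
    case-of : ∀ {A B : Set} → A → (A → B) → B
    case-of a f = f a

    top : lookup (full c ls v) (stackTrack r) ≡ lookup v r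
    top = Vecₚ.lookup-++ʳ ls v r

    nil : ∀ xs → column (stackTrack r) xs ≡ [] → xs ≡ []
    nil [] _ = refl

    finish : ∀ xs y ys → Sought (stackTrack r) (full c ls v) xs y ys → size xs y ys ≤ suc B →
             seek (stackTrack r) ∶ home cs ⟶ at xs y ys within seekTime B → ∀ as → lookup v r ≡ as →
             ∃[ t ] output t ≡ [ List.null as ] × verdict r ∶ home cs ⟶ t within verdictTime B
    finish xs y ys so sz run [] e with nil xs (trans (Sought.below so) (cong (List.map symbol ∘ reverse) (trans top e)))
    ... | refl = tape [] (bit true) (List.map letter (y ∷ ys)) , refl ,
      relax (+-monoʳ-≤ (seekTime B) (s≤s (s≤s (m≤n+m 1 (homeTime (suc B))))))
        (run ▹-run once-run _ _ ▹-run branch-false (cong nonzero (Vecₚ.lookup-replicate (stackTrack r) zero)) (once-run _ _))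
    finish xs y ys so sz run (a ∷ as) e with Stored-pop {i = stackTrack r} (trans top e) so
    ... | xs′ , x , refl , xa , _ = tape [] (bit false) (List.map letter (xs′ ++ x ∷ y ∷ ys)) ,
      cong (false ∷_) (leadingBits-letters (xs′ ++ x ∷ y ∷ ys)) ,
      (run ▹-run goLeft-run xs′ x y ys ▹-run
       branch-true (cong nonzero (trans (cong (λ c → lookup c (stackTrack r)) (cell-letter x)) xa))
         (homeward-run xs′ x (y ∷ ys) (≤-trans (≤-reflexive (cong length (sym (Listₚ.++-assoc xs′ [ x ] (y ∷ ys))))) sz) ▹-run once-run _ _))

  decider : ℕ → ∀ p → depth p ≤ D → Fin s → Machine
  decider C p d r = prepare C ▹ compile p d ▹ verdict r

  deciderTime : ℕ → Prog → ℕ → ℕ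
  deciderTime C p n = prepareTime C n + (ops p N * unit (N + ops p N) + verdictTime (N + ops p N))
    where N = n + suc C

  decider-run : ∀ C p d r w →
    ∃[ t ] output t ≡ [ List.null (lookup (exec (paddedClock inBit pad C w) p (Vec.replicate s [])) r) ] ×
           decider C p d r ∶ load (List.map bit w) ⟶ t within deciderTime C p (length w)
  decider-run C p d r w =
    let c = paddedClock inBit pad C w
        len = length-paddedClock inBit pad C w
        cells = trans (Listₚ.length-map clockCell c) len
        (cs , st , le , run) = correct c p d {B = (length w + suc C) + ops p (length w + suc C)} (Vec.replicate D []) (Vec.replicate s []) (List.map clockCell c)
          (λ i _ → Vecₚ.lookup-replicate i []) (Stored-clock c)
          (≤-reflexive (cong₂ (λ a b → a + ops p b) cells len))
        (t , out , run′) = verdict-run r c (Vec.replicate D []) (exec c p (Vec.replicate s [])) cs st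
          (≤-trans le (≤-reflexive (cong₂ (λ a b → a + ops p b) cells len)))
    in t , out , (prepare-run C w ▹-run
         relax (≤-reflexive (cong (λ n → ops p n * unit ((length w + suc C) + ops p (length w + suc C))) len)) run ▹-run run′)

  deciderTime-poly : ∀ C p → PolyBounded (deciderTime C p)
  deciderTime-poly C p =
    prepare-poly ⟨+⟩ ((operations ⟨*⟩ ∘-poly unit-poly cells) ⟨+⟩ ∘-poly verdict-poly cells)
    where
    infixr 6 _⟨+⟩_
    infixr 7 _⟨*⟩_
    _⟨+⟩_ : ∀ {f g} → PolyBounded f → PolyBounded g → PolyBounded (λ x → f x + g x)
    _⟨+⟩_ = +-poly
    _⟨*⟩_ : ∀ {f g} → PolyBounded f → PolyBounded g → PolyBounded (λ x → f x * g x)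
    _⟨*⟩_ = *-poly
    clock-poly = id-poly ⟨+⟩ const-poly (suc C)
    operations = ∘-poly (ops-poly p) clock-poly
    cells = clock-poly ⟨+⟩ operations
    home-poly : PolyBounded homeTime
    home-poly = (id-poly ⟨*⟩ const-poly 2) ⟨+⟩ const-poly 1
    seek-poly : PolyBounded seekTime
    seek-poly = const-poly 1 ⟨+⟩ home-poly ⟨+⟩ const-poly 1
    clear-poly : PolyBounded clearTime
    clear-poly = (id-poly ⟨*⟩ const-poly 3) ⟨+⟩ const-poly 1
    prepare-poly : PolyBounded (prepareTime C)
    prepare-poly = const-poly 1 ⟨+⟩ const-poly 1 ⟨+⟩ home-poly ⟨+⟩ const-poly (suc C) ⟨+⟩ ∘-poly home-poly clock-poly
    verdict-poly : PolyBounded (verdictTime)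
    verdict-poly = seek-poly ⟨+⟩ const-poly 1 ⟨+⟩ const-poly 1 ⟨+⟩ ∘-poly home-poly (const-poly 1 ⟨+⟩ id-poly) ⟨+⟩ const-poly 1
    push-poly : PolyBounded pushTime
    push-poly = seek-poly ⟨+⟩ const-poly 1 ⟨+⟩ home-poly
    case-poly : PolyBounded caseTime
    case-poly = seek-poly ⟨+⟩ const-poly 1 ⟨+⟩ const-poly (Finite.card F) ⟨+⟩ const-poly 1 ⟨+⟩ home-poly
    iter-poly : PolyBounded iterTime
    iter-poly = const-poly 1 ⟨+⟩ const-poly (Finite.card F) ⟨+⟩ const-poly 1 ⟨+⟩ home-poly ⟨+⟩ seek-poly
    each-poly : PolyBounded eachTime
    each-poly = seek-poly ⟨+⟩ const-poly 1 ⟨+⟩ const-poly 1 ⟨+⟩ clear-poly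
    unit-poly : PolyBounded unit
    unit-poly =
      let (a , k , bound) = const-poly 1 ⟨+⟩ push-poly ⟨+⟩ case-poly ⟨+⟩ iter-poly ⟨+⟩ each-poly
      in a , k , λ B → ≤-trans (≤-reflexive (unit-≡ B)) (bound B)

module _ (Γ : Set) (F : Finite Γ) (s : ℕ) (inBit : Bool → Γ) (pad : Γ) where

  open Programs Γ F s

  program-P : ∀ (L : Language) C p r →
    (∀ w → let as = lookup (exec (paddedClock inBit pad C w) p (Vec.replicate s [])) r in (as ≡ [] × L w) ⊎ (as ≢ [] × ¬ L w)) → P L
  program-P L C p r decides = toTM M , proj₁ bound , proj₁ (proj₂ bound) , λ w →
    let (t , out , run) = decider-run C p ≤-refl r w
        (n , q , n≤ , halts) = toTM-run M run
    in n , output t , ≤-trans n≤ (proj₂ (proj₂ bound) (length w)) , (q , t , halts , refl) , good w out (decides w)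
    where
    -- One work letter per cell: a cell is a string of one digit per track, where the digit zero
    -- stands for a free entry.
    open Machines (suc (Finite.card F) ^ suc (depth p + s))
    open Deciding Γ F s inBit pad (depth p) (suc (Finite.card F) ^ suc (depth p + s)) encodeVec (decodeVec (suc (depth p + s))) decode-encode
    M = decider C p ≤-refl r
    bound = poly-bound (+-poly (const-poly 1) (deciderTime-poly C p))
    good : ∀ w {o} {as : List Γ} → o ≡ [ List.null as ] → (as ≡ [] × L w) ⊎ (as ≢ [] × ¬ L w) → Decision L w o
    good w             out (inj₁ (refl , l)) = inj₁ (l , out)
    good w {as = []}   out (inj₂ (ne , ¬l)) = contradiction refl ne
    good w {as = _ ∷ _} out (inj₂ (ne , ¬l)) = inj₂ (¬l , out)

-- Loops and simulation of Turing machines in stack programs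

iter : ∀ {A : Set} → ℕ → (A → A) → A → A
iter zero    f x = x
iter (suc n) f x = iter n f (f x)

iter-+ : ∀ {A : Set} m n (f : A → A) x → iter (m + n) f x ≡ iter n f (iter m f x)
iter-+ zero    n f x = refl
iter-+ (suc m) n f x = iter-+ m n f (f x)

iter-* : ∀ {A : Set} m n (f : A → A) x → iter (m * n) f x ≡ iter m (iter n f) x
iter-* zero    n f x = refl
iter-* (suc m) n f x = trans (iter-+ n (m * n) f x) (iter-* m n f (iter n f x))

iter-suc : ∀ {A : Set} n (f : A → A) x → iter (suc n) f x ≡ f (iter n f x)
iter-suc zero    f x = refl
iter-suc (suc n) f x = iter-suc n f (f x)

iter-fixed : ∀ {A : Set} n {f : A → A} {x} → f x ≡ x → iter n f x ≡ x
iter-fixed zero            e = refl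
iter-fixed (suc n) {f} {x} e = trans (cong (iter n f) e) (iter-fixed n e)

iter-stable : ∀ {A : Set} {m n} {f : A → A} {x y} → m ≤ n → iter m f x ≡ y → f y ≡ y → iter n f x ≡ y
iter-stable {m = m} {n} {f} {x} m≤n refl e = begin
  iter n f x                    ≡⟨ cong (λ n → iter n f x) (ℕₚ.m+[n∸m]≡n m≤n) ⟨
  iter (m + (n ∸ m)) f x        ≡⟨ iter-+ m (n ∸ m) f x ⟩
  iter (n ∸ m) f (iter m f x)   ≡⟨ iter-fixed (n ∸ m) e ⟩
  iter m f x                    ∎
  where open ≡-Reasoning

iter-steps : ∀ {A : Set} n {f : A → A} (x : ℕ → A) → (∀ {i} → i < n → f (x i) ≡ x (suc i)) → iter n f (x 0) ≡ x n
iter-steps zero    x steps = refl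
iter-steps (suc n) {f} x steps = trans (cong (iter n f) (steps (s≤s z≤n))) (iter-steps n (x ∘ suc) (λ i<n → steps (s≤s i<n)))

module _ {A : Set} where

  -- It idles once the first list is empty, so a loop may make more rounds than there are symbols to
  -- move; an upper bound on their number is enough.
  transfer : List A × List A → List A × List A
  transfer ([]     , ys) = [] , ys
  transfer (x ∷ xs , ys) = xs , x ∷ ys

  iter-transfer : ∀ n xs ys → iter n transfer (xs , ys) ≡ (List.drop n xs , List.take n xs ʳ++ ys)
  iter-transfer zero    xs       ys = refl
  iter-transfer (suc n) []       ys = iter-fixed n refl
  iter-transfer (suc n) (x ∷ xs) ys = iter-transfer n xs (x ∷ ys)

  iter-transfer-all : ∀ {n} xs ys → length xs ≤ n → iter n transfer (xs , ys) ≡ ([] , xs ʳ++ ys)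
  iter-transfer-all {n} xs ys le = trans (iter-transfer n xs ys)
    (cong₂ (λ as bs → as , bs ʳ++ ys) (Listₚ.drop-all n xs le) (Listₚ.take-all n xs le))

module Loops (Γ : Set) (F : Finite Γ) (s : ℕ) where

  open Programs Γ F s

  rep : ℕ → Prog → Prog
  rep zero    p = p
  rep (suc e) p = each (λ _ → rep e p)

  foldl-iter : ∀ {A B : Set} (f : A → A) x (bs : List B) → foldl (λ x _ → f x) x bs ≡ iter (length bs) f x
  foldl-iter f x []       = refl
  foldl-iter f x (_ ∷ bs) = foldl-iter f (f x) bs

  foldl-cong : ∀ {A B : Set} {f g : A → B → A} → (∀ x b → f x b ≡ g x b) → ∀ x bs → foldl f x bs ≡ foldl g x bs
  foldl-cong e x []       = refl
  foldl-cong {g = g} e x (b ∷ bs) = trans (cong (λ x → foldl _ x bs) (e x b)) (foldl-cong e (g x b) bs)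

  exec-rep : ∀ c e p v → exec c (rep e p) v ≡ iter (length c ^ e) (exec c p) v
  exec-rep c zero    p v = refl
  exec-rep c (suc e) p v = begin
    foldl (λ v _ → exec c (rep e p) v) v c                       ≡⟨ foldl-cong (λ x _ → exec-rep c e p x) v c ⟩
    foldl (λ v _ → iter (length c ^ e) (exec c p) v) v c         ≡⟨ foldl-iter (iter (length c ^ e) (exec c p)) v c ⟩
    iter (length c) (iter (length c ^ e) (exec c p)) v           ≡⟨ iter-* (length c) (length c ^ e) (exec c p) v ⟨
    iter (length c * length c ^ e) (exec c p) v                  ∎
    where open ≡-Reasoning

  -- S lays out as a store the part of it on which the loop acts.
  exec-rep-as : ∀ {A : Set} c e p (S : A → Store) (f : A → A) → (∀ x → exec c p (S x) ≡ S (f x)) →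
                ∀ x → exec c (rep e p) (S x) ≡ S (iter (length c ^ e) f x)
  exec-rep-as c e p S f h x = trans (exec-rep c e p (S x)) (go (length c ^ e) x)
    where
    go : ∀ n x → iter n (exec c p) (S x) ≡ S (iter n f x)
    go zero    x = refl
    go (suc n) x = trans (cong (iter n (exec c p)) (h x)) (go n (f x))

  exec-rep-steps : ∀ c e p (x : ℕ → Store) → (∀ {i} → i < length c ^ e → exec c p (x i) ≡ x (suc i)) →
                   exec c (rep e p) (x 0) ≡ x (length c ^ e)
  exec-rep-steps c e p x h = trans (exec-rep c e p (x 0)) (iter-steps (length c ^ e) x h)

data Sym (k m : ℕ) (X : Set) : Set where
  onTape : Symbol k → Sym k m X
  ctrl   : Fin m → Sym k m X
  aux    : X → Sym k m X

finite-Sym : ∀ k m {X} → Finite X → Finite (Sym k m X)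
finite-Sym k m {X} F = finite-retract to from (λ { (onTape _) → refl ; (ctrl _) → refl ; (aux _) → refl })
  (finite-⊎ (finite-Symbol k) (finite-⊎ (finite-Fin m) F))
  where
  to : Sym k m X → Symbol k ⊎ (Fin m ⊎ X)
  to (onTape a) = inj₁ a
  to (ctrl q)   = inj₂ (inj₁ q)
  to (aux x)    = inj₂ (inj₂ x)
  from : Symbol k ⊎ (Fin m ⊎ X) → Sym k m X
  from (inj₁ a)        = onTape a
  from (inj₂ (inj₁ q)) = ctrl q
  from (inj₂ (inj₂ x)) = aux x

-- A total version of `step` that fixes halting configurations. Any number of rounds from the
-- running time on gives the final configuration, so the simulation may run for a power of the
-- clock's length.
advance : (M : TM) → Config M → Config M
advance M c = Maybe.fromMaybe c (Defs.step M c)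

advance-halted : ∀ M {c} → Defs.step M c ≡ nothing → advance M c ≡ c
advance-halted M {c} e = cong (Maybe.fromMaybe c) e

HaltsFrom-iter : ∀ M {c t d} → HaltsFrom M c t d → iter t (advance M) c ≡ d × Defs.step M d ≡ nothing
HaltsFrom-iter M (halt e) = refl , e
HaltsFrom-iter M {c} (next {c′ = c′} {t = t} e h) =
  let (p , q) = HaltsFrom-iter M h in trans (cong (iter t (advance M) ∘ Maybe.fromMaybe c) e) p , q

HaltsFrom-iter-≤ : ∀ M {c t d n} → HaltsFrom M c t d → t ≤ n → iter n (advance M) c ≡ d
HaltsFrom-iter-≤ M h le = let (p , q) = HaltsFrom-iter M h in iter-stable le p (advance-halted M q)

output-head : ∀ {k} (t : Tape (Symbol k)) {b o} → output t ≡ b ∷ o → Tape.here t ≡ bit b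
output-head (tape _ (bit _) _) refl = refl

-- Stacks 0 and 1 hold the tape to the left of the head and from the head on, stack 2 the state.

module Simulation (M : TM) (X : Set) (FX : Finite X) (s : ℕ) where

  open TM M

  Γ : Set
  Γ = Sym extra (suc states-1) X

  FΓ : Finite Γ
  FΓ = finite-Sym extra (suc states-1) FX

  open Programs Γ FΓ (3 + s)
  open Loops Γ FΓ (3 + s)

  letters : List (Symbol extra) → List Γ
  letters = List.map onTape

  config : Config M → Vec (List Γ) s → Store
  config (q , tape ls a rs) v = letters ls ∷ letters (a ∷ rs) ∷ [ ctrl q ] ∷ v

  perform : State → Letter → Maybe (State × Letter × Move) → Prog
  perform q a nothing                 = push 2F (ctrl q) ⨾ push 1F (onTape a)
  perform q a (just (q′ , a′ , stay)) = push 2F (ctrl q′) ⨾ push 1F (onTape a′)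
  perform q a (just (q′ , a′ , left)) = push 2F (ctrl q′) ⨾ push 1F (onTape a′) ⨾
    case 0F (λ { nothing → push 1F (onTape blank) ; (just x) → push 1F x })
  perform q a (just (q′ , a′ , right)) = push 2F (ctrl q′) ⨾ push 0F (onTape a′) ⨾
    case 1F (λ { nothing → push 1F (onTape blank) ; (just x) → push 1F x })

  simulate : Prog
  simulate = case 2F λ { (just (ctrl q)) → case 1F (λ { (just (onTape a)) → perform q a (δ q a) ; _ → skip }) ; _ → skip }

  simulate-step : ∀ c x v → exec c simulate (config x v) ≡ config (advance M x) v
  simulate-step c (q , tape ls a rs) v with δ q a
  ... | nothing = refl
  ... | just (q′ , a′ , stay) = refl
  simulate-step c (q , tape []       a rs)       v | just (q′ , a′ , left)  = refl
  simulate-step c (q , tape (l ∷ ls) a rs)       v | just (q′ , a′ , left)  = refl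
  simulate-step c (q , tape ls       a [])       v | just (q′ , a′ , right) = refl
  simulate-step c (q , tape ls       a (r ∷ rs)) v | just (q′ , a′ , right) = refl

  start : Prog
  start = push 2F (ctrl zero) ⨾ case 1F (λ { nothing → push 1F (onTape blank) ; (just x) → push 1F x })

  start-config : ∀ c as v → exec c start ([] ∷ letters as ∷ [] ∷ v) ≡ config (zero , load as) v
  start-config c []       v = refl
  start-config c (a ∷ as) v = refl

  run-simulation : ∀ c e {w t q s} v → HaltsFrom M (initial M w) t (q , s) → t ≤ length c ^ e →
                   exec c (start ⨾ rep e simulate) ([] ∷ letters (List.map bit w) ∷ [] ∷ v) ≡ config (q , s) v
  run-simulation c e {w} v h le = begin
    exec c (rep e simulate) (exec c start ([] ∷ letters (List.map bit w) ∷ [] ∷ v)) ≡⟨ cong (exec c (rep e simulate)) (start-config c (List.map bit w) v) ⟩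
    exec c (rep e simulate) (config (initial M w) v)              ≡⟨ exec-rep-as c e simulate (λ x → config x v) (advance M) (λ x → simulate-step c x v) (initial M w) ⟩
    config (iter (length c ^ e) (advance M) (initial M w)) v      ≡⟨ cong (λ x → config x v) (HaltsFrom-iter-≤ M h le) ⟩
    config _ v                                                    ∎
    where open ≡-Reasoning

-- One factor m pays for the coefficient 2 a, and the rest multiplies exponents. This is how every
-- polynomial time bound becomes a power of the clock's length.
poly-≤ : ∀ {a k x m} j → 2 * a ≤ m → 1 ≤ m → x ≤ m ^ j → poly a k x ≤ m ^ suc (j * k)
poly-≤ {a} {k} {x} {m} j 2a≤m 1≤m x≤ = begin
  a + a * x ^ k                       ≤⟨ +-mono-≤ (≤-trans (≤-reflexive (sym (*-identityʳ a))) (*-monoʳ-≤ a (1≤^ (j * k)))) (*-monoʳ-≤ a (≤-trans (^-monoˡ-≤ k x≤) (≤-reflexive (ℕₚ.^-*-assoc m j k)))) ⟩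
  a * m ^ (j * k) + a * m ^ (j * k)   ≡⟨ double a (m ^ (j * k)) ⟩
  2 * a * m ^ (j * k)                 ≤⟨ *-monoˡ-≤ (m ^ (j * k)) 2a≤m ⟩
  m ^ suc (j * k)                     ∎
  where
  open ≤-Reasoning
  double : ∀ a b → a * b + a * b ≡ 2 * a * b
  double = solve-∀
  1≤^ : ∀ n → 1 ≤ m ^ n
  1≤^ n = ≤-trans (≤-reflexive (sym (ℕₚ.^-zeroˡ n))) (^-monoˡ-≤ n 1≤m)

-- P is contained in NP

unpair : Word → Maybe Word
unpair []              = nothing
unpair (false ∷ y)     = just []
unpair (true ∷ [])     = nothing
unpair (true ∷ b ∷ z)  = Maybe.map (b ∷_) (unpair z)

unpair-pair : ∀ x y → unpair (pair x y) ≡ just x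
unpair-pair []      y = refl
unpair-pair (b ∷ x) y = cong (Maybe.map (b ∷_)) (unpair-pair x y)

unpair-just : ∀ z {x} → unpair z ≡ just x → ∃[ y ] z ≡ pair x y
unpair-just (false ∷ y)    refl = y , refl
unpair-just (true ∷ b ∷ z) e with unpair z in eq
unpair-just (true ∷ b ∷ z) refl | just x = let (y , p) = unpair-just z eq in y , cong (λ z → true ∷ b ∷ z) p

unpair-length : ∀ z {x} → unpair z ≡ just x → length x ≤ length z
unpair-length (false ∷ y)    refl = z≤n
unpair-length (true ∷ b ∷ z) e with unpair z in eq
unpair-length (true ∷ b ∷ z) refl | just x = s≤s (≤-trans (unpair-length z eq) (n≤1+n _))

module FirstComponent (L : Language) (PL : P L) where

  M : TM
  M = proj₁ PL

  a k : ℕ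
  a = proj₁ (proj₂ PL)
  k = proj₁ (proj₂ (proj₂ PL))

  -- The parser's memory on stack 3: the stack is empty where a flag is expected, holds `inPair`
  -- after the flag `true`, when a bit of the first component is due, and holds `done` after the
  -- flag `false`.
  data Mode : Set where
    inPair done : Mode

  finite-Mode : Finite Mode
  finite-Mode = finite-retract (λ { inPair → false ; done → true }) (λ { false → inPair ; true → done })
    (λ { inPair → refl ; done → refl }) finite-Bool

  open Simulation M Mode finite-Mode 2 public
  open Programs Γ FΓ 5
  open Loops Γ FΓ 5

  inBit : Bool → Γ
  inBit b = onTape (bit b)

  parseBit : Bool → Prog
  parseBit b = case 3F λ where
    nothing             → push 3F (aux (if b then inPair else done))
    (just (aux inPair)) → push 0F (inBit b)
    (just x)            → push 3F x

  parse : Γ → Prog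
  parse (onTape (bit b)) = parseBit b
  parse _                = skip

  moveLetter : Prog
  moveLetter = case 0F λ { nothing → skip ; (just x) → push 1F x }

  judge : Prog
  judge = case 1F λ { (just (onTape (bit true))) → skip ; _ → push 4F (aux done) }

  -- The exponent that `poly-≤` gives for j = 1, since the simulated word is no longer than the
  -- clock. The condition 2 a ≤ m of that lemma is the reason for the padding `suc (2 * a)` of the
  -- clock.
  exponent : ℕ
  exponent = suc (1 * k)

  afterParse : Prog
  afterParse = case 3F λ where
    (just (aux done)) → rep 1 moveLetter ⨾ (start ⨾ rep exponent simulate) ⨾ judge
    _                 → push 4F (aux done)

  program : Prog
  program = each parse ⨾ afterParse

  module _ (z : Word) where

    c : List Γ
    c = paddedClock inBit (onTape blank) (suc (2 * a)) z

    parsed : List Γ → Maybe Mode → Store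
    parsed l m = l ∷ [] ∷ [] ∷ maybe (λ x → [ aux x ]) [] m ∷ [] ∷ []

    private
      feed : Store → List Γ → Store
      feed = foldl (λ v x → exec c (parse x) v)

      feed-done : ∀ w l → feed (parsed l (just done)) (List.map inBit w) ≡ parsed l (just done)
      feed-done []      l = refl
      feed-done (b ∷ w) l = feed-done w l

      feed-pads : ∀ v n → feed v (replicate n (onTape blank)) ≡ v
      feed-pads v zero    = refl
      feed-pads v (suc n) = feed-pads v n

    data Parse (l : List Γ) (w : Word) (v : Store) : Set where
      good : ∀ x → unpair w ≡ just x → v ≡ parsed (List.map inBit x ʳ++ l) (just done) → Parse l w v
      bad  : ∀ m l′ → unpair w ≡ nothing → m ≢ just done → v ≡ parsed l′ m → Parse l w v

    parse-word : ∀ w l → Parse l w (feed (parsed l nothing) (List.map inBit w))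
    parse-word []             l = bad nothing l refl (λ ()) refl
    parse-word (false ∷ w)    l = good [] refl (feed-done w l)
    parse-word (true ∷ [])    l = bad (just inPair) l refl (λ ()) refl
    parse-word (true ∷ b ∷ w) l with parse-word w (inBit b ∷ l)
    ... | good x e p       = good (b ∷ x) (cong (Maybe.map (b ∷_)) e) p
    ... | bad m l′ e ne p = bad m l′ (cong (Maybe.map (b ∷_)) e) ne p

    parse-clock : ∀ v → exec c (each parse) v ≡ feed v (List.map inBit z)
    parse-clock v = begin
      feed v c                                                        ≡⟨ Listₚ.foldl-++ _ v (List.map inBit z ++ replicate (suc (2 * a)) (onTape blank)) [ onTape blank ] ⟩
      feed v (List.map inBit z ++ replicate (suc (2 * a)) (onTape blank)) ≡⟨ Listₚ.foldl-++ _ v (List.map inBit z) _ ⟩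
      feed (feed v (List.map inBit z)) (replicate (suc (2 * a)) (onTape blank)) ≡⟨ feed-pads _ (suc (2 * a)) ⟩
      feed v (List.map inBit z)                                       ∎
      where open ≡-Reasoning

    size-clock : length c ≡ length z + suc (suc (2 * a))
    size-clock = length-paddedClock inBit (onTape blank) (suc (2 * a)) z

    private
      FirstIn : Set
      FirstIn = ∃₂ λ x y → z ≡ pair x y × L x

      Judged : Store → Set
      Judged v = (lookup v 4F ≡ [] × FirstIn) ⊎ (lookup v 4F ≢ [] × ¬ FirstIn)

      judged-config : ∀ {x y o} q s → z ≡ pair x y → output s ≡ o → Decision L x o → Judged (exec c judge (config (q , s) ([] ∷ [] ∷ [])))
      judged-config {x} {y} q (tape ls a rs) e out (inj₁ (l , refl)) with output-head (tape ls a rs) out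
      ... | refl = inj₁ (refl , x , y , e , l)
      judged-config {x} {y} q (tape ls a rs) e out (inj₂ (¬l , refl)) with output-head (tape ls a rs) out
      ... | refl = inj₂ ((λ ()) , λ (x′ , y′ , e′ , l) → ¬l (subst L (first-unique e e′) l))
        where
        first-unique : ∀ {x y x′ y′} → z ≡ pair x y → z ≡ pair x′ y′ → x′ ≡ x
        first-unique {x} {y} {x′} {y′} refl e′ with trans (sym (unpair-pair x y)) (trans (cong unpair e′) (unpair-pair x′ y′))
        ... | refl = refl

      moved : ∀ l → length l ≤ length c → exec c (rep 1 moveLetter) (l ∷ [] ∷ [] ∷ [] ∷ [] ∷ []) ≡ [] ∷ reverse l ∷ [] ∷ [] ∷ [] ∷ []
      moved l le = trans
        (exec-rep-as c 1 moveLetter (λ (l , r) → l ∷ r ∷ [] ∷ [] ∷ [] ∷ []) transfer (λ { ([] , _) → refl ; (_ ∷ _ , _) → refl }) (l , []))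
        (cong (λ (l , r) → l ∷ r ∷ [] ∷ [] ∷ [] ∷ []) (iter-transfer-all l [] (≤-trans le (≤-reflexive (sym (*-identityʳ (length c)))))))

    accepts : Judged (exec c program (Vec.replicate 5 []))
    accepts = subst Judged (cong (exec c afterParse) (sym (parse-clock (Vec.replicate 5 [])))) (parsed-word (parse-word z []))
      where
      size-w : length z ≤ length c
      size-w = ≤-trans (m≤m+n _ _) (≤-reflexive (sym size-clock))

      large : ∀ {n} → n ≤ suc (suc (2 * a)) → n ≤ length c
      large le = ≤-trans le (≤-trans (m≤n+m _ (length z)) (≤-reflexive (sym size-clock)))

      bad-mode : ∀ m l → m ≢ just done → ¬ FirstIn → Judged (exec c afterParse (parsed l m))
      bad-mode nothing       l ne n = inj₂ ((λ ()) , n)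
      bad-mode (just inPair) l ne n = inj₂ ((λ ()) , n)
      bad-mode (just done)   l ne n = contradiction refl ne

      parsed-word : ∀ {v} → Parse [] z v → Judged (exec c afterParse v)
      parsed-word (bad m l e ne refl) = bad-mode m l ne λ { (x , y , refl , _) → contradiction (trans (sym (unpair-pair x y)) e) λ () }
      parsed-word (good x e refl) = subst Judged
        (cong (exec c judge) (sym (trans (cong (exec c (start ⨾ rep exponent simulate))
            (trans (moved (List.map inBit x ʳ++ []) size-x) (cong (λ r → [] ∷ r ∷ [] ∷ [] ∷ [] ∷ [])
              (trans (Listₚ.ʳ++-ʳ++ (List.map inBit x)) (trans (Listₚ.++-identityʳ _) (Listₚ.map-∘ x))))))
          (run-simulation c exponent {w = x} ([] ∷ [] ∷ []) halts
            (≤-trans t≤ (poly-≤ {a} {k} 1 (large (≤-trans (n≤1+n _) (n≤1+n _))) (large (s≤s z≤n)) (≤-trans (unpair-length z e) (≤-trans size-w (≤-reflexive (sym (*-identityʳ (length c)))))))))))) 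
        (judged-config q s (proj₂ (unpair-just z e)) out dec)
        where
        run = proj₂ (proj₂ (proj₂ PL)) x
        t≤ = proj₁ (proj₂ (proj₂ run))
        q = proj₁ (proj₁ (proj₂ (proj₂ (proj₂ run))))
        s = proj₁ (proj₂ (proj₁ (proj₂ (proj₂ (proj₂ run)))))
        halts = proj₁ (proj₂ (proj₂ (proj₁ (proj₂ (proj₂ (proj₂ run))))))
        out = proj₂ (proj₂ (proj₂ (proj₁ (proj₂ (proj₂ (proj₂ run))))))
        dec = proj₂ (proj₂ (proj₂ (proj₂ run)))
        size-x : length (List.map inBit x ʳ++ []) ≤ length c
        size-x = ≤-trans (≤-reflexive (trans (Listₚ.length-reverse (List.map inBit x)) (Listₚ.length-map inBit x))) (≤-trans (unpair-length z e) size-w)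

-- The verifier accepts a pair if its first component lies in L. As `poly 0 0` is 0, the only
-- certificate is the empty word; `unpair` shows that the first component is determined by the pair.
P⊆NP : ∀ {L} → P L → NP L
P⊆NP {L} PL = V , program-P Γ FΓ 5 inBit (onTape blank) V (suc (2 * a)) program 4F accepts , 0 , 0 , λ w → mk⇔
  (λ l → [] , z≤n , w , [] , refl , l)
  (λ (y , _ , x , y′ , e , l) → subst L (just-injective (trans (sym (unpair-pair x y′)) (trans (cong unpair (sym e)) (unpair-pair w y)))) l)
  where
  open FirstComponent L PL
  V : Language
  V z = ∃₂ λ x y → z ≡ pair x y × L x
  just-injective : ∀ {x y : Word} → just x ≡ just y → x ≡ y
  just-injective refl = refl

-- The tableau of a computation

nth : ∀ {A : Set} → A → List A → ℕ → A
nth a []       _       = a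
nth a (x ∷ xs) zero    = x
nth a (x ∷ xs) (suc n) = nth a xs n

nth-replicate-++ : ∀ {A : Set} {a : A} m {b} xs i → nth a (replicate m b ++ xs) (m + i) ≡ nth a xs i
nth-replicate-++ zero    xs i = refl
nth-replicate-++ (suc m) xs i = nth-replicate-++ m xs i

nth-blanks : ∀ {A : Set} {a : A} m i → nth a (replicate m a) i ≡ a
nth-blanks zero    i       = refl
nth-blanks (suc m) zero    = refl
nth-blanks (suc m) (suc i) = nth-blanks m i

nth-++-blanks : ∀ {A : Set} {a : A} xs m i → nth a (xs ++ replicate m a) i ≡ nth a xs i
nth-++-blanks []       m i       = nth-blanks m i
nth-++-blanks (x ∷ xs) m zero    = refl
nth-++-blanks (x ∷ xs) m (suc i) = nth-++-blanks xs m i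

nth-map : ∀ {A B : Set} {a : A} (f : A → B) xs i → nth (f a) (List.map f xs) i ≡ f (nth a xs i)
nth-map f []       i       = refl
nth-map f (x ∷ xs) zero    = refl
nth-map f (x ∷ xs) (suc i) = nth-map f xs i

data Slot : Set where
  above-left above above-right below : Slot

-- Rows have length W = ℓ + 2, so the square under the middle one, j + 1, has the number j + 1 + W =
-- 3 + ℓ + j.
offset : ℕ → Slot → ℕ
offset ℓ above-left  = 0
offset ℓ above       = 1
offset ℓ above-right = 2
offset ℓ below       = 3 + ℓ

-- Clause j, with the given literals, holds under an assignment that makes
-- Tr e σ true and Fa e σ false.
Holds : {Square : Set} → (Bool → Slot → Square → Bool) → (Tr Fa : ℕ → Square → Set) → ℕ → ℕ → Set
Holds literal Tr Fa ℓ j = ∃₂ λ s σ →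
  (T (literal false s σ) × Fa (offset ℓ s + j) σ) ⊎ (T (literal true s σ) × Tr (offset ℓ s + j) σ)

-- What the first row demands of square j + 1, for the label with index j: a given content, a part
-- of the certificate, or nothing. The last is the default beyond the first row.
data Label (Square : Set) : Set where
  free  : Label Square
  fixed : Square → Label Square
  guess : Label Square

-- Every index carries all kinds of clauses, whatever its label, so that the clause vertices form a
-- regular array. Where a kind has nothing to say about a label, its clause is a tautology.
data Kind (Square : Set) : Set where
  local                 : Square → Square → Square → Kind Square
  initial₁ initial₂     : Kind Square

finite-Slot : Finite Slot
finite-Slot = finite-retract {B = Fin 4}
  (λ { above-left → 0F ; above → 1F ; above-right → 2F ; below → 3F })
  (λ { 0F → above-left ; 1F → above ; 2F → above-right ; 3F → below })
  (λ { above-left → refl ; above → refl ; above-right → refl ; below → refl }) (finite-Fin 4)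

finite-Label : ∀ {A} → Finite A → Finite (Label A)
finite-Label F = finite-retract
  (λ { free → nothing ; guess → just nothing ; (fixed x) → just (just x) })
  (λ { nothing → free ; (just nothing) → guess ; (just (just x)) → fixed x })
  (λ { free → refl ; guess → refl ; (fixed _) → refl }) (finite-Maybe (finite-Maybe F))

finite-Kind : ∀ {A} → Finite A → Finite (Kind A)
finite-Kind F = finite-retract
  (λ { initial₁ → nothing ; initial₂ → just nothing ; (local x y z) → just (just (x , y , z)) })
  (λ { nothing → initial₁ ; (just nothing) → initial₂ ; (just (just (x , y , z))) → local x y z })
  (λ { initial₁ → refl ; initial₂ → refl ; (local _ _ _) → refl }) (finite-Maybe (finite-Maybe (finite-× F (finite-× F F))))

module Tableau (M : TM) where

  open TM M

  -- A square of the tableau holds a letter, and the state if the head is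
  -- there.  State nothing is used in the first row only: the head starts on
  -- the blank before the input, which it leaves to the right in state zero.

  Phase : Set
  Phase = Maybe State

  Square : Set
  Square = Letter × Maybe Phase

  finite-Square : Finite Square
  finite-Square = finite-× (finite-Symbol extra) (finite-Maybe (finite-Maybe (finite-Fin _)))

  plain : Letter → Square
  plain a = a , nothing

  blankSquare startSquare : Square
  blankSquare = plain blank
  startSquare = blank , just nothing

  δ′ : Phase → Letter → Maybe (Phase × Letter × Move)
  δ′ nothing  a = just (just zero , a , right)
  δ′ (just q) a = Maybe.map (map₁ just) (δ q a)

  effect : Square → Maybe (Phase × Letter × Move)
  effect (a , nothing) = nothing
  effect (a , just q)  = δ′ q a

  -- In a row of a computation only one square carries the head. The rule must nevertheless be
  -- defined on all triples; if both neighbours send a head, the preference is arbitrary.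
  arriving : Maybe (Phase × Letter × Move) → Maybe (Phase × Letter × Move) → Maybe Phase
  arriving (just (q , _ , right)) _                    = just q
  arriving _                      (just (q , _ , left)) = just q
  arriving _                      _                    = nothing

  leaving : Letter → Phase → Maybe (Phase × Letter × Move) → Square
  leaving a q nothing                 = a , just q
  leaving a q (just (q′ , a′ , stay)) = a′ , just q′
  leaving a q (just (q′ , a′ , _))    = a′ , nothing

  successor : Square → Square → Square → Square
  successor x (a , nothing) z = a , arriving (effect x) (effect z)
  successor x (a , just q)  z = leaving a q (δ′ q a)

  -- One square suffices to recognise rejection: the verifier's output is `[ true ]` or `[ false ]`,
  -- and the output begins at the head.
  rejecting : Square → Bool
  rejecting (bit false , just (just q)) = Maybe.is-nothing (δ q (bit false))
  rejecting _                           = false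

  -- Positions are relative to the head.
  square : Phase × Tape Letter → ℤ → Square
  square (q , tape ls a rs) (ℤ.+ zero)  = a , just q
  square (q , tape ls a rs) (ℤ.+ suc i) = plain (nth blank rs i)
  square (q , tape ls a rs) -[1+ i ]    = plain (nth blank ls i)

  shift : Maybe (Phase × Letter × Move) → ℤ → ℤ
  shift nothing               d = d
  shift (just (_ , _ , left))  d = ℤ.suc d
  shift (just (_ , _ , stay))  d = d
  shift (just (_ , _ , right)) d = ℤ.pred d

  moved : Maybe (Phase × Letter × Move) → Phase × Tape Letter → Phase × Tape Letter
  moved nothing             c       = c
  moved (just (q , a , m)) (_ , t) = q , move m (write a t)

  action : Phase × Tape Letter → Maybe (Phase × Letter × Move)
  action (q , t) = δ′ q (Tape.here t)

  -- In coordinates relative to the head, only the positions -1, 0 and 1 see the head in their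
  -- neighbourhood; elsewhere the letters are merely renumbered by `shift`. The end of a listed half
  -- tape needs its own cases, where the default of `nth` supplies the blank.
  local-rule : ∀ c d → square (moved (action c) c) (shift (action c) d) ≡ successor (square c (ℤ.pred d)) (square c d) (square c (ℤ.suc d))
  local-rule c@(q , tape ls a rs) d with δ′ q a in eq
  local-rule (q , tape ls a rs) (ℤ.+ 0) | r with δ′ q a | eq
  local-rule (q , tape ls a rs)       (ℤ.+ 0) | nothing               | _ | refl = refl
  local-rule (q , tape [] a rs)       (ℤ.+ 0) | just (_ , _ , left)   | _ | refl = refl
  local-rule (q , tape (_ ∷ _) a rs)  (ℤ.+ 0) | just (_ , _ , left)   | _ | refl = refl
  local-rule (q , tape ls a rs)       (ℤ.+ 0) | just (_ , _ , stay)   | _ | refl = refl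
  local-rule (q , tape ls a [])       (ℤ.+ 0) | just (_ , _ , right)  | _ | refl = refl
  local-rule (q , tape ls a (_ ∷ _))  (ℤ.+ 0) | just (_ , _ , right)  | _ | refl = refl
  local-rule (q , tape ls a rs) (ℤ.+ 1) | r with δ′ q a | eq
  local-rule (q , tape ls a rs)       (ℤ.+ 1) | nothing               | _ | refl = refl
  local-rule (q , tape [] a rs)       (ℤ.+ 1) | just (_ , _ , left)   | _ | refl = refl
  local-rule (q , tape (_ ∷ _) a rs)  (ℤ.+ 1) | just (_ , _ , left)   | _ | refl = refl
  local-rule (q , tape ls a rs)       (ℤ.+ 1) | just (_ , _ , stay)   | _ | refl = refl
  local-rule (q , tape ls a [])       (ℤ.+ 1) | just (_ , _ , right)  | _ | refl = refl
  local-rule (q , tape ls a (_ ∷ _))  (ℤ.+ 1) | just (_ , _ , right)  | _ | refl = refl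
  local-rule (q , tape ls a rs)       (ℤ.+ suc (suc i)) | nothing              = refl
  local-rule (q , tape [] a rs)       (ℤ.+ suc (suc i)) | just (_ , _ , left)  = refl
  local-rule (q , tape (_ ∷ _) a rs)  (ℤ.+ suc (suc i)) | just (_ , _ , left)  = refl
  local-rule (q , tape ls a rs)       (ℤ.+ suc (suc i)) | just (_ , _ , stay)  = refl
  local-rule (q , tape ls a [])       (ℤ.+ suc (suc i)) | just (_ , _ , right) = refl
  local-rule (q , tape ls a (_ ∷ _))  (ℤ.+ suc (suc i)) | just (_ , _ , right) = refl
  local-rule (q , tape ls a rs) -[1+ 0 ] | r with δ′ q a | eq
  local-rule (q , tape ls a rs)       -[1+ 0 ] | nothing               | _ | refl = refl
  local-rule (q , tape [] a rs)       -[1+ 0 ] | just (_ , _ , left)   | _ | refl = refl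
  local-rule (q , tape (_ ∷ _) a rs)  -[1+ 0 ] | just (_ , _ , left)   | _ | refl = refl
  local-rule (q , tape ls a rs)       -[1+ 0 ] | just (_ , _ , stay)   | _ | refl = refl
  local-rule (q , tape ls a [])       -[1+ 0 ] | just (_ , _ , right)  | _ | refl = refl
  local-rule (q , tape ls a (_ ∷ _))  -[1+ 0 ] | just (_ , _ , right)  | _ | refl = refl
  local-rule (q , tape ls a rs)       -[1+ suc i ] | nothing              = refl
  local-rule (q , tape [] a rs)       -[1+ suc i ] | just (_ , _ , left)  = refl
  local-rule (q , tape (_ ∷ _) a rs)  -[1+ suc i ] | just (_ , _ , left)  = refl
  local-rule (q , tape ls a rs)       -[1+ suc i ] | just (_ , _ , stay)  = refl
  local-rule (q , tape ls a [])       -[1+ suc i ] | just (_ , _ , right) = refl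
  local-rule (q , tape ls a (_ ∷ _))  -[1+ suc i ] | just (_ , _ , right) = refl

module Rows (M : TM) (u : Word) (h : ℕ) where

  open TM M
  open Tableau M

  embed : Config M → Phase × Tape Letter
  embed (q , s) = just q , s

  run : ℕ → Config M
  run t = iter t (advance M) (initial M u)

  -- Row 0 precedes the computation, so row `suc t` shows it after t steps. With the head on an
  -- extra square before the word, all letters of the word, known or guessed, are plain in the first
  -- row.
  conf : ℕ → Phase × Tape Letter
  conf zero    = nothing , tape [] blank (List.map bit u)
  conf (suc t) = embed (run t)

  -- The motion of the head is recorded by shifting all relative positions against it, so that the
  -- columns p stay fixed from row to row.
  rel : ℕ → ℕ → ℤ
  rel zero    p = p ℤ.⊖ h
  rel (suc t) p = shift (action (conf t)) (rel t p)

  row : ℕ → ℕ → Square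
  row t p = square (conf t) (rel t p)

  private
    shift-suc : ∀ r d → shift r (ℤ.suc d) ≡ ℤ.suc (shift r d)
    shift-suc nothing                d = refl
    shift-suc (just (_ , _ , left))  d = refl
    shift-suc (just (_ , _ , stay))  d = refl
    shift-suc (just (_ , _ , right)) d = trans (ℤₚ.pred-suc d) (sym (ℤₚ.suc-pred d))

  rel-suc : ∀ t p → rel t (suc p) ≡ ℤ.suc (rel t p)
  rel-suc zero    p = sym (ℤₚ.distribʳ-⊖-+-pos 1 p h)
  rel-suc (suc t) p = trans (cong (shift (action (conf t))) (rel-suc t p)) (shift-suc (action (conf t)) (rel t p))

  private
    moved-embed : ∀ c → embed (advance M c) ≡ moved (action (embed c)) (embed c)
    moved-embed (q , s) with δ q (Tape.here s)
    ... | nothing = refl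
    ... | just _  = refl

    -- The two tapes differ only in an explicit blank on the left, and possibly in none at all on
    -- the right, which the default of `nth` makes invisible to `square`.
    blank-before : ∀ as d → square (just zero , load as) d ≡ square (just zero , move right (tape [] blank as)) d
    blank-before []       (ℤ.+ zero)     = refl
    blank-before []       (ℤ.+ suc i)    = refl
    blank-before []       -[1+ zero ]    = refl
    blank-before []       -[1+ suc i ]   = refl
    blank-before (a ∷ as) (ℤ.+ zero)     = refl
    blank-before (a ∷ as) (ℤ.+ suc i)    = refl
    blank-before (a ∷ as) -[1+ zero ]    = refl
    blank-before (a ∷ as) -[1+ suc i ]   = refl

    conf-moved : ∀ t d → square (conf (suc t)) d ≡ square (moved (action (conf t)) (conf t)) d
    conf-moved zero    d = blank-before (List.map bit u) d
    conf-moved (suc t) d = cong (λ c → square c d)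
      (trans (cong embed (iter-suc t (advance M) (initial M u))) (moved-embed (run t)))

  row-rule : ∀ t p → row (suc t) (suc p) ≡ successor (row t p) (row t (suc p)) (row t (suc (suc p)))
  row-rule t p = begin
    row (suc t) (suc p)                                            ≡⟨ conf-moved t _ ⟩
    square (moved (action c) c) (shift (action c) (rel t (suc p))) ≡⟨ local-rule c (rel t (suc p)) ⟩
    successor (square c (ℤ.pred (rel t (suc p)))) (row t (suc p)) (square c (ℤ.suc (rel t (suc p))))
      ≡⟨ cong₂ (λ d d′ → successor (square c d) (row t (suc p)) (square c d′))
           (trans (cong ℤ.pred (rel-suc t p)) (ℤₚ.pred-suc (rel t p))) (sym (rel-suc t (suc p))) ⟩
    successor (row t p) (row t (suc p)) (row t (suc (suc p)))      ∎
    where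
    open ≡-Reasoning
    c = conf t

  -- The head moves by at most one column per row. Starting in column h, it cannot pass column 0 up
  -- to row h, so its position is a natural number.
  head : ∀ t → t ≤ h → ∃[ p ] rel t p ≡ ℤ.+ 0 × h ≤ p + t × p ≤ h + t
  head zero    _   = h , ℤₚ.n⊖n≡0 h , m≤m+n h 0 , m≤m+n h 0
  head (suc t) t<h with head t (ℕₚ.<⇒≤ t<h)
  ... | p , e , lo , hi with action (conf t)
  ... | nothing               = p , e , ≤-trans lo (+-monoʳ-≤ p (n≤1+n t)) , ≤-trans hi (+-monoʳ-≤ h (n≤1+n t))
  ... | just (_ , _ , stay)   = p , e , ≤-trans lo (+-monoʳ-≤ p (n≤1+n t)) , ≤-trans hi (+-monoʳ-≤ h (n≤1+n t))
  ... | just (_ , _ , right)  = suc p , trans (cong ℤ.pred (rel-suc t p)) (trans (ℤₚ.pred-suc (rel t p)) e) ,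
    ≤-trans lo (≤-trans (+-monoʳ-≤ p (n≤1+n t)) (n≤1+n _)) , ≤-trans (s≤s hi) (≤-reflexive (sym (+-suc h t)))
  head (suc t) t<h | zero , e , lo , hi | just (_ , _ , left) = contradiction (≤-trans t<h lo) (ℕₚ.<-irrefl refl)
  head (suc t) t<h | suc p , e , lo , hi | just (_ , _ , left) =
    p , trans (sym (rel-suc t p)) e , ≤-trans lo (≤-reflexive (sym (+-suc p t))) , ≤-trans (≤-trans (n≤1+n p) hi) (+-monoʳ-≤ h (n≤1+n t))

  private
    plain-accepting : ∀ a → rejecting (plain a) ≡ false
    plain-accepting blank       = refl
    plain-accepting (bit false) = refl
    plain-accepting (bit true)  = refl
    plain-accepting (work _)    = refl

    rejecting-halted : ∀ q s d → rejecting (square (just q , s) d) ≡ true → Defs.step M (q , s) ≡ nothing × Tape.here s ≡ bit false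
    rejecting-halted q (tape ls (bit false) rs) (ℤ.+ zero) e with δ q (bit false)
    ... | nothing = refl , refl
    rejecting-halted q (tape ls (bit true)  rs) (ℤ.+ zero) ()
    rejecting-halted q (tape ls blank       rs) (ℤ.+ zero) ()
    rejecting-halted q (tape ls (work _)    rs) (ℤ.+ zero) ()
    rejecting-halted q (tape ls a rs) (ℤ.+ suc i) e = contradiction (trans (sym (plain-accepting (nth blank rs i))) e) λ ()
    rejecting-halted q (tape ls a rs) -[1+ i ] e = contradiction (trans (sym (plain-accepting (nth blank ls i))) e) λ ()

    start-accepting : ∀ t d → rejecting (square (nothing , t) d) ≡ false
    start-accepting (tape ls blank rs)       (ℤ.+ zero) = refl
    start-accepting (tape ls (bit false) rs) (ℤ.+ zero) = refl
    start-accepting (tape ls (bit true) rs)  (ℤ.+ zero) = refl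
    start-accepting (tape ls (work _) rs)    (ℤ.+ zero) = refl
    start-accepting (tape ls a rs) (ℤ.+ suc i) = plain-accepting (nth blank rs i)
    start-accepting (tape ls a rs) -[1+ i ] = plain-accepting (nth blank ls i)

  -- A rejecting square shows a halted configuration. A run has only one of these, whichever of the
  -- two times comes first, and its head would read both `true` and `false`.
  accepted : ∀ {n q s} → HaltsFrom M (initial M u) n (q , s) → output s ≡ [ true ] → ∀ t p → rejecting (row t p) ≡ false
  accepted halts out zero    p = start-accepting _ (rel zero p)
  accepted {n} {q} {s} halts out (suc t) p with rejecting (row (suc t) p) in e
  ... | false = refl
  ... | true  = contradiction (trans (sym (output-head s out)) (trans (cong (Tape.here ∘ proj₂) same) (proj₂ halted))) λ ()
    where
    halted = rejecting-halted (proj₁ (run t)) (proj₂ (run t)) (rel (suc t) p) e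
    final = HaltsFrom-iter M halts
    same : (q , s) ≡ run t
    same with ℕₚ.≤-total n t
    ... | inj₁ n≤t = sym (iter-stable n≤t (proj₁ final) (advance-halted M (proj₂ final)))
    ... | inj₂ t≤n = trans (sym (proj₁ final)) (iter-stable t≤n refl (advance-halted M (proj₁ halted)))

  rejected : ∀ {n q s} → HaltsFrom M (initial M u) n (q , s) → output s ≡ [ false ] → ∀ {T} → n ≤ T →
             ∀ p → rel (suc T) p ≡ ℤ.+ 0 → rejecting (row (suc T) p) ≡ true
  rejected {q = q} {s} halts out {T} n≤T p e = trans
    (cong₂ (λ c d → rejecting (square (embed c) d)) (HaltsFrom-iter-≤ M halts n≤T) e)
    (halted-false s (output-head s out) (proj₂ (HaltsFrom-iter M halts)))
    where
    halted-false : ∀ s → Tape.here s ≡ bit false → Defs.step M (q , s) ≡ nothing → rejecting (square (just q , s) (ℤ.+ 0)) ≡ true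
    halted-false (tape ls .(bit false) rs) refl e with δ q (bit false)
    ... | nothing = refl

  private
    first-row′ : ∀ h j → square (nothing , tape [] blank (List.map bit u)) (j ℤ.⊖ h) ≡
                 nth blankSquare (replicate h blankSquare ++ startSquare ∷ List.map (plain ∘ bit) u) j
    first-row′ zero    zero    = refl
    first-row′ zero    (suc j) = trans (sym (nth-map plain (List.map bit u) j)) (cong (λ as → nth blankSquare as j) (sym (Listₚ.map-∘ u)))
    first-row′ (suc h) zero    = refl
    first-row′ (suc h) (suc j) = trans (cong (square _) (ℤₚ.[1+m]⊖[1+n]≡m⊖n j h)) (first-row′ h j)

  first-row : ∀ j → row 0 j ≡ nth blankSquare (replicate h blankSquare ++ startSquare ∷ List.map (plain ∘ bit) u) j
  first-row = first-row′ h

-- The clauses of the tableau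

pair-++ : ∀ w y → pair w y ≡ pair w [] ++ y
pair-++ []      y = refl
pair-++ (b ∷ w) y = cong (λ z → true ∷ b ∷ z) (pair-++ w y)

From : ∀ {A : Set} → (ℕ → A → Set) → ℕ → List A → Set
From P e []       = ⊤
From P e (x ∷ xs) = P e x × From P (suc e) xs

module _ {A : Set} {P : ℕ → A → Set} where

  From-intro : ∀ {a} e xs → (∀ i → i < length xs → P (i + e) (nth a xs i)) → From P e xs
  From-intro e []       h = tt
  From-intro {a} e (x ∷ xs) h = h 0 (s≤s z≤n) ,
    From-intro (suc e) xs (λ i i< → subst (λ n → P n (nth a xs i)) (sym (+-suc i e)) (h (suc i) (s≤s i<)))

  From-elim : ∀ {a} e xs → From P e xs → ∀ i → i < length xs → P (i + e) (nth a xs i)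
  From-elim e (x ∷ xs) (p , ps) zero    _        = p
  From-elim {a} e (x ∷ xs) (p , ps) (suc i) (s≤s i<) = subst (λ n → P n (nth a xs i)) (+-suc i e) (From-elim (suc e) xs ps i i<)

  From-split : ∀ e xs ys → From P e (xs ++ ys) → From P e xs × From P (length xs + e) ys
  From-split e []       ys ps       = tt , ps
  From-split e (x ∷ xs) ys (p , ps) =
    let (q , r) = From-split (suc e) xs ys ps in (p , q) , subst (λ n → From P n ys) (+-suc (length xs) e) r

  From-join : ∀ e xs ys → From P e xs → From P (length xs + e) ys → From P e (xs ++ ys)
  From-join e []       ys ps       qs = qs
  From-join e (x ∷ xs) ys (p , ps) qs = p , From-join (suc e) xs ys ps (subst (λ n → From P n ys) (sym (+-suc (length xs) e)) qs)

module Clauses (M : TM) where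

  open Tableau M
  open Finite finite-Square

  bitSquare : Bool → Square
  bitSquare = plain ∘ bit

  -- Whether a clause contains the positive (true) or negative (false)
  -- literal that a given square stands in a given slot.  A successor that
  -- rejects is left out of the clause that would derive it; the clauses of
  -- a free label are tautologies.
  literal : Label Square → Kind Square → Bool → Slot → Square → Bool
  literal ι         (local x y z) false above-left  σ = σ == x
  literal ι         (local x y z) false above       σ = σ == y
  literal ι         (local x y z) false above-right σ = σ == z
  literal ι         (local x y z) true  below       σ = (σ == successor x y z) ∧ not (rejecting (successor x y z))
  literal free      initial₁      _     above       σ = true
  literal (fixed τ) initial₁      true  above       σ = σ == τ
  literal guess     initial₁      true  above       σ = (σ == bitSquare true) ∨ ((σ == bitSquare false) ∨ (σ == blankSquare))
  literal guess     initial₂      false above       σ = σ == blankSquare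
  literal guess     initial₂      true  above-right σ = σ == blankSquare
  literal free      initial₂      _     above       σ = true
  literal (fixed τ) initial₂      _     above       σ = true
  literal _         _             _     _           _ = false

  Satisfied : (Tr Fa : ℕ → Square → Set) → ℕ → ℕ → Label Square → Kind Square → Set
  Satisfied Tr Fa ℓ j ι κ = Holds (literal ι κ) Tr Fa ℓ j

  private
    T-∧ : ∀ a {b} → T (a ∧ b) → T a × T b
    T-∧ true t = tt , t

    T-∨ : ∀ a {b} → T (a ∨ b) → T a ⊎ T b
    T-∨ true  t = inj₁ tt
    T-∨ false t = inj₂ t

    ∨-T₁ : ∀ {a b} → T a → T (a ∨ b)
    ∨-T₁ {true} t = tt

    ∨-T₂ : ∀ a {b} → T b → T (a ∨ b)
    ∨-T₂ true  t = tt
    ∨-T₂ false t = t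

    ==-T : ∀ σ → T (σ == σ)
    ==-T σ = subst T (sym (==-refl σ)) tt

  module _ (H Y : ℕ) (w : Word) where

    prefix : List Square
    prefix = replicate H blankSquare ++ startSquare ∷ List.map bitSquare (pair w [])

    -- The H blanks on either side are the margin that keeps the uncontrolled ends of the rows away
    -- from the head until the verifier has halted.
    labels : List (Label Square)
    labels = List.map fixed prefix ++ replicate Y guess ++ List.map fixed (replicate H blankSquare)

    squares : Word → List Square
    squares y = prefix ++ (List.map bitSquare y ++ replicate (Y ∸ length y) blankSquare) ++ replicate H blankSquare

    ℓ W : ℕ
    ℓ = length labels
    -- Column 0 separates the rows and columns 1 to ℓ carry the labels. One more column keeps square
    -- j + 2 in its row for every label j, as `initial₂` refers to it.
    W = suc (suc ℓ)

    length-squares : ∀ y → length y ≤ Y → length (squares y) ≡ ℓ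
    length-squares y le = begin
      length (squares y) ≡⟨ trans (Listₚ.length-++ prefix) (cong (length prefix +_) (trans (Listₚ.length-++ (List.map bitSquare y ++ replicate (Y ∸ length y) blankSquare))
        (cong (_+ length (replicate H blankSquare)) (Listₚ.length-++ (List.map bitSquare y))))) ⟩
      length prefix + (length (List.map bitSquare y) + length (replicate (Y ∸ length y) blankSquare) + length (replicate H blankSquare))
        ≡⟨ cong (λ n → length prefix + (n + length (replicate H blankSquare)))
             (trans (cong₂ _+_ (Listₚ.length-map bitSquare y) (Listₚ.length-replicate (Y ∸ length y))) (ℕₚ.m+[n∸m]≡n le)) ⟩
      length prefix + (Y + length (replicate H blankSquare))
        ≡⟨ cong₂ _+_ (Listₚ.length-map fixed prefix) (trans (Listₚ.length-++ (replicate Y guess)) (cong₂ _+_ (Listₚ.length-replicate Y) (Listₚ.length-map fixed (replicate H blankSquare)))) ⟨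
      length (List.map fixed prefix) + length (replicate Y guess ++ List.map fixed (replicate H blankSquare)) ≡⟨ Listₚ.length-++ (List.map fixed prefix) ⟨
      ℓ ∎
      where open ≡-Reasoning

    2H≤ℓ : H + H ≤ ℓ
    2H≤ℓ = begin
      H + H ≤⟨ +-mono-≤ (≤-trans (m≤m+n H _) (≤-reflexive (sym (trans (Listₚ.length-map fixed prefix) (trans (Listₚ.length-++ (replicate H blankSquare)) (cong (_+ _) (Listₚ.length-replicate H)))))))
                        (≤-trans (m≤n+m H _) (≤-reflexive (sym (trans (Listₚ.length-++ (replicate Y guess)) (cong (length (replicate {A = Label Square} Y guess) +_) (trans (Listₚ.length-map fixed (replicate H blankSquare)) (Listₚ.length-replicate H))))))) ⟩
      length (List.map fixed prefix) + length (replicate Y guess ++ List.map fixed (replicate H blankSquare)) ≡⟨ Listₚ.length-++ (List.map fixed prefix) ⟨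
      ℓ ∎
      where open ≤-Reasoning

    module _ (y : Word) where
      open Rows M (pair w y) (suc H) using (row; first-row)

      first-row-squares : ∀ j → nth blankSquare (squares y) j ≡ row 0 (suc j)
      first-row-squares j = begin
        nth blankSquare (squares y) j ≡⟨ cong (λ as → nth blankSquare as j) regroup ⟩
        nth blankSquare ((replicate H blankSquare ++ startSquare ∷ List.map bitSquare (pair w y)) ++ replicate ((Y ∸ length y) + H) blankSquare) j
          ≡⟨ nth-++-blanks (replicate H blankSquare ++ startSquare ∷ List.map bitSquare (pair w y)) _ j ⟩
        nth blankSquare (replicate H blankSquare ++ startSquare ∷ List.map bitSquare (pair w y)) j ≡⟨ first-row (suc j) ⟨
        row 0 (suc j) ∎
        where
        open ≡-Reasoning
        n = Y ∸ length y
        regroup : squares y ≡ (replicate H blankSquare ++ startSquare ∷ List.map bitSquare (pair w y)) ++ replicate (n + H) blankSquare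
        regroup = begin
          prefix ++ (List.map bitSquare y ++ replicate n blankSquare) ++ replicate H blankSquare
            ≡⟨ cong (prefix ++_) (Listₚ.++-assoc (List.map bitSquare y) _ _) ⟩
          prefix ++ List.map bitSquare y ++ replicate n blankSquare ++ replicate H blankSquare
            ≡⟨ Listₚ.++-assoc prefix (List.map bitSquare y) _ ⟨
          (prefix ++ List.map bitSquare y) ++ replicate n blankSquare ++ replicate H blankSquare
            ≡⟨ cong₂ _++_ (trans (Listₚ.++-assoc (replicate H blankSquare) _ _) (cong (λ as → replicate H blankSquare ++ startSquare ∷ as)
                 (trans (sym (Listₚ.map-++ bitSquare (pair w []) y)) (cong (List.map bitSquare) (sym (pair-++ w y))))))
               (sym (replicate-+ n H)) ⟩
          (replicate H blankSquare ++ startSquare ∷ List.map bitSquare (pair w y)) ++ replicate (n + H) blankSquare ∎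

    -- The assignment comes from an arbitrary quasi-kernel. It may leave a literal undecided or give
    -- several letters to one square; all that is known is consistency. So the argument only follows
    -- what the clauses force, starting from the first row.
    module Soundness
      (V : Language) (T₀ J : ℕ)
      (halts : ∀ y → length y ≤ Y → ∃[ t ] ∃[ o ] t ≤ T₀ × Computes M (pair w y) t o × Decision V (pair w y) o)
      (margin : 2 * T₀ + 3 ≤ H) (rows : suc T₀ * W ≤ J)
      (Tr Fa : ℕ → Square → Set) (consistent : ∀ {e σ} → Tr e σ → Fa e σ → ⊥)
      (satisfied : ∀ j κ → j < J → Satisfied Tr Fa ℓ j (nth free labels j) κ)
      where

      Init : ℕ → Label Square → Set
      Init e free      = ⊤
      Init e (fixed σ) = Tr e σ
      Init e guess     = (Tr e (bitSquare true) ⊎ Tr e (bitSquare false) ⊎ Tr e blankSquare) × (Fa e blankSquare ⊎ Tr (suc e) blankSquare)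

      private
        read : ∀ {e σ τ} → T (σ == τ) → Tr e σ → Tr e τ
        read t r = subst (Tr _) (==⇒≡ t) r

        init₁ : ∀ {j σ} → Satisfied Tr Fa ℓ j (fixed σ) initial₁ → Tr (suc j) σ
        init₁ (above , σ , inj₂ (t , r)) = read t r

        init-guess₁ : ∀ {j} → Satisfied Tr Fa ℓ j guess initial₁ →
                      Tr (suc j) (bitSquare true) ⊎ Tr (suc j) (bitSquare false) ⊎ Tr (suc j) blankSquare
        init-guess₁ (above , σ , inj₂ (t , r)) with T-∨ (σ == bitSquare true) t
        ... | inj₁ t₁ = inj₁ (read t₁ r)
        ... | inj₂ t₂ with T-∨ (σ == bitSquare false) t₂
        ... | inj₁ t₃ = inj₂ (inj₁ (read t₃ r))
        ... | inj₂ t₄ = inj₂ (inj₂ (read t₄ r))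

        init-guess₂ : ∀ {j} → Satisfied Tr Fa ℓ j guess initial₂ → Fa (suc j) blankSquare ⊎ Tr (suc (suc j)) blankSquare
        init-guess₂ (above       , σ , inj₁ (t , r)) = inj₁ (subst (Fa _) (==⇒≡ t) r)
        init-guess₂ (above-right , σ , inj₂ (t , r)) = inj₂ (read t r)

        init : ∀ {j} ι → (∀ κ → Satisfied Tr Fa ℓ j ι κ) → Init (suc j) ι
        init free      s = tt
        init (fixed σ) s = init₁ (s initial₁)
        init guess     s = init-guess₁ (s initial₁) , init-guess₂ (s initial₂)

        -- Consistency refutes the three negative literals, so the clause acts as an implication
        -- with the positive one as its conclusion. A rejecting successor has been left out of its
        -- clause; hence whatever is derived does not reject.
        derive : ∀ {j x y z} ι → Satisfied Tr Fa ℓ j ι (local x y z) → Tr j x → Tr (1 + j) y → Tr (2 + j) z →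
               Tr (3 + ℓ + j) (successor x y z) × T (not (rejecting (successor x y z)))
        derive ι (above-left  , σ , inj₁ (t , r)) a b c = ⊥-elim (consistent a (subst (Fa _) (==⇒≡ t) r))
        derive ι (above       , σ , inj₁ (t , r)) a b c = ⊥-elim (consistent b (subst (Fa _) (==⇒≡ t) r))
        derive ι (above-right , σ , inj₁ (t , r)) a b c = ⊥-elim (consistent c (subst (Fa _) (==⇒≡ t) r))
        derive ι (below       , σ , inj₂ (t , r)) a b c = let (t₁ , t₂) = T-∧ (σ == _) t in read t₁ r , t₂

        fixed-segment : ∀ e σs → From Init e (List.map fixed σs) → From Tr e σs
        fixed-segment e []       _        = tt
        fixed-segment e (σ ∷ σs) (p , ps) = p , fixed-segment (suc e) σs ps

        blanks : ∀ n e → Tr e blankSquare → From Init e (replicate n guess) → From Tr e (replicate n blankSquare)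
        blanks zero    e r _                   = tt
        blanks (suc n) e r ((_ , inj₁ f) , ps) = ⊥-elim (consistent r f)
        blanks (suc n) e r ((_ , inj₂ s) , ps) = r , blanks n (suc e) s ps

        -- The certificate ends at the first square read as blank. From there `initial₂` forces
        -- blanks up to the end of the guessed part. If a square has several letters, the one by
        -- which its clause is satisfied is read.
        guesses : ∀ n e → From Init e (replicate n guess) →
                  ∃[ y ] length y ≤ n × From Tr e (List.map bitSquare y ++ replicate (n ∸ length y) blankSquare)
        guesses zero    e _ = [] , z≤n , tt
        guesses (suc n) e ((inj₁ r , _) , ps) =
          let (y , le , q) = guesses n (suc e) ps in true ∷ y , s≤s le , r , q
        guesses (suc n) e ((inj₂ (inj₁ r) , _) , ps) =
          let (y , le , q) = guesses n (suc e) ps in false ∷ y , s≤s le , r , q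
        guesses (suc n) e ((inj₂ (inj₂ r) , c) , ps) = [] , z≤n , blanks (suc n) e r ((inj₂ (inj₂ r) , c) , ps)

      ℓ≤J : ℓ ≤ J
      ℓ≤J = ≤-trans (≤-trans (n≤1+n ℓ) (n≤1+n (suc ℓ))) (≤-trans (m≤m+n W _) rows)

      found : ∃[ y ] length y ≤ Y × From Tr 1 (squares y)
      found =
        let all = From-intro {P = Init} {a = free} 1 labels λ i i< →
                    subst (λ n → Init n (nth free labels i)) (+-comm 1 i) (init (nth free labels i) (λ κ → satisfied i κ (≤-trans i< ℓ≤J)))
            (p , q) = From-split 1 (List.map fixed prefix) _ all
            (r , s) = From-split _ (replicate Y guess) _ q
            (y , le , ys) = guesses Y _ r
        in y , le , From-join 1 prefix _ (fixed-segment 1 prefix p)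
          (subst (λ n → From Tr n ((List.map bitSquare y ++ replicate (Y ∸ length y) blankSquare) ++ replicate H blankSquare)) (cong (_+ 1) (Listₚ.length-map fixed prefix))
            (From-join _ (List.map bitSquare y ++ replicate (Y ∸ length y) blankSquare) _ ys
              (subst (λ n → From Tr (n + _) _) (trans (Listₚ.length-replicate Y) (sym (trans (Listₚ.length-++ (List.map bitSquare y))
                  (trans (cong₂ _+_ (Listₚ.length-map bitSquare y) (Listₚ.length-replicate (Y ∸ length y))) (ℕₚ.m+[n∸m]≡n le)))))
                (fixed-segment _ (replicate H blankSquare) s))))

      module _ (y : Word) (y≤ : length y ≤ Y) (first : From Tr 1 (squares y)) where
        open Rows M (pair w y) (suc H)

        row-zero : ∀ p → 1 ≤ p → p ≤ ℓ → Tr p (row 0 p)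
        row-zero (suc j) _ j< = subst₂ Tr (+-comm j 1) (first-row-squares y j)
          (From-elim {a = blankSquare} 1 (squares y) first j (≤-trans j< (≤-reflexive (sym (length-squares y y≤)))))

        -- Nothing controls the squares beyond the ends of a row, so each row loses one known column
        -- at either end: in row t the known columns are t + 1 to ℓ - t.
        cone : ∀ t p → suc t ≤ p → p + t ≤ ℓ → t ≤ suc T₀ → Tr (t * W + p) (row t p)
        cone′ : ∀ t p → suc t ≤ p → suc p + suc t ≤ ℓ → suc t ≤ suc T₀ →
                Tr (3 + ℓ + (t * W + p)) (row (suc t) (suc p)) × T (not (rejecting (row (suc t) (suc p))))

        cone zero    p       lo hi b = row-zero p lo (≤-trans (m≤m+n p 0) hi)
        cone (suc t) (suc p) (s≤s lo) hi b = subst (λ e → Tr e (row (suc t) (suc p))) (position ℓ t p) (proj₁ (cone′ t p lo hi b))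
          where
          position : ∀ ℓ t p → 3 + ℓ + (t * (2 + ℓ) + p) ≡ (2 + ℓ) + t * (2 + ℓ) + suc p
          position = solve-∀

        cone′ t p lo hi b = subst (λ σ → Tr _ σ × T (not (rejecting σ))) (sym (row-rule t p))
          (derive (nth free labels j) (satisfied j (local (row t p) (row t (suc p)) (row t (suc (suc p)))) j<J)
            (cone t p lo (≤-trans (≤-trans (≤-trans (+-monoʳ-≤ p (n≤1+n t)) (n≤1+n _)) hi) ≤-refl) t≤)
            (subst (λ e → Tr e (row t (suc p))) (+-suc (t * W) p) (cone t (suc p) (≤-trans lo (n≤1+n p)) (≤-trans (+-monoʳ-≤ (suc p) (n≤1+n t)) hi) t≤))
            (subst (λ e → Tr e (row t (suc (suc p)))) (trans (+-suc (t * W) (suc p)) (cong suc (+-suc (t * W) p)))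
              (cone t (suc (suc p)) (≤-trans lo (≤-trans (n≤1+n p) (n≤1+n _))) (≤-trans (≤-reflexive (sym (+-suc (suc p) t))) hi) t≤)))
          where
          j = t * W + p
          t≤ = ≤-trans (n≤1+n t) b
          p<W : p < W
          p<W = ≤-trans (≤-trans (m≤m+n (suc p) (suc t)) hi) (≤-trans (n≤1+n ℓ) (n≤1+n _))
          j<J : j < J
          j<J = begin-strict
            t * W + p  <⟨ ℕₚ.+-monoʳ-< (t * W) p<W ⟩
            t * W + W  ≡⟨ +-comm (t * W) W ⟩
            suc t * W  ≤⟨ *-monoˡ-≤ W b ⟩
            suc T₀ * W ≤⟨ rows ⟩
            J          ∎
            where open ≤-Reasoning

        T₀<H : T₀ < H
        T₀<H = ≤-trans (≤-trans (m≤m+n (suc T₀) (T₀ + 2)) (≤-reflexive (sum T₀))) margin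
          where
          sum : ∀ t → suc t + (t + 2) ≡ 2 * t + 3
          sum = solve-∀

        accepts : V (pair w y)
        accepts with halts y y≤
        ... | t , o , t≤ , comp , inj₁ (v , _) = v
        -- Row T₀ + 1 shows the verifier after T₀ steps, hence halted. Its head has moved by at most
        -- T₀ + 1 columns, and `margin` keeps it inside the cone on both sides. A rejecting square
        -- there would contradict `derive`.
        ... | t , o , t≤ , (q , s , h , out) , inj₂ (_ , refl) with head (suc T₀) (s≤s (ℕₚ.<⇒≤ T₀<H))
        ... | zero , e , lo , hi = contradiction (ℕₚ.≤-pred lo) (ℕₚ.<⇒≱ T₀<H)
        ... | suc p , e , lo , hi = contradiction (subst (T ∘ not) (rejected h out t≤ (suc p) e) (proj₂ (cone′ T₀ p lower upper ≤-refl))) λ ()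
          where
          lower : suc T₀ ≤ p
          lower = ℕₚ.+-cancelʳ-≤ (suc (suc T₀)) (suc T₀) p (begin
            suc T₀ + suc (suc T₀) ≡⟨ three T₀ ⟩
            2 * T₀ + 3            ≤⟨ margin ⟩
            H                     ≤⟨ n≤1+n H ⟩
            suc H                 ≤⟨ lo ⟩
            suc p + suc T₀        ≡⟨ sym (+-suc p (suc T₀)) ⟩
            p + suc (suc T₀)      ∎)
            where
            open ≤-Reasoning
            three : ∀ t → suc t + suc (suc t) ≡ 2 * t + 3
            three = solve-∀
          upper : suc p + suc T₀ ≤ ℓ
          upper = begin
            suc p + suc T₀              ≤⟨ +-monoˡ-≤ (suc T₀) hi ⟩
            suc H + suc T₀ + suc T₀     ≡⟨ three H T₀ ⟩
            H + (2 * T₀ + 3)            ≤⟨ +-monoʳ-≤ H margin ⟩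
            H + H                       ≤⟨ 2H≤ℓ ⟩
            ℓ                           ∎
            where
            open ≤-Reasoning
            three : ∀ h t → suc h + suc t + suc t ≡ h + (2 * t + 3)
            three = solve-∀

      sound : ∃[ y ] length y ≤ Y × V (pair w y)
      sound = let (y , le , first) = found in y , le , accepts y le first

    module Completeness (y : Word) (y≤ : length y ≤ Y) where

      open Rows M (pair w y) (suc H)

      module _ (accepting : ∀ t p → rejecting (row t p) ≡ false) where

        -- Column 0 separates the rows: the clauses that reach across it hold
        -- because nothing stands there.
        entry : ℕ → ℕ → Maybe Square
        entry t zero    = nothing
        entry t (suc p) = just (row t (suc p))

        value : ℕ → Maybe Square
        value e = entry (e / W) (e % W)

        holds : ℕ → Square → Bool
        holds e σ = maybe (_== σ) false (value e)

        Tr Fa : ℕ → Square → Set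
        Tr e σ = T (holds e σ)
        Fa e σ = T (not (holds e σ))

        value-row : ∀ t p → p < W → value (t * W + p) ≡ entry t p
        value-row t p p<W = cong₂ entry
          (trans (+-distrib-/-∣ʳ′) (trans (cong₂ _+_ (m*n/n≡m t W) (m<n⇒m/n≡0 p<W)) (+-identityʳ t)))
          (trans (cong (_% W) (+-comm (t * W) p)) (trans ([m+kn]%n≡m%n p t W) (m<n⇒m%n≡m p<W)))
          where
          +-distrib-/-∣ʳ′ : (t * W + p) / W ≡ t * W / W + p / W
          +-distrib-/-∣ʳ′ = trans (cong (_/ W) (+-comm (t * W) p))
            (trans (+-distrib-/-∣ʳ p (divides t refl)) (+-comm (p / W) (t * W / W)))

        private
          dec-holds : ∀ e σ → Tr e σ ⊎ Fa e σ
          dec-holds e σ with holds e σ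
          ... | true  = inj₁ tt
          ... | false = inj₂ tt

          Tr-just : ∀ e {σ τ} → value e ≡ just σ → σ ≡ τ → Tr e τ
          Tr-just e {σ} p refl = subst (λ v → T (maybe (_== σ) false v)) (sym p) (==-T σ)

          Fa-nothing : ∀ e σ → value e ≡ nothing → Fa e σ
          Fa-nothing e σ p = subst (λ v → T (not (maybe (_== σ) false v))) (sym p) tt

          Fa-just : ∀ e {σ τ} → value e ≡ just σ → σ ≢ τ → Fa e τ
          Fa-just e {σ} {τ} p ne = subst (λ v → T (not (maybe (_== τ) false v))) (sym p) (differ (σ == τ) ==⇒≡)
            where
            differ : ∀ b → (T b → σ ≡ τ) → T (not b)
            differ true  h = ne (h tt)
            differ false h = tt

          tautology : ∀ {ι κ j} → T (literal ι κ true above blankSquare) → T (literal ι κ false above blankSquare) → Satisfied Tr Fa ℓ j ι κ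
          tautology {j = j} t f with dec-holds (1 + j) blankSquare
          ... | inj₁ h = above , blankSquare , inj₂ (t , h)
          ... | inj₂ h = above , blankSquare , inj₁ (f , h)

          local-satisfied : ∀ ι t p x y z → p < W → Satisfied Tr Fa ℓ (t * W + p) ι (local x y z)
          local-satisfied ι t zero x y z _ = above-left , x , inj₁ (==-T x , Fa-nothing (t * W + 0) x (value-row t 0 (s≤s z≤n)))
          local-satisfied ι t (suc p) x y z p<W with suc (suc p) ℕₚ.≟ W
          ... | yes e = above , y , inj₁ (==-T y , Fa-nothing (1 + (t * W + suc p)) y (trans (cong value (wrap t (suc p) e)) (value-row (suc t) 0 (s≤s z≤n))))
            where
            wrap : ∀ t p → suc p ≡ W → 1 + (t * W + p) ≡ suc t * W + 0
            wrap t p e = trans (sym (+-suc (t * W) p)) (trans (cong (t * W +_) e) (trans (+-comm (t * W) W) (sym (+-identityʳ _))))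
          ... | no ne₁ with suc (suc (suc p)) ℕₚ.≟ W
          ... | yes e = above-right , z , inj₁ (==-T z , Fa-nothing (2 + (t * W + suc p)) z (trans (cong value (wrap t (suc p) e)) (value-row (suc t) 0 (s≤s z≤n))))
            where
            wrap : ∀ t p → suc (suc p) ≡ W → 2 + (t * W + p) ≡ suc t * W + 0
            wrap t p e = trans (sym (trans (+-suc (t * W) (suc p)) (cong suc (+-suc (t * W) p)))) (trans (cong (t * W +_) e) (trans (+-comm (t * W) W) (sym (+-identityʳ _))))
          ... | no ne₂ = inner
            where
            q = suc p
            q+1< = ℕₚ.≤∧≢⇒< p<W ne₁
            q+2< = ℕₚ.≤∧≢⇒< q+1< ne₂
            v₀ : value (t * W + q) ≡ just (row t q)
            v₀ = value-row t q p<W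
            v₁ : value (1 + (t * W + q)) ≡ just (row t (suc q))
            v₁ = trans (cong value (sym (+-suc (t * W) q))) (value-row t (suc q) q+1<)
            v₂ : value (2 + (t * W + q)) ≡ just (row t (suc (suc q)))
            v₂ = trans (cong value (sym (trans (+-suc (t * W) (suc q)) (cong suc (+-suc (t * W) q))))) (value-row t (suc (suc q)) q+2<)
            v₃ : value (3 + ℓ + (t * W + q)) ≡ just (row (suc t) (suc q))
            v₃ = trans (cong value (position ℓ t q)) (value-row (suc t) (suc q) q+1<)
              where
              position : ∀ ℓ t p → 3 + ℓ + (t * (2 + ℓ) + p) ≡ (2 + ℓ) + t * (2 + ℓ) + suc p
              position = solve-∀
            inner : Satisfied Tr Fa ℓ (t * W + q) ι (local x y z)
            inner with row t q ≟ x
            ... | no ne = above-left , x , inj₁ (==-T x , Fa-just (t * W + q) v₀ ne)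
            ... | yes refl with row t (suc q) ≟ y
            ... | no ne = above , y , inj₁ (==-T y , Fa-just (1 + (t * W + q)) v₁ ne)
            ... | yes refl with row t (suc (suc q)) ≟ z
            ... | no ne = above-right , z , inj₁ (==-T z , Fa-just (2 + (t * W + q)) v₂ ne)
            ... | yes refl = below , row (suc t) (suc q) , inj₂ (both , Tr-just (3 + ℓ + (t * W + q)) v₃ refl)
              where
              both : T ((row (suc t) (suc q) == successor (row t q) (row t (suc q)) (row t (suc (suc q)))) ∧
                        not (rejecting (successor (row t q) (row t (suc q)) (row t (suc (suc q))))))
              both = subst (λ σ → T ((row (suc t) (suc q) == σ) ∧ not (rejecting σ))) (row-rule t q)
                (subst₂ (λ a b → T (a ∧ not b)) (sym (==-refl (row (suc t) (suc q)))) (sym (accepting (suc t) (suc q))) tt)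

          Fits : Label Square → Square → Set
          Fits free      σ = ⊤
          Fits (fixed τ) σ = σ ≡ τ
          Fits guess     σ = σ ≡ bitSquare true ⊎ σ ≡ bitSquare false ⊎ σ ≡ blankSquare

          fits-fixed : ∀ τs {ιs σs} → (∀ i → Fits (nth free ιs i) (nth blankSquare σs i)) →
                       ∀ i → Fits (nth free (List.map fixed τs ++ ιs) i) (nth blankSquare (τs ++ σs) i)
          fits-fixed []       h i       = h i
          fits-fixed (τ ∷ τs) h zero    = refl
          fits-fixed (τ ∷ τs) h (suc i) = fits-fixed τs h i

          fits-guess : ∀ n y {ιs σs} → length y ≤ n → (∀ i → Fits (nth free ιs i) (nth blankSquare σs i)) →
                       ∀ i → Fits (nth free (replicate n guess ++ ιs) i) (nth blankSquare ((List.map bitSquare y ++ replicate (n ∸ length y) blankSquare) ++ σs) i)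
          fits-guess zero    []          le       h i       = h i
          fits-guess (suc n) []          le       h zero    = inj₂ (inj₂ refl)
          fits-guess (suc n) []          le       h (suc i) = fits-guess n [] z≤n h i
          fits-guess (suc n) (true ∷ y)  le       h zero    = inj₁ refl
          fits-guess (suc n) (false ∷ y) le       h zero    = inj₂ (inj₁ refl)
          fits-guess (suc n) (b ∷ y)     (s≤s le) h (suc i) = fits-guess n y le h i

          fits : ∀ j → Fits (nth free labels j) (row 0 (suc j))
          fits j = subst (Fits (nth free labels j)) (first-row-squares y j)
            (fits-fixed prefix (fits-guess Y y y≤ tail) j)
            where
            tail : ∀ i → Fits (nth free (List.map fixed (replicate H blankSquare)) i) (nth blankSquare (replicate H blankSquare) i)
            tail i = subst₂ (λ ιs σs → Fits (nth free ιs i) (nth blankSquare σs i)) (Listₚ.++-identityʳ (List.map fixed (replicate H blankSquare))) (Listₚ.++-identityʳ (replicate H blankSquare))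
              (fits-fixed (replicate H blankSquare) {[]} {[]} (λ _ → tt) i)

          guess-late : ∀ (τs : List Square) ιs j → nth free (List.map fixed τs ++ ιs) j ≡ guess → length τs ≤ j
          guess-late []       ιs j       e = z≤n
          guess-late (τ ∷ τs) ιs (suc j) e = s≤s (guess-late τs ιs j e)

          guess-inside : ∀ (ιs : List (Label Square)) j → nth free ιs j ≡ guess → j < length ιs
          guess-inside (ι ∷ ιs) zero    e = s≤s z≤n
          guess-inside (ι ∷ ιs) (suc j) e = s≤s (guess-inside ιs j e)

          blank-onwards : ∀ bs i → nth blankSquare (List.map bitSquare bs) i ≡ blankSquare → nth blankSquare (List.map bitSquare bs) (suc i) ≡ blankSquare
          blank-onwards []       i       e = refl
          blank-onwards (b ∷ bs) (suc i) e = blank-onwards bs i e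

          -- To the right of the start square the first row is a word of bits followed by blanks
          -- only.
          blank-next : ∀ j → H < j → row 0 (suc j) ≡ blankSquare → row 0 (suc (suc j)) ≡ blankSquare
          blank-next j H<j e = trans (at-input (suc i) (trans (cong suc j≡) (sym (+-suc H (suc i))))) (blank-onwards (pair w y) i (trans (sym (at-input i j≡)) e))
            where
            i = j ∸ suc H
            j≡ : j ≡ H + suc i
            j≡ = trans (sym (ℕₚ.m+[n∸m]≡n H<j)) (sym (+-suc H i))
            at-input : ∀ i {j} → j ≡ H + suc i → row 0 (suc j) ≡ nth blankSquare (List.map bitSquare (pair w y)) i
            at-input i refl = trans (first-row (suc (H + suc i))) (nth-replicate-++ H (startSquare ∷ List.map bitSquare (pair w y)) (suc i))

          initial₁-satisfied : ∀ j ι → (∀ {τ} → ι ≡ fixed τ → suc j < W) → (ι ≡ guess → suc j < W) → Fits ι (row 0 (suc j)) → Satisfied Tr Fa ℓ j ι initial₁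
          initial₁-satisfied j free      b c f = tautology {free} {initial₁} {j} tt tt
          initial₁-satisfied j (fixed τ) b c f = above , τ , inj₂ (==-T τ , Tr-just (suc j) (value-row 0 (suc j) (b refl)) f)
          initial₁-satisfied j guess     b c (inj₁ f) = above , bitSquare true , inj₂ (∨-T₁ (==-T (bitSquare true)) , Tr-just (suc j) (value-row 0 (suc j) (c refl)) f)
          initial₁-satisfied j guess     b c (inj₂ (inj₁ f)) = above , bitSquare false , inj₂ (∨-T₂ (bitSquare false == bitSquare true) (∨-T₁ (==-T (bitSquare false))) , Tr-just (suc j) (value-row 0 (suc j) (c refl)) f)
          initial₁-satisfied j guess     b c (inj₂ (inj₂ f)) = above , blankSquare , inj₂ (∨-T₂ (blankSquare == bitSquare true) (∨-T₂ (blankSquare == bitSquare false) (==-T blankSquare)) , Tr-just (suc j) (value-row 0 (suc j) (c refl)) f)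

          initial₂-satisfied : ∀ j ι → nth free labels j ≡ ι → Satisfied Tr Fa ℓ j ι initial₂
          initial₂-satisfied j free      e = tautology {free} {initial₂} {j} tt tt
          initial₂-satisfied j (fixed τ) e = tautology {fixed τ} {initial₂} {j} tt tt
          initial₂-satisfied j guess     e with row 0 (suc j) ≟ blankSquare
          ... | no ne = above , blankSquare , inj₁ (==-T blankSquare , Fa-just (suc j) (value-row 0 (suc j) (s≤s (≤-trans (guess-inside labels j e) (n≤1+n ℓ)))) ne)
          ... | yes b = above-right , blankSquare , inj₂ (==-T blankSquare , Tr-just (suc (suc j)) (value-row 0 (suc (suc j)) (s≤s (s≤s (guess-inside labels j e))))
            (blank-next j (≤-trans H<prefix (guess-late prefix (replicate Y guess ++ List.map fixed (replicate H blankSquare)) j e)) b))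
            where
            H<prefix : H < length prefix
            H<prefix = ≤-trans (≤-trans (s≤s (m≤m+n H _)) (≤-reflexive (sym (+-suc H _))))
              (≤-reflexive (sym (trans (Listₚ.length-++ (replicate H blankSquare)) (cong (_+ _) (Listₚ.length-replicate H)))))

        complete : ∀ j κ → Satisfied Tr Fa ℓ j (nth free labels j) κ
        complete j (local x y z) = subst (λ j′ → Satisfied Tr Fa ℓ j′ (nth free labels j) (local x y z))
          (trans (+-comm (j / W * W) (j % W)) (sym (m≡m%n+[m/n]*n j W)))
          (local-satisfied (nth free labels j) (j / W) (j % W) x y z (m%n<n j W))
        complete j initial₁ = initial₁-satisfied j (nth free labels j)
          (λ e → s≤s (≤-trans (fixed-inside labels j e) (n≤1+n ℓ))) (λ e → s≤s (≤-trans (guess-inside labels j e) (n≤1+n ℓ))) (fits j)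
          where
          fixed-inside : ∀ (ιs : List (Label Square)) j {τ} → nth free ιs j ≡ fixed τ → j < length ιs
          fixed-inside (ι ∷ ιs) zero    e = s≤s z≤n
          fixed-inside (ι ∷ ιs) (suc j) e = s≤s (fixed-inside ιs j e)
        complete j initial₂ = initial₂-satisfied j (nth free labels j) refl

-- Counting in subsets

trues : List Bool → ℕ
trues []          = 0
trues (true ∷ bs) = suc (trues bs)
trues (false ∷ bs) = trues bs

trues-++ : ∀ as bs → trues (as ++ bs) ≡ trues as + trues bs
trues-++ []           bs = refl
trues-++ (true ∷ as)  bs = cong suc (trues-++ as bs)
trues-++ (false ∷ as) bs = trues-++ as bs

∣∣-trues : ∀ {n} (Q : Subset n) → ∣ Q ∣ ≡ trues (Vec.toList Q)
∣∣-trues []          = refl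
∣∣-trues (true ∷ Q)  = cong suc (∣∣-trues Q)
∣∣-trues (false ∷ Q) = ∣∣-trues Q

members : ∀ {n} → Subset n → List (Fin n)
members []          = []
members (true ∷ Q)  = zero ∷ List.map suc (members Q)
members (false ∷ Q) = List.map suc (members Q)

length-members : ∀ {n} (Q : Subset n) → length (members Q) ≡ ∣ Q ∣
length-members []          = refl
length-members (true ∷ Q)  = cong suc (trans (Listₚ.length-map suc (members Q)) (length-members Q))
length-members (false ∷ Q) = trans (Listₚ.length-map suc (members Q)) (length-members Q)

∈-members : ∀ {n} {Q : Subset n} {i} → i Subset.∈ Q → i ∈ members Q
∈-members {Q = true ∷ Q}  Vec.here       = Any.here refl
∈-members {Q = true ∷ Q}  (Vec.there i∈) = Any.there (∈ₚ.∈-map⁺ suc (∈-members i∈))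
∈-members {Q = false ∷ Q} (Vec.there i∈) = ∈ₚ.∈-map⁺ suc (∈-members i∈)

-- Otherwise sending each number below K to its place in `ns` would be injective into fewer than K
-- places.
missing : ∀ K (ns : List ℕ) → length ns < K → ∃[ i ] i < K × ¬ (i ∈ ns)
missing K ns short =
  let (i , i∉) = Finₚ.¬∀⟶∃¬ K (λ i → toℕ i ∈ ns) (λ i → toℕ i ∈? ns) clash
  in toℕ i , Finₚ.toℕ<n i , i∉
  where
  open import Data.List.Membership.DecPropositional ℕₚ._≟_ using (_∈?_)
  clash : ¬ (∀ i → toℕ i ∈ ns)
  clash all with Finₚ.pigeonhole short (λ i → Any.index (all i))
  ... | i , j , i<j , e = ℕₚ.<-irrefl (trans (lookup-index (all i)) (trans (cong (List.lookup ns) e) (sym (lookup-index (all j))))) i<j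
    where
    lookup-index : ∀ {n} {ns : List ℕ} (n∈ : n ∈ ns) → n ≡ List.lookup ns (Any.index n∈)
    lookup-index (Any.here e)   = e
    lookup-index (Any.there n∈) = lookup-index n∈

-- Digraphs of decidable relations

module Relational {V : Set} (r : V → V → Bool) (xs : List V) where

  nodes : Vec V (length xs)
  nodes = Vec.fromList xs

  digraph : Digraph
  digraph = record { order = length xs ; matrix = Vec.map (λ x → Vec.map (r x) nodes) nodes }

  open Digraph digraph using (Arc; Vertex)

  node : Vertex → V
  node = lookup nodes

  private
    entry : ∀ u v → lookup (lookup (Digraph.matrix digraph) u) v ≡ r (node u) (node v)
    entry u v = trans (cong (λ row → lookup row v) (Vecₚ.lookup-map u (λ x → Vec.map (r x) nodes) nodes)) (Vecₚ.lookup-map v (r (node u)) nodes)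

  arc⁻ : ∀ u v → Arc u v → T (r (node u) (node v))
  arc⁻ u v = subst T (entry u v)

  arc⁺ : ∀ u v → T (r (node u) (node v)) → Arc u v
  arc⁺ u v = subst T (sym (entry u v))

  private
    index-of : ∀ {x} (ys : List V) → x ∈ ys → ∃[ i ] lookup (Vec.fromList ys) i ≡ x
    index-of (y ∷ ys) (Any.here refl) = zero , refl
    index-of (y ∷ ys) (Any.there x∈)  = let (i , e) = index-of ys x∈ in suc i , e

    member : ∀ (ys : List V) i → lookup (Vec.fromList ys) i ∈ ys
    member (y ∷ ys) zero    = Any.here refl
    member (y ∷ ys) (suc i) = Any.there (member ys i)

  vertex : ∀ {x} → x ∈ xs → ∃[ v ] node v ≡ x
  vertex = index-of xs

  node-∈ : ∀ v → node v ∈ xs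
  node-∈ = member xs

  encode-digraph : encode digraph ≡ replicate (length xs) true ++ false ∷ List.concatMap (λ x → List.map (r x) xs) xs
  encode-digraph = cong (λ bits → replicate (length xs) true ++ false ∷ bits) (begin
    Vec.toList (Vec.concat (Vec.map (λ x → Vec.map (r x) nodes) nodes))  ≡⟨ rows xs ⟩
    List.concatMap (λ x → Vec.toList (Vec.map (r x) nodes)) xs           ≡⟨ Listₚ.concatMap-cong (λ x → trans (Vecₚ.toList-map (r x) nodes) (cong (List.map (r x)) (Vecₚ.toList∘fromList xs))) xs ⟩
    List.concatMap (λ x → List.map (r x) xs) xs                          ∎)
    where
    open ≡-Reasoning
    rows : ∀ ys → Vec.toList (Vec.concat (Vec.map (λ x → Vec.map (r x) nodes) (Vec.fromList ys))) ≡ List.concatMap (λ x → Vec.toList (Vec.map (r x) nodes)) ys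
    rows []       = refl
    rows (y ∷ ys) = trans (Vecₚ.toList-++ (Vec.map (r y) nodes) _) (cong (Vec.toList (Vec.map (r y) nodes) ++_) (rows ys))

  -- A rank that drops along every arc excludes loops, opposite arcs and directed cycles alike, and
  -- makes every walk of length at most two a path.
  module Ranked (rank : V → ℕ) (descending : ∀ x y → T (r x y) → rank y < rank x) where

    descends : ∀ u v → Arc u v → rank (node v) < rank (node u)
    descends u v a = descending _ _ (arc⁻ u v a)

    private
      walk-descends : ∀ {u v} → Walk digraph u v → rank (node v) ≤ rank (node u)
      walk-descends ε       = ≤-refl
      walk-descends (a ◅ p) = ≤-trans (walk-descends p) (ℕₚ.<⇒≤ (descends _ _ a))

    arc-≢ : ∀ u v → Arc u v → u ≢ v
    arc-≢ u .u a refl = ℕₚ.<-irrefl refl (descends u u a)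

    acyclic : Acyclic digraph
    acyclic {u} {v} a p _ = ℕₚ.<-irrefl refl (≤-trans (descends u v a) (walk-descends p))

    module _ (side : V → Bool) (crossing : ∀ x y → T (r x y) → side x ≢ side y) where

      private
        T-∨⁻ : ∀ a {b} → T (a ∨ b) → T a ⊎ T b
        T-∨⁻ true  t = inj₁ tt
        T-∨⁻ false t = inj₂ t

        T-∨⁺ : ∀ a {b} → T a ⊎ T b → T (a ∨ b)
        T-∨⁺ true  _        = tt
        T-∨⁺ false (inj₂ t) = t

        arcs : Vertex → Vertex → Bool
        arcs u v = r (node u) (node v)

        symmetrise : ∀ {u v} → T (arcs u v) ⊎ T (arcs v u) → T (arcs u v ∨ arcs v u)
        symmetrise {u} {v} = T-∨⁺ (arcs u v)

        graph : Graph (length xs)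
        graph = record
          { edge        = λ u v → arcs u v ∨ arcs v u
          ; symmetric   = λ {u} {v} e → symmetrise {v} {u} (Sum.swap (T-∨⁻ (arcs u v) e))
          ; irreflexive = λ {v} e → Sum.[ (λ a → ℕₚ.<-irrefl refl (descending _ _ a)) , (λ a → ℕₚ.<-irrefl refl (descending _ _ a)) ]′ (T-∨⁻ (arcs v v) e)
          }

      orientation : AcyclicBipartiteOrientation digraph
      orientation = acyclic , graph ,
        (side ∘ node , λ {u} {v} e → Sum.[ crossing _ _ , (λ a → crossing _ _ a ∘ sym) ]′ (T-∨⁻ (arcs u v) e)) ,
        (λ u v → mk⇔ (Sum.map (arc⁺ u v) (arc⁺ v u) ∘ T-∨⁻ (arcs u v)) (T-∨⁺ (arcs u v) ∘ Sum.map (arc⁻ u v) (arc⁻ v u))) ,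
        (λ u v (a , b) → ℕₚ.<-asym (descends u v a) (descends v u b))

    Near : Vertex → Vertex → Set
    Near u w = Arc u w ⊎ (∃[ v ] Arc u v × Arc v w)

    -- `IsDistance` asks for the exact minimum, so the relation is tested for a direct arc first,
    -- even when a walk of length two is given. By the rank its ends are distinct, so length zero is
    -- impossible.
    near⇒distance : ∀ {u w} → Near u w → ∃[ d ] IsDistance digraph u w d × d ≤ 2
    near⇒distance {u} {w} near with r (node u) (node w) in eq
    near⇒distance {u} {w} near | true = 1 , ((a ◅ ε , (arc-≢ u w a ∷ []) ∷ [] ∷ [] , refl) , nonempty (arc-≢ u w a)) , s≤s z≤n
      where
      a : Arc u w
      a = arc⁺ u w (subst T (sym eq) tt)
      nonempty : ∀ {u w} → u ≢ w → (p : Walk digraph u w) → IsPath digraph p → 1 ≤ walkLength digraph p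
      nonempty ne ε       _ = contradiction refl ne
      nonempty ne (_ ◅ _) _ = s≤s z≤n
    near⇒distance {u} {w} (inj₁ a) | false = contradiction (subst T eq (arc⁻ u w a)) λ ()
    near⇒distance {u} {w} (inj₂ (v , a , b)) | false =
      2 , ((a ◅ b ◅ ε , (arc-≢ u v a ∷ u≢w ∷ []) ∷ (arc-≢ v w b ∷ []) ∷ [] ∷ [] , refl) , long) , ≤-refl
      where
      u≢w : u ≢ w
      u≢w refl = ℕₚ.<-asym (descends u v a) (descends v u b)
      long : (p : Walk digraph u w) → IsPath digraph p → 2 ≤ walkLength digraph p
      long ε           _ = contradiction refl u≢w
      long (c ◅ ε)     _ = contradiction (subst T eq (arc⁻ u w c)) λ ()
      long (_ ◅ _ ◅ _) _ = s≤s (s≤s z≤n)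

    distance⇒near : ∀ {u w d} → u ≢ w → IsDistance digraph u w d → d ≤ 2 → Near u w
    distance⇒near ne ((ε , _ , _) , _) _ = contradiction refl ne
    distance⇒near ne ((a ◅ ε , _ , _) , _) _ = inj₁ a
    distance⇒near ne ((a ◅ b ◅ ε , _ , _) , _) _ = inj₂ (_ , a , b)
    distance⇒near ne ((a ◅ b ◅ c ◅ p , _ , refl) , _) (s≤s (s≤s ()))

    Covered : (V → Set) → V → Set
    Covered P x = ∃[ z ] P z × (T (r x z) ⊎ ∃[ y ] y ∈ xs × T (r x y) × T (r y z))

    module Chosen (Q : Subset (length xs)) where

      Chosen : V → Set
      Chosen x = ∃[ v ] v Subset.∈ Q × node v ≡ x

      chosen : List V
      chosen = List.map node (members Q)

      length-chosen : length chosen ≡ ∣ Q ∣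
      length-chosen = trans (Listₚ.length-map node (members Q)) (length-members Q)

      ∈-chosen : ∀ {x} → Chosen x → x ∈ chosen
      ∈-chosen (v , v∈ , refl) = ∈ₚ.∈-map⁺ node (∈-members v∈)

      chosen-∈ : ∀ {x} → Chosen x → x ∈ xs
      chosen-∈ (v , _ , refl) = node-∈ v

      module _ (qk : IsQuasiKernel digraph Q) where

        chosen-independent : ∀ {x y} → Chosen x → Chosen y → ¬ T (r x y)
        chosen-independent (u , u∈ , refl) (v , v∈ , refl) a = proj₁ qk u∈ v∈ (arc-≢ u v (arc⁺ u v a)) (inj₁ (arc⁺ u v a))

        private
          covered-near : ∀ u v → v Subset.∈ Q → Near u v → Covered Chosen (node u)
          covered-near u v v∈ (inj₁ a)           = node v , (v , v∈ , refl) , inj₁ (arc⁻ u v a)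
          covered-near u v v∈ (inj₂ (t , a , b)) = node v , (v , v∈ , refl) , inj₂ (node t , node-∈ t , arc⁻ u t a , arc⁻ t v b)

          covered-distance : ∀ u → ¬ (u Subset.∈ Q) → (∃[ v ] v Subset.∈ Q × ∃[ d ] IsDistance digraph u v d × d ≤ 2) → Covered Chosen (node u)
          covered-distance u u∉ (v , v∈ , d , dist , d≤) = covered-near u v v∈ (distance⇒near (λ { refl → u∉ v∈ }) dist d≤)

        unchosen-covered : ∀ {x} → x ∈ xs → ¬ Chosen x → Covered Chosen x
        unchosen-covered x∈ x∉ = at-vertex (vertex x∈) x∉
          where
          at-vertex : ∀ {x} → ∃[ v ] node v ≡ x → ¬ Chosen x → Covered Chosen x
          at-vertex (v , refl) x∉ = covered-distance v (λ v∈ → x∉ (v , v∈ , refl)) (proj₂ qk v (λ v∈ → x∉ (v , v∈ , refl)))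

        sink-chosen : ∀ {x} → x ∈ xs → (∀ y → ¬ T (r x y)) → Chosen x
        sink-chosen x∈ sink = at-vertex (vertex x∈) sink
          where
          out-of : ∀ {x} → Covered Chosen x → ¬ (∀ y → ¬ T (r x y))
          out-of (z , _ , inj₁ a)               sink = sink z a
          out-of (z , _ , inj₂ (y , _ , a , _)) sink = sink y a
          decide : ∀ v → Dec (v Subset.∈ Q) → (∀ y → ¬ T (r (node v) y)) → Chosen (node v)
          decide v (yes v∈) sink = v , v∈ , refl
          decide v (no v∉)  sink = contradiction sink (out-of (covered-distance v v∉ (proj₂ qk v v∉)))
          at-vertex : ∀ {x} → ∃[ v ] node v ≡ x → (∀ y → ¬ T (r x y)) → Chosen x
          at-vertex (v , refl) sink = decide v (v Subsetₚ.∈? Q) sink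

    module Selection (selected : V → Bool)
      (independent : ∀ x y → T (selected x) → T (selected y) → ¬ T (r x y))
      (covering : ∀ {x} → x ∈ xs → ¬ T (selected x) → Covered (λ y → y ∈ xs × T (selected y)) x) where

      kernel : Subset (length xs)
      kernel = Vec.map selected nodes

      private
        selected⁻ : ∀ v → v Subset.∈ kernel → T (selected (node v))
        selected⁻ v v∈ = subst T (trans (sym (Vecₚ.[]=⇒lookup v∈)) (Vecₚ.lookup-map v selected nodes)) tt

        selected⁺ : ∀ v → T (selected (node v)) → v Subset.∈ kernel
        selected⁺ v t = Vecₚ.lookup⇒[]= v kernel (trans (Vecₚ.lookup-map v selected nodes) (is-true (selected (node v)) t))
          where
          is-true : ∀ b → T b → b ≡ true
          is-true true _ = refl

        indep : Independent digraph kernel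
        indep {u} {v} u∈ v∈ _ (inj₁ a) = independent (node u) (node v) (selected⁻ u u∈) (selected⁻ v v∈) (arc⁻ u v a)
        indep {u} {v} u∈ v∈ _ (inj₂ a) = independent (node v) (node u) (selected⁻ v v∈) (selected⁻ u u∈) (arc⁻ v u a)

        Reached : Vertex → Set
        Reached u = ∃[ w ] w Subset.∈ kernel × ∃[ d ] IsDistance digraph u w d × d ≤ 2

        reach₁ : ∀ u {z} → ∃[ w ] node w ≡ z → T (selected z) → T (r (node u) z) → Reached u
        reach₁ u (w , refl) s a = w , selected⁺ w s , near⇒distance (inj₁ (arc⁺ u w a))

        reach₂ : ∀ u {y z} → ∃[ v ] node v ≡ y → ∃[ w ] node w ≡ z → T (selected z) → T (r (node u) y) → T (r y z) → Reached u
        reach₂ u (v , refl) (w , refl) s a b = w , selected⁺ w s , near⇒distance (inj₂ (v , arc⁺ u v a , arc⁺ v w b))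

        reach : ∀ u → Covered (λ y → y ∈ xs × T (selected y)) (node u) → Reached u
        reach u (z , (z∈ , s) , inj₁ a)                = reach₁ u (vertex z∈) s a
        reach u (z , (z∈ , s) , inj₂ (y , y∈ , a , b)) = reach₂ u (vertex y∈) (vertex z∈) s a b

      quasi-kernel : IsQuasiKernel digraph kernel
      quasi-kernel = indep , λ v v∉ → reach v (covering (node-∈ v) (v∉ ∘ selected⁺ v))

      size-kernel : ∣ kernel ∣ ≡ trues (List.map selected xs)
      size-kernel = trans (∣∣-trues kernel) (cong trues (trans (Vecₚ.toList-map selected nodes) (cong (List.map selected) (Vecₚ.toList∘fromList xs))))

-- Concatenation of families of lists indexed by numbers

gather : ∀ {A : Set} → ℕ → (ℕ → List A) → List A
gather zero    f = []
gather (suc n) f = f 0 ++ gather n (f ∘ suc)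

gather-∈ : ∀ {A : Set} {n i x} {f : ℕ → List A} → i < n → x ∈ f i → x ∈ gather n f
gather-∈ {n = suc n} {zero}      _         x∈ = ∈ₚ.∈-++⁺ˡ x∈
gather-∈ {n = suc n} {suc i} {f = f} (s≤s i<n) x∈ = ∈ₚ.∈-++⁺ʳ (f 0) (gather-∈ i<n x∈)

gather-∈⁻ : ∀ {A : Set} n {x} {f : ℕ → List A} → x ∈ gather n f → ∃[ i ] i < n × x ∈ f i
gather-∈⁻ (suc n) {f = f} x∈ with ∈ₚ.∈-++⁻ (f 0) x∈
... | inj₁ p = 0 , s≤s z≤n , p
... | inj₂ p = let (i , i< , q) = gather-∈⁻ n p in suc i , s≤s i< , q

gather-cong : ∀ {A : Set} n {f g : ℕ → List A} → (∀ {i} → i < n → f i ≡ g i) → gather n f ≡ gather n g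
gather-cong zero    e = refl
gather-cong (suc n) e = cong₂ _++_ (e (s≤s z≤n)) (gather-cong n (λ i< → e (s≤s i<)))

gather-map : ∀ {A B : Set} n (h : A → B) (f : ℕ → List A) → List.map h (gather n f) ≡ gather n (List.map h ∘ f)
gather-map zero    h f = refl
gather-map (suc n) h f = trans (Listₚ.map-++ h (f 0) _) (cong (List.map h (f 0) ++_) (gather-map n h (f ∘ suc)))

gather-concatMap : ∀ {A B : Set} n (h : A → List B) (f : ℕ → List A) → List.concatMap h (gather n f) ≡ gather n (List.concatMap h ∘ f)
gather-concatMap zero    h f = refl
gather-concatMap (suc n) h f = trans (Listₚ.concatMap-++ h (f 0) _) (cong (List.concatMap h (f 0) ++_) (gather-concatMap n h (f ∘ suc)))

gather-+ : ∀ {A : Set} m n (f : ℕ → List A) → gather (m + n) f ≡ gather m f ++ gather n (λ i → f (m + i))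
gather-+ zero    n f = refl
gather-+ (suc m) n f = trans (cong (f 0 ++_) (gather-+ m n (f ∘ suc))) (sym (Listₚ.++-assoc (f 0) _ _))

gather-* : ∀ {A : Set} m n (f : ℕ → List A) → gather (m * n) f ≡ gather m (λ i → gather n (λ j → f (i * n + j)))
gather-* zero    n f = refl
gather-* (suc m) n f = trans (gather-+ n (m * n) f) (cong (gather n f ++_)
  (trans (gather-* m n (λ i → f (n + i))) (gather-cong m λ {i} _ → gather-cong n λ {j} _ → cong f (sym (+-assoc n (i * n) j)))))

length-gather : ∀ {A : Set} n {c} {f : ℕ → List A} → (∀ i → length (f i) ≡ c) → length (gather n f) ≡ n * c
length-gather zero    e = refl
length-gather (suc n) {f = f} e = trans (Listₚ.length-++ (f 0)) (cong₂ _+_ (e 0) (length-gather n (e ∘ suc)))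

trues-gather : ∀ n {c} {f : ℕ → List Bool} → (∀ i → trues (f i) ≡ c) → trues (gather n f) ≡ n * c
trues-gather zero    e = refl
trues-gather (suc n) {f = f} e = trans (trues-++ (f 0) _) (cong₂ _+_ (e 0) (trues-gather n (e ∘ suc)))

-- The approximation factor

fromℕ : ℕ → ℚ
fromℕ n = ℤ.+ n ℚ./ 1

private
  fromℕ-mkℚ : ∀ n → fromℕ n ≡ ℚ.mkℚ (ℤ.+ n) 0 (Coprime.sym (Coprime.1-coprimeTo n))
  fromℕ-mkℚ n = ℚₚ.normalize-coprime (Coprime.sym (Coprime.1-coprimeTo n))

fromℕ-* : ∀ a b → fromℕ (a * b) ≡ fromℕ a ℚ.* fromℕ b
fromℕ-* a b = sym (trans (cong₂ ℚ._*_ (fromℕ-mkℚ a) (fromℕ-mkℚ b)) (cong (ℚ._/ 1) (sym (ℤₚ.pos-* a b))))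

fromℕ-+ : ∀ a b → fromℕ (a + b) ≡ fromℕ a ℚ.+ fromℕ b
fromℕ-+ a b = sym (trans (cong₂ ℚ._+_ (fromℕ-mkℚ a) (fromℕ-mkℚ b))
  (cong (ℚ._/ 1) (trans (cong₂ ℤ._+_ (ℤₚ.*-identityʳ (ℤ.+ a)) (ℤₚ.*-identityʳ (ℤ.+ b))) refl)))

fromℕ-cancel-≤ : ∀ {a b} → fromℕ a ℚ.≤ fromℕ b → a ≤ b
fromℕ-cancel-≤ {a} {b} le with subst₂ ℚ._≤_ (fromℕ-mkℚ a) (fromℕ-mkℚ b) le
... | ℚ.*≤* q = ℤₚ.drop‿+≤+ (subst₂ ℤ._≤_ (ℤₚ.*-identityʳ (ℤ.+ a)) (ℤₚ.*-identityʳ (ℤ.+ b)) q)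

fromℕ-nonNeg : ∀ n → 0ℚ ℚ.≤ fromℕ n
fromℕ-nonNeg n = ℚₚ.nonNegative⁻¹ (fromℕ n) {{ℚₚ.normalize-nonNeg n 1}}

private
  square-≤ : ∀ {p q} → 0ℚ ℚ.≤ p → p ℚ.≤ q → p ℚ.* p ℚ.≤ q ℚ.* q
  square-≤ {p} {q} 0≤p p≤q = ℚₚ.≤-trans (ℚₚ.*-monoˡ-≤-nonNeg p {{ℚ.nonNegative 0≤p}} p≤q)
    (ℚₚ.*-monoʳ-≤-nonNeg q {{ℚ.nonNegative (ℚₚ.≤-trans 0≤p p≤q)}} p≤q)

  -- The first three terms of the exponential series are 1, s and s ^ 2 / 2. The first two are
  -- nonnegative, so s ^ 2 / 2 alone is at most n.
  square-≤ln : ∀ {s n} → s ≤ln n → s ℚ.* s ℚ.≤ fromℕ (2 * n)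
  square-≤ln {s} {n} (0≤s , below-exp) = begin
    s ℚ.* s                     ≡⟨ halves s ⟩
    quadratic ℚ.+ quadratic     ≤⟨ ℚₚ.+-mono-≤ quadratic≤ quadratic≤ ⟩
    fromℕ n ℚ.+ fromℕ n         ≡⟨ fromℕ-+ n n ⟨
    fromℕ (n + n)               ≡⟨ cong (λ m → fromℕ (n + m)) (+-identityʳ n) ⟨
    fromℕ (2 * n)               ∎
    where
    open ℚₚ.≤-Reasoning
    quadratic linear : ℚ
    quadratic = expTerm s 2
    linear = expTerm s 1
    halves : ∀ s → s ℚ.* s ≡ expTerm s 2 ℚ.+ expTerm s 2
    halves s = solve 1 (λ s → s :* s := (con 1ℚ :* s :* con (ℤ.+ 1 ℚ./ 1)) :* s :* con (ℤ.+ 1 ℚ./ 2) :+ (con 1ℚ :* s :* con (ℤ.+ 1 ℚ./ 1)) :* s :* con (ℤ.+ 1 ℚ./ 2)) refl s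
      where open ℚSolver.+-*-Solver
    linear≡ : s ≡ linear
    linear≡ = solve 1 (λ s → s := con 1ℚ :* s :* con (ℤ.+ 1 ℚ./ 1)) refl s
      where open ℚSolver.+-*-Solver
    constant≥ : 0ℚ ℚ.≤ (0ℚ ℚ.+ 1ℚ) ℚ.+ linear
    constant≥ = ℚₚ.≤-trans (ℚₚ.≤-reflexive (sym (ℚₚ.+-identityʳ 0ℚ)))
      (ℚₚ.+-mono-≤ (ℚₚ.nonNegative⁻¹ (0ℚ ℚ.+ 1ℚ)) (ℚₚ.≤-trans 0≤s (ℚₚ.≤-reflexive linear≡)))
    quadratic≤ : quadratic ℚ.≤ fromℕ n
    quadratic≤ = ℚₚ.≤-trans (ℚₚ.≤-reflexive (sym (ℚₚ.+-identityˡ quadratic)))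
      (ℚₚ.≤-trans (ℚₚ.+-mono-≤ constant≥ ℚₚ.≤-refl) (below-exp 3))

-- Squaring eliminates the rational s and leaves an inequality of natural numbers. If instead r ≤ 1,
-- then x ≤ m, and the factor 2 n is at least 1.
within-square : ∀ {n x m} → 1 ≤ n → WithinFactor (LogFactor 1ℚ n) x m → x * x ≤ 2 * n * (m * m)
within-square {n} {x} {m} 1≤n (r , inj₁ r≤1 , x≤) = begin
  x * x           ≤⟨ *-mono-≤ x≤m x≤m ⟩
  m * m           ≤⟨ ℕₚ.m≤n*m (m * m) (2 * n) {{ℕ.>-nonZero (≤-trans 1≤n (m≤m+n n _))}} ⟩
  2 * n * (m * m) ∎
  where
  open ≤-Reasoning
  x≤m : x ≤ m
  x≤m = fromℕ-cancel-≤ {x} {m} (ℚₚ.≤-trans x≤ (ℚₚ.≤-trans (ℚₚ.*-monoʳ-≤-nonNeg (fromℕ m) {{ℚ.nonNegative (fromℕ-nonNeg m)}} r≤1)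
    (ℚₚ.≤-reflexive (ℚₚ.*-identityˡ (fromℕ m)))))
within-square {n} {x} {m} 1≤n (r , inj₂ (s , s≤ln , r≤s) , x≤) = fromℕ-cancel-≤ {x * x} {2 * n * (m * m)} (begin
  fromℕ (x * x)                             ≡⟨ fromℕ-* x x ⟩
  fromℕ x ℚ.* fromℕ x                       ≤⟨ square-≤ (fromℕ-nonNeg x) x≤sm ⟩
  (s ℚ.* fromℕ m) ℚ.* (s ℚ.* fromℕ m)       ≡⟨ solve 2 (λ s m → (s :* m) :* (s :* m) := (s :* s) :* (m :* m)) refl s (fromℕ m) ⟩
  (s ℚ.* s) ℚ.* (fromℕ m ℚ.* fromℕ m)       ≡⟨ cong ((s ℚ.* s) ℚ.*_) (fromℕ-* m m) ⟨
  (s ℚ.* s) ℚ.* fromℕ (m * m)               ≤⟨ ℚₚ.*-monoʳ-≤-nonNeg (fromℕ (m * m)) {{ℚ.nonNegative (fromℕ-nonNeg (m * m))}} (square-≤ln {s} {n} s≤ln) ⟩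
  fromℕ (2 * n) ℚ.* fromℕ (m * m)           ≡⟨ fromℕ-* (2 * n) (m * m) ⟨
  fromℕ (2 * n * (m * m))                   ∎)
  where
  open ℚₚ.≤-Reasoning
  open ℚSolver.+-*-Solver
  x≤sm : fromℕ x ℚ.≤ s ℚ.* fromℕ m
  x≤sm = ℚₚ.≤-trans x≤ (ℚₚ.*-monoʳ-≤-nonNeg (fromℕ m) {{ℚ.nonNegative (fromℕ-nonNeg m)}} (ℚₚ.≤-trans r≤s (ℚₚ.≤-reflexive (ℚₚ.*-identityˡ s))))

-- The digraph of the clauses

data Node (Square Clause : Set) : Set where
  sink⁺ sink⁻ middle⁺ middle⁻ : Node Square Clause
  variable′    : ℕ → Square → Bool → Node Square Clause
  clause link  : ℕ → ℕ → Clause → Node Square Clause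

inSlot : {Square : Set} → (Slot → Square → Bool) → Maybe Slot → Square → Bool
inSlot f nothing  σ = false
inSlot f (just s) σ = f s σ

module Gadget (Square Clause : Set) (finite-Square : Finite Square) (finite-Clause : Finite Clause)
  (literal : ℕ → Clause → Bool → Slot → Square → Bool) (ℓ E J K : ℕ) where

  open Finite

  V : Set
  V = Node Square Clause

  -- Adjacency is expressed by moved lists and not by equations between indices, because a program
  -- holds a row in this form: one more `nothing` on top of a stack leads from index j to j + 1.
  shifted : List (Maybe Slot) → ℕ → ℕ → Maybe Slot
  shifted pattern′ j e = nth nothing (replicate j nothing ++ pattern′) e

  diagonal clausePattern : List (Maybe Slot)
  -- Only the presence of the entry is tested; the slot in it is a mere mark.
  diagonal      = [ just above-left ]
  clausePattern = just above-left ∷ just above ∷ just above-right ∷ replicate ℓ nothing ++ [ just below ]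

  -- A variable's nodes reach their sinks in two steps, so both are optional in
  -- a quasi-kernel, but not together.  Copy i of a clause needs one of its
  -- literals, directly or through its link, or costs a node of its own.
  arc : V → V → Bool
  arc middle⁺               sink⁺                = true
  arc middle⁻               sink⁻                = true
  arc (variable′ e σ true)  middle⁺              = true
  arc (variable′ e σ false) middle⁻              = true
  arc (variable′ e σ true)  (variable′ e′ τ false) = Maybe.is-just (shifted diagonal e e′) ∧ _==_ finite-Square σ τ
  arc (clause i j κ)        (variable′ e σ false) = inSlot (literal j κ false) (shifted clausePattern j e) σ
  arc (clause i j κ)        (link i′ j′ κ′)      = Maybe.is-just (shifted diagonal (i * J + j) (i′ * J + j′)) ∧ _==_ finite-Clause κ κ′
  -- This brings `sink⁻` within two steps of the link, so that links cost nothing, while every walk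
  -- from a clause to `sink⁻` has length three. The choice of `middle⁻` respects the two sides.
  arc (link i j κ)          middle⁻              = true
  arc (link i j κ)          (variable′ e σ true) = inSlot (literal j κ true) (shifted clausePattern j e) σ
  arc _                     _                    = false

  variableNodes : ℕ → List V
  variableNodes e = List.concatMap (λ σ → variable′ e σ true ∷ variable′ e σ false ∷ []) (elements finite-Square)

  clauseNodes : ℕ → ℕ → List V
  clauseNodes i j = List.concatMap (λ κ → clause i j κ ∷ link i j κ ∷ []) (elements finite-Clause)

  private
    concatMap-∈ : ∀ {A B : Set} {x : A} {y : B} {f : A → List B} {xs} → x ∈ xs → y ∈ f x → y ∈ List.concatMap f xs
    concatMap-∈ {f = f} x∈ y∈ = ∈ₚ.∈-concatMap⁺ f (Any.map (λ { refl → y∈ }) x∈)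

  Valid : V → Set
  Valid (variable′ e _ _) = e < E
  Valid (clause i j _)    = i < K × j < J
  Valid (link i j _)      = i < K × j < J
  Valid _                 = ⊤

  abstract
    nodes : List V
    nodes = (sink⁺ ∷ sink⁻ ∷ middle⁺ ∷ middle⁻ ∷ []) ++ gather E variableNodes ++ gather K (λ i → gather J (clauseNodes i))

    nodes-≡ : nodes ≡ (sink⁺ ∷ sink⁻ ∷ middle⁺ ∷ middle⁻ ∷ []) ++ gather E variableNodes ++ gather K (λ i → gather J (clauseNodes i))
    nodes-≡ = refl

    sink⁺-∈ : sink⁺ ∈ nodes
    sink⁺-∈ = Any.here refl

    sink⁻-∈ : sink⁻ ∈ nodes
    sink⁻-∈ = Any.there (Any.here refl)

    middle⁺-∈ : middle⁺ ∈ nodes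
    middle⁺-∈ = Any.there (Any.there (Any.here refl))
    middle⁻-∈ : middle⁻ ∈ nodes
    middle⁻-∈ = Any.there (Any.there (Any.there (Any.here refl)))

    variable-∈ : ∀ {e} σ b → e < E → variable′ e σ b ∈ nodes
    variable-∈ σ b e< = ∈ₚ.∈-++⁺ʳ (sink⁺ ∷ sink⁻ ∷ middle⁺ ∷ middle⁻ ∷ []) (∈ₚ.∈-++⁺ˡ (gather-∈ e< (concatMap-∈ (∈-elements finite-Square σ) (choose b))))
      where
      choose : ∀ {e σ} b → _∈_ {A = V} (variable′ e σ b) (variable′ e σ true ∷ variable′ e σ false ∷ [])
      choose true  = Any.here refl
      choose false = Any.there (Any.here refl)

    clauses-∈ : ∀ {i j x} κ → i < K → j < J → x ∈ clause i j κ ∷ link i j κ ∷ [] → x ∈ nodes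
    clauses-∈ κ i< j< x∈ = ∈ₚ.∈-++⁺ʳ (sink⁺ ∷ sink⁻ ∷ middle⁺ ∷ middle⁻ ∷ []) (∈ₚ.∈-++⁺ʳ (gather E variableNodes)
      (gather-∈ i< (gather-∈ j< (concatMap-∈ (∈-elements finite-Clause κ) x∈))))

    valid : ∀ {x} → x ∈ nodes → Valid x
    valid (Any.here refl) = tt
    valid (Any.there (Any.here refl)) = tt
    valid (Any.there (Any.there (Any.here refl))) = tt
    valid (Any.there (Any.there (Any.there (Any.here refl)))) = tt
    valid (Any.there (Any.there (Any.there (Any.there x∈)))) with ∈ₚ.∈-++⁻ (gather E variableNodes) x∈
    ... | inj₁ p = of-variables (gather-∈⁻ E p)
      where
      of-variables : ∀ {x} → ∃[ e ] e < E × x ∈ variableNodes e → Valid x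
      of-variables (e , e< , q) with Any.satisfied (∈ₚ.∈-concatMap⁻ (λ σ → variable′ e σ true ∷ variable′ e σ false ∷ []) {xs = elements finite-Square} q)
      ... | σ , Any.here refl = e<
      ... | σ , Any.there (Any.here refl) = e<
    ... | inj₂ p with gather-∈⁻ K p
    ... | i , i< , q with gather-∈⁻ J q
    ... | j , j< , r with Any.satisfied (∈ₚ.∈-concatMap⁻ (λ κ → clause i j κ ∷ link i j κ ∷ []) {xs = elements finite-Clause} r)
    ... | κ , Any.here refl = i< , j<
    ... | κ , Any.there (Any.here refl) = i< , j<

  rank : V → ℕ
  rank sink⁺                 = 0
  rank sink⁻                 = 0
  rank middle⁺               = 1
  rank middle⁻               = 1
  rank (variable′ _ _ false) = 2
  rank (variable′ _ _ true)  = 3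
  rank (link _ _ _)          = 4
  rank (clause _ _ _)        = 5

  side : V → Bool
  side sink⁺                 = false
  side sink⁻                 = true
  side middle⁺               = true
  side middle⁻               = false
  side (variable′ _ _ b)     = not b
  side (link _ _ _)          = true
  side (clause _ _ _)        = false

  private
    both : ∀ x y → T (arc x y) → rank y < rank x × side x ≢ side y
    both middle⁺               sink⁺                  t = s≤s z≤n , λ ()
    both middle⁻               sink⁻                  t = s≤s z≤n , λ ()
    both (variable′ e σ true)  middle⁺                t = s≤s (s≤s z≤n) , λ ()
    both (variable′ e σ false) middle⁻                t = s≤s (s≤s z≤n) , λ ()
    both (variable′ e σ true)  (variable′ e′ τ false) t = s≤s (s≤s (s≤s z≤n)) , λ ()
    both (clause i j κ)        (variable′ e σ false)  t = s≤s (s≤s (s≤s z≤n)) , λ ()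
    both (clause i j κ)        (link i′ j′ κ′)        t = s≤s (s≤s (s≤s (s≤s (s≤s z≤n)))) , λ ()
    both (link i j κ)          middle⁻                t = s≤s (s≤s z≤n) , λ ()
    both (link i j κ)          (variable′ e σ true)   t = s≤s (s≤s (s≤s (s≤s z≤n))) , λ ()

  open Relational arc nodes renaming (nodes to nodeVec) public
  open Ranked rank (λ x y t → proj₁ (both x y t)) public

  bipartite : AcyclicBipartiteOrientation digraph
  bipartite = orientation side (λ x y t → proj₂ (both x y t))

  private
    diagonal-≡ : ∀ e e′ → T (Maybe.is-just (shifted diagonal e e′)) → e′ ≡ e
    diagonal-≡ zero    zero     t = refl
    diagonal-≡ (suc e) (suc e′) t = cong suc (diagonal-≡ e e′ t)

    diagonal-refl : ∀ e → shifted diagonal e e ≡ just above-left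
    diagonal-refl zero    = refl
    diagonal-refl (suc e) = diagonal-refl e

    pattern-offset : ∀ s → nth nothing clausePattern (offset ℓ s) ≡ just s
    pattern-offset above-left  = refl
    pattern-offset above       = refl
    pattern-offset above-right = refl
    pattern-offset below       = last ℓ
      where
      last : ∀ n → nth nothing (replicate n nothing ++ [ just below ]) n ≡ just below
      last zero    = refl
      last (suc n) = last n

    clause-slot : ∀ j s → shifted clausePattern j (offset ℓ s + j) ≡ just s
    clause-slot j s = trans (cong (nth nothing (replicate j nothing ++ clausePattern)) (+-comm (offset ℓ s) j))
      (trans (nth-replicate-++ j clausePattern (offset ℓ s)) (pattern-offset s))

    slot-pattern : ∀ e {s} → nth nothing clausePattern e ≡ just s → e ≡ offset ℓ s
    slot-pattern 0 refl = refl
    slot-pattern 1 refl = refl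
    slot-pattern 2 refl = refl
    slot-pattern (suc (suc (suc e))) q = last ℓ e q
      where
      last : ∀ n e {s} → nth nothing (replicate n nothing ++ [ just below ]) e ≡ just s → 3 + e ≡ offset n s
      last zero    zero    refl = refl
      last (suc n) (suc e) {below} q = cong suc (last n e q)
      last (suc n) (suc e) {above-left}  q = contradiction (last n e q) λ ()
      last (suc n) (suc e) {above}       q = contradiction (last n e q) λ ()
      last (suc n) (suc e) {above-right} q = contradiction (last n e q) λ ()

    slot-clause : ∀ j e {s} → shifted clausePattern j e ≡ just s → e ≡ offset ℓ s + j
    slot-clause j e q = trans (strip j e q) (+-comm j _)
      where
      strip : ∀ j e {s} → shifted clausePattern j e ≡ just s → e ≡ j + offset ℓ s
      strip zero    e       q = slot-pattern e q
      strip (suc j) (suc e) q = cong suc (strip j e q)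

    lexicographic : ∀ i i′ {j j′} → j < J → j′ < J → i * J + j ≡ i′ * J + j′ → i ≡ i′ × j ≡ j′
    lexicographic zero    zero     _   _    e = refl , e
    lexicographic zero    (suc i′) {j} {j′} j<J _ e = contradiction (≤-trans (≤-trans (m≤m+n J (i′ * J)) (m≤m+n (J + i′ * J) j′)) (≤-reflexive (sym e))) (ℕₚ.<⇒≱ j<J)
    lexicographic (suc i) zero     {j} {j′} _ j′<J e = contradiction (≤-trans (≤-trans (m≤m+n J (i * J)) (m≤m+n (J + i * J) j)) (≤-reflexive e)) (ℕₚ.<⇒≱ j′<J)
    lexicographic (suc i) (suc i′) {j} {j′} j<J j′<J e =
      let (p , q) = lexicographic i i′ j<J j′<J (ℕₚ.+-cancelˡ-≡ J _ _ (trans (sym (+-assoc J (i * J) j)) (trans e (+-assoc J (i′ * J) j′))))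
      in cong suc p , q

    T-∧⁻ : ∀ a {b} → T (a ∧ b) → T a × T b
    T-∧⁻ true t = tt , t

    T-∧⁺ : ∀ {a b} → T a → T b → T (a ∧ b)
    T-∧⁺ {true} _ t = t

    no-arc-from-sink⁻ : ∀ y → ¬ T (arc sink⁻ y)
    no-arc-from-sink⁻ y t with both sink⁻ y t
    ... | () , _

  module FromQuasiKernel (Q : Subset (length nodes)) (qk : IsQuasiKernel digraph Q) (small : ∣ Q ∣ < K) where

    open Chosen Q

    Tr Fa : ℕ → Square → Set
    Tr e σ = Chosen (variable′ e σ true)
    Fa e σ = Chosen (variable′ e σ false)

    private
      middle-unchosen : ¬ Chosen middle⁻
      middle-unchosen c = chosen-independent qk c (sink-chosen qk sink⁻-∈ no-arc-from-sink⁻) tt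

      copy : V → ℕ
      copy (clause i _ _) = i
      copy (link i _ _)   = i
      -- K is outside the range of the copies, so such a vertex uses up none of them.
      copy _              = K

      copies : List ℕ
      copies = List.map copy chosen

      unused : ∃[ i ] i < K × ¬ (i ∈ copies)
      unused = missing K copies (≤-trans (s≤s (≤-reflexive (trans (Listₚ.length-map copy chosen) length-chosen))) small)

      i₀ : ℕ
      i₀ = proj₁ unused

      not-copy : ∀ {x} → Chosen x → copy x ≢ i₀
      not-copy c e = proj₂ (proj₂ unused) (subst (_∈ copies) e (∈ₚ.∈-map⁺ copy (∈-chosen c)))

    consistent : ∀ {e σ} → Tr e σ → Fa e σ → ⊥
    consistent {e} {σ} t f = chosen-independent qk t f (T-∧⁺ (subst (T ∘ Maybe.is-just) (sym (diagonal-refl e)) tt) (subst T (sym (==-refl finite-Square σ)) tt))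

    private
      Slotted : (Slot → Square → Bool) → (ℕ → Square → Set) → ℕ → Square → Set
      Slotted f P j σ = ∃[ s ] T (f s σ) × P (offset ℓ s + j) σ

      read : ∀ f P j e σ → T (inSlot f (shifted clausePattern j e) σ) → P e σ → Slotted f P j σ
      read f P j e σ = at-slot (shifted clausePattern j e) refl
        where
        at-slot : ∀ m → shifted clausePattern j e ≡ m → T (inSlot f m σ) → P e σ → Slotted f P j σ
        at-slot (just s) q t p = s , t , subst (λ e → P e σ) (slot-clause j e q) p

      same-copy : ∀ {i j i′ j′} → j < J → j′ < J → T (Maybe.is-just (shifted diagonal (i * J + j) (i′ * J + j′))) → i′ ≡ i × j′ ≡ j
      same-copy {i} {j} {i′} {j′} j< j′< t = lexicographic i′ i j′< j< (diagonal-≡ (i * J + j) (i′ * J + j′) t)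

      direct : ∀ j κ x → j < J → Chosen x → T (arc (clause i₀ j κ) x) → Holds (literal j κ) Tr Fa ℓ j
      direct j κ (variable′ e σ false) j< c a = let (s , t , f) = read (literal j κ false) Fa j e σ a c in s , σ , inj₁ (t , f)
      direct j κ (link i′ j′ κ′)       j< c a = contradiction
        (proj₁ (same-copy {i₀} {j} {i′} {j′} j< (proj₂ (valid (chosen-∈ c))) (proj₁ (T-∧⁻ (Maybe.is-just (shifted diagonal (i₀ * J + j) (i′ * J + j′))) a))))
        (not-copy c)

      -- The second step leads either to `middle⁻`, which is adjacent to the sink that every
      -- quasi-kernel contains, or from the clause's own link to a positive literal.
      indirect : ∀ j κ y x → j < J → y ∈ nodes → Chosen x → T (arc (clause i₀ j κ) y) → T (arc y x) → Holds (literal j κ) Tr Fa ℓ j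
      indirect j κ (variable′ e σ false) middle⁻              j< y∈ c a b = contradiction c middle-unchosen
      indirect j κ (link i′ j′ κ′)       middle⁻              j< y∈ c a b = contradiction c middle-unchosen
      indirect j κ (link i′ j′ κ′)       (variable′ e σ true) j< y∈ c a b =
        own (proj₂ (same-copy {i₀} {j} {i′} {j′} j< (proj₂ (valid y∈)) (proj₁ a₁₂))) (==⇒≡ finite-Clause {κ} {κ′} (proj₂ a₁₂)) b
        where
        a₁₂ = T-∧⁻ (Maybe.is-just (shifted diagonal (i₀ * J + j) (i′ * J + j′))) a
        own : ∀ {j′ κ′} → j′ ≡ j → κ ≡ κ′ → T (inSlot (literal j′ κ′ true) (shifted clausePattern j′ e) σ) → Holds (literal j κ) Tr Fa ℓ j
        own refl refl b = let (s , t , f) = read (literal j κ true) Tr j e σ b c in s , σ , inj₂ (t , f)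

      from-cover : ∀ j κ → j < J → Covered Chosen (clause i₀ j κ) → Holds (literal j κ) Tr Fa ℓ j
      from-cover j κ j< (x , c , inj₁ a)                = direct j κ x j< c a
      from-cover j κ j< (x , c , inj₂ (y , y∈ , a , b)) = indirect j κ y x j< y∈ c a b

    -- Copy `i₀` has no chosen vertex. Its clauses are therefore covered from outside, which is
    -- possible only through a chosen literal. All copies carry the same clauses, so one copy is
    -- enough.
    satisfied : ∀ j κ → j < J → Holds (literal j κ) Tr Fa ℓ j
    satisfied j κ j< = from-cover j κ j< (unchosen-covered qk (clauses-∈ {i₀} {j} κ (proj₁ (proj₂ unused)) j< (Any.here refl)) (λ c → not-copy c refl))

  module ToQuasiKernel (holds : ℕ → Square → Bool) (inside : 3 + ℓ + J ≤ E)
    (satisfied : ∀ j κ → Holds (literal j κ) (λ e σ → T (holds e σ)) (λ e σ → T (not (holds e σ))) ℓ j) where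

    selected : V → Bool
    selected sink⁺                 = true
    selected sink⁻                 = true
    selected (variable′ e σ true)  = holds e σ
    selected (variable′ e σ false) = not (holds e σ)
    selected _                     = false

    private
      no-arc : ∀ x y → T (selected x) → T (selected y) → ¬ T (arc x y)
      no-arc sink⁺ sink⁺ s t ()
      no-arc sink⁻ sink⁻ s t ()
      no-arc (variable′ e σ true)  sink⁺ s t ()
      no-arc (variable′ e σ false) sink⁺ s t ()
      no-arc (variable′ e σ true)  sink⁻ s t ()
      no-arc (variable′ e σ false) sink⁻ s t ()
      no-arc (variable′ e σ true) (variable′ e′ τ false) s t a
        with T-∧⁻ (Maybe.is-just (shifted diagonal e e′)) a
      ... | a₁ , a₂ with diagonal-≡ e e′ a₁ | ==⇒≡ finite-Square {σ} {τ} a₂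
      ... | refl | refl = clash (holds e σ) s t
        where
        clash : ∀ b → T b → ¬ T (not b)
        clash true _ ()

      Cover : V → Set
      Cover = Covered (λ y → y ∈ nodes × T (selected y))

      offset≤ : ∀ ℓ s → offset ℓ s ≤ 3 + ℓ
      offset≤ ℓ above-left  = z≤n
      offset≤ ℓ above       = s≤s z≤n
      offset≤ ℓ above-right = s≤s (s≤s z≤n)
      offset≤ ℓ below       = ≤-refl

      in-slot : ∀ (f : Slot → Square → Bool) j s σ → T (f s σ) → T (inSlot f (shifted clausePattern j (offset ℓ s + j)) σ)
      in-slot f j s σ t = subst (λ m → T (inSlot f m σ)) (sym (clause-slot j s)) t

      slot-inside : ∀ s {j} → j < J → offset ℓ s + j < E
      slot-inside s j< = ≤-trans (ℕₚ.+-mono-≤-< (offset≤ ℓ s) j<) inside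

      clause-covered : ∀ i j κ → i < K → j < J → Holds (literal j κ) (λ e σ → T (holds e σ)) (λ e σ → T (not (holds e σ))) ℓ j → Cover (clause i j κ)
      clause-covered i j κ i< j< (s , σ , inj₁ (t , f)) = variable′ (offset ℓ s + j) σ false ,
        (variable-∈ σ false (slot-inside s j<) , f) , inj₁ (in-slot (literal j κ false) j s σ t)
      clause-covered i j κ i< j< (s , σ , inj₂ (t , f)) = variable′ (offset ℓ s + j) σ true ,
        (variable-∈ σ true (slot-inside s j<) , f) ,
        inj₂ (link i j κ , clauses-∈ κ i< j< (Any.there (Any.here refl)) ,
          T-∧⁺ (subst (T ∘ Maybe.is-just) (sym (diagonal-refl (i * J + j))) tt) (subst T (sym (==-refl finite-Clause κ)) tt) ,
          in-slot (literal j κ true) j s σ t)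

      covers : ∀ x → Valid x → ¬ T (selected x) → Cover x
      covers sink⁺                 v n = contradiction tt n
      covers sink⁻                 v n = contradiction tt n
      covers middle⁺               v n = sink⁺ , (sink⁺-∈ , tt) , inj₁ tt
      covers middle⁻               v n = sink⁻ , (sink⁻-∈ , tt) , inj₁ tt
      covers (variable′ e σ true)  v n = sink⁺ , (sink⁺-∈ , tt) , inj₂ (middle⁺ , middle⁺-∈ , tt , tt)
      covers (variable′ e σ false) v n = sink⁻ , (sink⁻-∈ , tt) , inj₂ (middle⁻ , middle⁻-∈ , tt , tt)
      covers (link i j κ)          v n = sink⁻ , (sink⁻-∈ , tt) , inj₂ (middle⁻ , middle⁻-∈ , tt , tt)
      covers (clause i j κ) (i< , j<) n = clause-covered i j κ i< j< (satisfied j κ)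

    open Selection selected no-arc (λ {x} x∈ → covers x (valid x∈)) renaming (size-kernel to size-selected) public

    -- Exactly one of the two vertices of each variable is selected, whatever the assignment, and no
    -- clause or link is. The size is thus independent of K.
    size-kernel : ∣ kernel ∣ ≡ 2 + E * length (elements finite-Square)
    size-kernel = begin
      ∣ kernel ∣ ≡⟨ size-selected ⟩
      trues (List.map selected nodes) ≡⟨ cong (trues ∘ List.map selected) nodes-≡ ⟩
      2 + trues (List.map selected (gather E variableNodes ++ gather K (λ i → gather J (clauseNodes i))))
        ≡⟨ cong (λ bs → 2 + trues bs) (Listₚ.map-++ selected (gather E variableNodes) _) ⟩
      2 + trues (List.map selected (gather E variableNodes) ++ List.map selected (gather K (λ i → gather J (clauseNodes i))))
        ≡⟨ cong (2 +_) (trues-++ (List.map selected (gather E variableNodes)) _) ⟩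
      2 + (trues (List.map selected (gather E variableNodes)) + trues (List.map selected (gather K (λ i → gather J (clauseNodes i)))))
        ≡⟨ cong₂ (λ a b → 2 + (trues a + trues b)) (gather-map E selected variableNodes)
             (trans (gather-map K selected _) (gather-cong K (λ {i} _ → gather-map J selected (clauseNodes i)))) ⟩
      2 + (trues (gather E (List.map selected ∘ variableNodes)) + trues (gather K (λ i → gather J (List.map selected ∘ clauseNodes i))))
        ≡⟨ cong₂ (λ a b → 2 + (a + b)) (trues-gather E (λ e → variables-trues e (elements finite-Square)))
             (trues-gather K {0} (λ i → trans (trues-gather J {0} (λ j → clauses-trues i j (elements finite-Clause))) (ℕₚ.*-zeroʳ J))) ⟩
      2 + (E * length (elements finite-Square) + K * 0) ≡⟨ cong (2 +_) (trans (cong (E * length (elements finite-Square) +_) (ℕₚ.*-zeroʳ K)) (+-identityʳ _)) ⟩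
      2 + E * length (elements finite-Square) ∎
      where
      open ≡-Reasoning
      variables-trues : ∀ e σs → trues (List.map selected (List.concatMap (λ σ → variable′ e σ true ∷ variable′ e σ false ∷ []) σs)) ≡ length σs
      variables-trues e []       = refl
      variables-trues e (σ ∷ σs) with holds e σ
      ... | true  = cong suc (variables-trues e σs)
      ... | false = cong suc (variables-trues e σs)
      clauses-trues : ∀ i j κs → trues (List.map selected (List.concatMap (λ κ → clause i j κ ∷ link i j κ ∷ []) κs)) ≡ 0
      clauses-trues i j []       = refl
      clauses-trues i j (κ ∷ κs) = clauses-trues i j κs

-- The program that writes the digraph

nest : ∀ {A : Set} → ℕ → (A → A) → A → A
nest zero    f a = a
nest (suc n) f a = f (nest n f a)

module Generator (A : TM) (Square Clause L : Set) (finite-Square : Finite Square) (finite-Clause : Finite Clause) (finite-L : Finite L)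
  (lit : L → Clause → Bool → Slot → Square → Bool) (default : L) where

  open Finite using (elements; _==_)

  Datum : Set
  Datum = L ⊎ Maybe Slot

  finite-Datum : Finite Datum
  finite-Datum = finite-⊎ finite-L (finite-Maybe finite-Slot)

  open Simulation A Datum finite-Datum 7 public
  open Programs Γ FΓ 10 public
  open Loops Γ FΓ 10 public

  inBit : Bool → Γ
  inBit b = onTape (bit b)

  marks : List (Maybe Slot) → List Γ
  marks = List.map (aux ∘ inj₂)

  labs : List L → List Γ
  labs = List.map (aux ∘ inj₁)

  -- Written bits are pushed on stack 0, hence in reverse order.
  out : List Bool → List Γ → List Γ
  out bs l = List.map inBit bs ʳ++ l

  out-++ : ∀ as bs l → out bs (out as l) ≡ out (as ++ bs) l
  out-++ as bs l = sym (trans (cong (_ʳ++ l) (Listₚ.map-++ inBit as bs)) (Listₚ.++-ʳ++ (List.map inBit as)))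

  emits : List Bool → Prog
  emits []       = skip
  emits (b ∷ bs) = push 0F (inBit b) ⨾ emits bs

  exec-emits : ∀ c bs l v → exec c (emits bs) (l ∷ v) ≡ out bs l ∷ v
  exec-emits c []       l v = refl
  exec-emits c (b ∷ bs) l v = exec-emits c bs (inBit b ∷ l) v

  sequence : ∀ {B : Set} → (B → Prog) → List B → Prog
  sequence p []       = skip
  sequence p (b ∷ bs) = p b ⨾ sequence p bs

  exec-sequence : ∀ {B : Set} c (S : List Γ → Store) (p : B → Prog) (f : B → List Bool) →
    (∀ b l → exec c (p b) (S l) ≡ S (out (f b) l)) → ∀ bs l → exec c (sequence p bs) (S l) ≡ S (out (List.concatMap f bs) l)
  exec-sequence c S p f h []       l = refl
  exec-sequence c S p f h (b ∷ bs) l = trans (cong (exec c (sequence p bs)) (h b l))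
    (trans (exec-sequence c S p f h bs (out (f b) l)) (cong S (out-++ (f b) (List.concatMap f bs) l)))

  -- Stacks 5 and 7 hold the patterns of the current row, with 6 and 8 for
  -- the entries already used; 3 and 4 do the same for the labels.
  store : List Γ → List Γ → List Γ → List (Maybe Slot) → List (Maybe Slot) → Store
  store l i i′ z d = l ∷ [] ∷ [] ∷ i ∷ i′ ∷ marks z ∷ [] ∷ marks d ∷ [] ∷ [] ∷ []

  scanVariables scanClauses : (Maybe Slot → List Bool) → Prog
  scanVariables f = case 5F λ where
    nothing               → emits (f nothing)
    (just (aux (inj₂ m))) → push 6F (aux (inj₂ m)) ⨾ emits (f m)
    (just _)              → skip
  scanClauses f = case 7F λ where
    nothing               → emits (f nothing)
    (just (aux (inj₂ m))) → push 8F (aux (inj₂ m)) ⨾ emits (f m)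
    (just _)              → skip

  restoreVariables restoreClauses restoreLabels : Prog
  restoreVariables = case 6F λ { nothing → skip ; (just x) → push 5F x }
  restoreClauses   = case 8F λ { nothing → skip ; (just x) → push 7F x }
  restoreLabels    = case 4F λ { nothing → skip ; (just x) → push 3F x }

  Scan : Set
  Scan = List (Maybe Slot) × List (Maybe Slot) × List Γ

  scan : (Maybe Slot → List Bool) → Scan → Scan
  scan f ([]     , zs′ , l) = [] , zs′ , out (f nothing) l
  scan f (z ∷ zs , zs′ , l) = zs , z ∷ zs′ , out (f z) l

  -- Past the end of the pattern the scan writes `f nothing`, just as `nth` falls back to its
  -- default; so patterns are never padded to the length of a row.
  iter-scan : ∀ n f zs zs′ l → iter n (scan f) (zs , zs′ , l) ≡
    (List.drop n zs , List.take n zs ʳ++ zs′ , out (gather n (f ∘ nth nothing zs)) l)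
  iter-scan zero    f zs       zs′ l = refl
  iter-scan (suc n) f []       zs′ l = trans (iter-scan n f [] zs′ (out (f nothing) l))
    (cong₂ (λ a b → a , b) (drop-[] n) (cong₂ (λ a b → a ʳ++ zs′ , b) (take-[] n) (out-++ (f nothing) _ l)))
    where
    drop-[] : ∀ n → List.drop {A = Maybe Slot} n [] ≡ []
    drop-[] zero    = refl
    drop-[] (suc n) = refl
    take-[] : ∀ n → List.take {A = Maybe Slot} n [] ≡ []
    take-[] zero    = refl
    take-[] (suc n) = refl
  iter-scan (suc n) f (z ∷ zs) zs′ l = trans (iter-scan n f zs (z ∷ zs′) (out (f z) l))
    (cong (λ l → List.drop n zs , List.take n zs ʳ++ z ∷ zs′ , l) (out-++ (f z) _ l))

  iter-restore : ∀ {B : Set} n (zs : List B) → iter n transfer (List.take n zs ʳ++ [] , List.drop n zs) ≡ ([] , zs)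
  iter-restore n zs = trans (iter-transfer-all (List.take n zs ʳ++ []) (List.drop n zs)
      (≤-trans (≤-reflexive (trans (Listₚ.length-reverse (List.take n zs)) (Listₚ.length-take n zs))) (ℕₚ.m⊓n≤m n (length zs))))
    (cong ([] ,_) (trans (Listₚ.ʳ++-ʳ++ (List.take n zs)) (Listₚ.take++drop≡id n zs)))

  module Layout (eE eJ eK : ℕ) where

    row : List Bool → (Maybe Slot → List Bool) → (Maybe Slot → List Bool) → Prog
    row g f h = emits g ⨾ (rep eE (scanVariables f) ⨾ rep eE restoreVariables) ⨾
                (rep (eK + eJ) (scanClauses h) ⨾ rep (eK + eJ) restoreClauses)

    module _ (c : List Γ) where

      E J K : ℕ
      E = length c ^ eE
      J = length c ^ eJ
      K = length c ^ eK

      m^[eK+eJ] : length c ^ (eK + eJ) ≡ K * J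
      m^[eK+eJ] = ℕₚ.^-distribˡ-+-* (length c) eK eJ

      rowBits : List Bool → (Maybe Slot → List Bool) → (Maybe Slot → List Bool) → List (Maybe Slot) → List (Maybe Slot) → List Bool
      rowBits g f h z d = g ++ gather E (f ∘ nth nothing z) ++ gather (K * J) (h ∘ nth nothing d)

      private
        variables-run : ∀ f l i i′ z d → exec c (rep eE (scanVariables f) ⨾ rep eE restoreVariables) (store l i i′ z d) ≡
                        store (out (gather E (f ∘ nth nothing z)) l) i i′ z d
        variables-run f l i i′ z d = begin
          exec c (rep eE restoreVariables) (exec c (rep eE (scanVariables f)) (S (z , [] , l)))
            ≡⟨ cong (exec c (rep eE restoreVariables)) (exec-rep-as c eE (scanVariables f) S (scan f) body (z , [] , l)) ⟩
          exec c (rep eE restoreVariables) (S (iter E (scan f) (z , [] , l)))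
            ≡⟨ cong (exec c (rep eE restoreVariables) ∘ S) (iter-scan E f z [] l) ⟩
          exec c (rep eE restoreVariables) (S′ (List.take E z ʳ++ [] , List.drop E z))
            ≡⟨ exec-rep-as c eE restoreVariables S′ transfer (λ { ([] , _) → refl ; (_ ∷ _ , _) → refl }) _ ⟩
          S′ (iter E transfer (List.take E z ʳ++ [] , List.drop E z))
            ≡⟨ cong S′ (iter-restore E z) ⟩
          store (out (gather E (f ∘ nth nothing z)) l) i i′ z d ∎
          where
          open ≡-Reasoning
          S : Scan → Store
          S (z , z′ , l) = l ∷ [] ∷ [] ∷ i ∷ i′ ∷ marks z ∷ marks z′ ∷ marks d ∷ [] ∷ [] ∷ []
          S′ : List (Maybe Slot) × List (Maybe Slot) → Store
          S′ (z₁ , z₂) = S (z₂ , z₁ , out (gather E (f ∘ nth nothing z)) l)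
          body : ∀ x → exec c (scanVariables f) (S x) ≡ S (scan f x)
          body ([]    , z′ , l) = exec-emits c (f nothing) l _
          body (z ∷ _ , z′ , l) = exec-emits c (f z) l _

        clauses-run : ∀ f l i i′ z d → exec c (rep (eK + eJ) (scanClauses f) ⨾ rep (eK + eJ) restoreClauses) (store l i i′ z d) ≡
                      store (out (gather (K * J) (f ∘ nth nothing d)) l) i i′ z d
        clauses-run f l i i′ z d = begin
          exec c (rep (eK + eJ) restoreClauses) (exec c (rep (eK + eJ) (scanClauses f)) (S (d , [] , l)))
            ≡⟨ cong (exec c (rep (eK + eJ) restoreClauses)) (exec-rep-as c (eK + eJ) (scanClauses f) S (scan f) body (d , [] , l)) ⟩
          exec c (rep (eK + eJ) restoreClauses) (S (iter n (scan f) (d , [] , l)))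
            ≡⟨ cong (exec c (rep (eK + eJ) restoreClauses) ∘ S) (iter-scan n f d [] l) ⟩
          exec c (rep (eK + eJ) restoreClauses) (S′ (List.take n d ʳ++ [] , List.drop n d))
            ≡⟨ exec-rep-as c (eK + eJ) restoreClauses S′ transfer (λ { ([] , _) → refl ; (_ ∷ _ , _) → refl }) _ ⟩
          S′ (iter n transfer (List.take n d ʳ++ [] , List.drop n d))
            ≡⟨ cong S′ (iter-restore n d) ⟩
          store (out (gather n (f ∘ nth nothing d)) l) i i′ z d
            ≡⟨ cong (λ n → store (out (gather n (f ∘ nth nothing d)) l) i i′ z d) m^[eK+eJ] ⟩
          store (out (gather (K * J) (f ∘ nth nothing d)) l) i i′ z d ∎
          where
          open ≡-Reasoning
          n = length c ^ (eK + eJ)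
          S : Scan → Store
          S (d , d′ , l) = l ∷ [] ∷ [] ∷ i ∷ i′ ∷ marks z ∷ [] ∷ marks d ∷ marks d′ ∷ [] ∷ []
          S′ : List (Maybe Slot) × List (Maybe Slot) → Store
          S′ (d₁ , d₂) = S (d₂ , d₁ , out (gather n (f ∘ nth nothing d)) l)
          body : ∀ x → exec c (scanClauses f) (S x) ≡ S (scan f x)
          body ([]    , d′ , l) = exec-emits c (f nothing) l _
          body (d ∷ _ , d′ , l) = exec-emits c (f d) l _

      row-run : ∀ g f h l i i′ z d → exec c (row g f h) (store l i i′ z d) ≡ store (out (rowBits g f h z d) l) i i′ z d
      row-run g f h l i i′ z d = begin
        exec c clauses (exec c variables (exec c (emits g) (store l i i′ z d))) ≡⟨ cong (exec c clauses ∘ exec c variables) (exec-emits c g l _) ⟩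
        exec c clauses (exec c variables (store (out g l) i i′ z d))           ≡⟨ cong (exec c clauses) (variables-run f (out g l) i i′ z d) ⟩
        exec c clauses (store (out (gather E (f ∘ nth nothing z)) (out g l)) i i′ z d) ≡⟨ clauses-run h _ i i′ z d ⟩
        store (out (gather (K * J) (h ∘ nth nothing d)) (out (gather E (f ∘ nth nothing z)) (out g l))) i i′ z d
          ≡⟨ cong (λ l → store l i i′ z d) (trans (out-++ (gather E _) _ (out g l)) (out-++ g _ l)) ⟩
        store (out (rowBits g f h z d) l) i i′ z d ∎
        where
        open ≡-Reasoning
        variables = rep eE (scanVariables f) ⨾ rep eE restoreVariables
        clauses = rep (eK + eJ) (scanClauses h) ⨾ rep (eK + eJ) restoreClauses

length-encode : ∀ D → length (encode D) ≡ Digraph.order D + suc (Digraph.order D * Digraph.order D)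
length-encode D = trans (Listₚ.length-++ (replicate order true)) (cong₂ (λ p q → p + suc q) (Listₚ.length-replicate order) (Vecₚ.length-toList (Vec.concat matrix)))
  where open Digraph D

gather-suc : ∀ {A : Set} n (f : ℕ → List A) → gather (suc n) f ≡ gather n f ++ f n
gather-suc zero    f = Listₚ.++-identityʳ (f 0)
gather-suc (suc n) f = trans (cong (f 0 ++_) (gather-suc n (f ∘ suc))) (sym (Listₚ.++-assoc (f 0) _ _))

length-concatMap : ∀ {A B : Set} {f : A → List B} {n} → (∀ x → length (f x) ≡ n) → ∀ xs → length (List.concatMap f xs) ≡ length xs * n
length-concatMap         e []       = refl
length-concatMap {f = f} e (x ∷ xs) = trans (Listₚ.length-++ (f x)) (cong₂ _+_ (e x) (length-concatMap e xs))

labelList : {L : Set} → L → L → L → (Bool → L) → ℕ → ℕ → Word → List L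
labelList blankL startL guessL bitL H Y w =
  replicate H blankL ++ startL ∷ List.map bitL (pair w []) ++ replicate Y guessL ++ replicate H blankL

-- The reduction, the simulated call and the comparison as one program

module Writer (A : TM) (Square Clause L : Set) (finite-Square : Finite Square) (finite-Clause : Finite Clause) (finite-L : Finite L)
  (lit : L → Clause → Bool → Slot → Square → Bool) (default blankL startL guessL : L) (bitL : Bool → L)
  (a k eH eE eJ eK : ℕ) where

  open Finite using (elements; _==_)
  open Generator A Square Clause L finite-Square finite-Clause finite-L lit default public
  open Layout eE eJ eK public

  squares : List Square
  squares = elements finite-Square

  clauses : List Clause
  clauses = elements finite-Clause

  noVariable noClause : Maybe Slot → List Bool
  noVariable _ = List.concatMap (λ _ → false ∷ false ∷ []) squares
  noClause   _ = List.concatMap (λ _ → false ∷ false ∷ []) clauses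

  ownNegation : Square → Maybe Slot → List Bool
  ownNegation σ m = List.concatMap (λ τ → false ∷ (Maybe.is-just m ∧ _==_ finite-Square σ τ) ∷ []) squares

  ownLink : Clause → Maybe Slot → List Bool
  ownLink κ m = List.concatMap (λ τ → false ∷ (Maybe.is-just m ∧ _==_ finite-Clause κ τ) ∷ []) clauses

  negatives positives : L → Clause → Maybe Slot → List Bool
  negatives ι κ m = List.concatMap (λ τ → false ∷ inSlot (lit ι κ false) m τ ∷ []) squares
  positives ι κ m = List.concatMap (λ τ → inSlot (lit ι κ true) m τ ∷ false ∷ []) squares

  toMiddle⁺ toMiddle⁻ toNone : List Bool
  toMiddle⁺ = false ∷ false ∷ true ∷ false ∷ []
  toMiddle⁻ = false ∷ false ∷ false ∷ true ∷ []
  toNone    = false ∷ false ∷ false ∷ false ∷ []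

  unary globalRows variableRows variableLoop : Prog
  unary = emits (replicate 4 true) ⨾ rep eE (emits (replicate (length squares * 2) true)) ⨾
          rep (eK + eJ) (emits (replicate (length clauses * 2) true)) ⨾ emits [ false ]
  globalRows = row toNone noVariable noClause ⨾ row toNone noVariable noClause ⨾
               row (true ∷ false ∷ false ∷ false ∷ []) noVariable noClause ⨾
               row (false ∷ true ∷ false ∷ false ∷ []) noVariable noClause
  variableRows = sequence (λ σ → row toMiddle⁺ (ownNegation σ) noClause ⨾ row toMiddle⁻ noVariable noClause) squares
  variableLoop = push 5F (aux (inj₂ (just above-left))) ⨾
                 rep eE (variableRows ⨾ push 5F (aux (inj₂ nothing))) ⨾
                 rep eE (case 5F (λ _ → skip)) ⨾ case 5F (λ _ → skip)

  -- The `nothing` that accompanies each label on stack 5 produces the gap of ℓ entries in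
  -- `clausePattern`, so the number ℓ is never computed.
  pushLabel : L → Prog
  pushLabel ι = push 4F (aux (inj₁ ι)) ⨾ push 5F (aux (inj₂ nothing))

  -- By skipping the padding, k nested loops make exactly n ^ k rounds for a word of length n. The
  -- guessed part needs exactly Y squares and not merely an upper bound, since a longer certificate
  -- would prove nothing.
  forBits : Prog → Prog
  forBits p = each λ { (onTape (bit _)) → p ; _ → skip }

  pushBits : Γ → Prog
  pushBits (onTape (bit b)) = pushLabel (bitL true) ⨾ pushLabel (bitL b)
  pushBits _                = skip

  labelLoop : Prog
  labelLoop = push 5F (aux (inj₂ (just below))) ⨾
    (rep eH (pushLabel blankL) ⨾ pushLabel startL ⨾ (each pushBits ⨾ pushLabel (bitL false)) ⨾
     (nest a (pushLabel guessL ⨾_) skip ⨾ nest a (nest k forBits (pushLabel guessL) ⨾_) skip) ⨾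
     rep eH (pushLabel blankL)) ⨾
    push 5F (aux (inj₂ (just above-right))) ⨾ push 5F (aux (inj₂ (just above))) ⨾ push 5F (aux (inj₂ (just above-left))) ⨾
    rep eE restoreLabels

  clauseRows : L → Prog
  clauseRows ι = sequence (λ κ → row toNone (negatives ι κ) (ownLink κ) ⨾ row toMiddle⁻ (positives ι κ) noClause) clauses

  labelledRows clauseStep oneCopy clauseLoop : Prog
  labelledRows = case 3F λ where
    nothing               → clauseRows default
    (just (aux (inj₁ ι))) → push 4F (aux (inj₁ ι)) ⨾ clauseRows ι
    (just _)              → skip
  clauseStep = labelledRows ⨾ push 5F (aux (inj₂ nothing)) ⨾ push 7F (aux (inj₂ nothing))
  -- The clause pattern on stack 5 and the labels start afresh with each copy. Stack 7 keeps
  -- growing, because its diagonal runs through the indices i J + j of all copies.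
  oneCopy = rep eJ clauseStep ⨾ rep eJ (case 5F (λ _ → skip)) ⨾ rep eJ restoreLabels
  clauseLoop = push 7F (aux (inj₂ (just above-left))) ⨾ rep eK oneCopy

  write-digraph : Prog
  write-digraph = unary ⨾ globalRows ⨾ variableLoop ⨾ labelLoop ⨾ clauseLoop

  countTrue popCount tick : Prog
  countTrue = case 1F λ where
    nothing                     → skip
    (just (onTape (bit true)))  → push 9F (onTape blank)
    (just (onTape (bit false))) → skip
    (just x)                    → push 1F x
  popCount = case 9F (λ _ → skip)
  -- With this extra symbol there are x + 1 of them for x ones, and K pops remove them all exactly
  -- when x < K.
  tick = push 9F (onTape blank)

  moveLetter : Prog
  moveLetter = case 0F λ { nothing → skip ; (just x) → push 1F x }

  -- Stack 9 ends up empty exactly if the output of A has fewer than K ones.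
  abstract
    solve : ℕ → ℕ → Prog
    solve eM eT = write-digraph ⨾ rep eM moveLetter ⨾ (start ⨾ rep eT simulate) ⨾ rep eM countTrue ⨾ tick ⨾ rep eK popCount

  module _ (w : Word) (C : ℕ) where

    c : List Γ
    c = paddedClock inBit (onTape blank) C w

    H Y : ℕ
    H = length c ^ eH
    Y = poly a k (length w)

    ιs : List L
    ιs = labelList blankL startL guessL bitL H Y w

    module G = Gadget Square Clause finite-Square finite-Clause (λ j → lit (nth default ιs j)) (length ιs) (E c) (J c) (K c)

    open G using (arc; nodes; nodes-≡; variableNodes; clauseNodes; clausePattern; diagonal; shifted)

    record Runs (p : Prog) (u v : Store) : Set where
      constructor runs
      field executed : exec c p u ≡ v

    infixr 5 _then_
    _then_ : ∀ {p q u v x} → Runs p u v → Runs q v x → Runs (p ⨾ q) u x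
    _then_ {q = q} (runs e) (runs f) = runs (trans (cong (exec c q) e) f)

    private
      -- The labels pile up in reverse order on stack 4, whence `ʳ++`; `restoreLabels` turns them
      -- round when all are there.
      record Appends (p : Prog) (κs : List L) : Set where
        constructor adds
        field added : ∀ l i z d i′ → exec c p (store l i (labs i′) z d) ≡ store l i (labs (κs ʳ++ i′)) (replicate (length κs) nothing ++ z) d
      open Appends

      appends-⨾ : ∀ {p q κs κs′} → Appends p κs → Appends q κs′ → Appends (p ⨾ q) (κs ++ κs′)
      appends-⨾ {p} {q} {κs} {κs′} f g = adds λ l i z d i′ → begin
        exec c q (exec c p (store l i (labs i′) z d)) ≡⟨ cong (exec c q) (added f l i z d i′) ⟩
        exec c q (store l i (labs (κs ʳ++ i′)) (replicate (length κs) nothing ++ z) d) ≡⟨ added g l i _ d (κs ʳ++ i′) ⟩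
        store l i (labs (κs′ ʳ++ κs ʳ++ i′)) (replicate (length κs′) nothing ++ replicate (length κs) nothing ++ z) d
          ≡⟨ cong₂ (λ κs z → store l i (labs κs) z d) (sym (Listₚ.++-ʳ++ κs))
               (trans (sym (Listₚ.++-assoc (replicate (length κs′) nothing) _ z))
                 (cong (_++ z) (trans (sym (replicate-+ (length κs′) (length κs))) (cong (λ n → replicate n nothing) (trans (+-comm (length κs′) (length κs)) (sym (Listₚ.length-++ κs))))))) ⟩
        store l i (labs ((κs ++ κs′) ʳ++ i′)) (replicate (length (κs ++ κs′)) nothing ++ z) d ∎
        where open ≡-Reasoning

      appends-skip : Appends skip []
      appends-skip = adds λ l i z d i′ → refl

      appends-label : ∀ ι → Appends (pushLabel ι) (replicate 1 ι)
      appends-label ι = adds λ l i z d i′ → refl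

      appends-nest : ∀ {p κ q} n → Appends p (replicate q κ) → Appends (nest n (p ⨾_) skip) (replicate (n * q) κ)
      appends-nest             zero    f = appends-skip
      appends-nest {p} {κ} {q} (suc n) f = subst (Appends (p ⨾ nest n (p ⨾_) skip)) (sym (replicate-+ q (n * q))) (appends-⨾ f (appends-nest n f))

      appends-foldl : ∀ {B : Set} (g : B → Prog) (h : B → List L) → (∀ b → Appends (g b) (h b)) → ∀ bs l i z d i′ →
        foldl (λ v b → exec c (g b) v) (store l i (labs i′) z d) bs ≡ store l i (labs (List.concatMap h bs ʳ++ i′)) (replicate (length (List.concatMap h bs)) nothing ++ z) d
      appends-foldl g h f []       l i z d i′ = refl
      appends-foldl g h f (b ∷ bs) l i z d i′ = begin
        foldl _ (exec c (g b) (store l i (labs i′) z d)) bs ≡⟨ cong (λ v → foldl (λ v b → exec c (g b) v) v bs) (added (f b) l i z d i′) ⟩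
        foldl _ (store l i (labs (h b ʳ++ i′)) (replicate (length (h b)) nothing ++ z) d) bs ≡⟨ appends-foldl g h f bs l i _ d (h b ʳ++ i′) ⟩
        store l i (labs (κs ʳ++ h b ʳ++ i′)) (replicate (length κs) nothing ++ replicate (length (h b)) nothing ++ z) d
          ≡⟨ cong₂ (λ κs z → store l i (labs κs) z d) (sym (Listₚ.++-ʳ++ (h b)))
               (trans (sym (Listₚ.++-assoc (replicate (length κs) nothing) _ z))
                 (cong (_++ z) (trans (sym (replicate-+ (length κs) (length (h b)))) (cong (λ n → replicate n nothing) (trans (+-comm (length κs) (length (h b))) (sym (Listₚ.length-++ (h b)))))))) ⟩
        store l i (labs ((h b ++ κs) ʳ++ i′)) (replicate (length (h b ++ κs)) nothing ++ z) d ∎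
        where
        open ≡-Reasoning
        κs = List.concatMap h bs

      concatMap-replicate : ∀ {B : Set} (bs : List B) q (κ : L) → List.concatMap (λ _ → replicate q κ) bs ≡ replicate (length bs * q) κ
      concatMap-replicate []       q κ = refl
      concatMap-replicate (b ∷ bs) q κ = trans (cong (replicate q κ ++_) (concatMap-replicate bs q κ)) (sym (replicate-+ q (length bs * q)))

      appends-each : ∀ {p κ q} → Appends p (replicate q κ) → Appends (each (λ _ → p)) (replicate (length c * q) κ)
      appends-each {p} {κ} {q} f = adds λ l i z d i′ → trans (appends-foldl (λ _ → p) (λ _ → replicate q κ) (λ _ → f) c l i z d i′)
        (cong (λ κs → store l i (labs (κs ʳ++ i′)) (replicate (length κs) nothing ++ z) d) (concatMap-replicate c q κ))

      appends-rep : ∀ e ι → Appends (rep e (pushLabel ι)) (replicate (length c ^ e) ι)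
      appends-rep zero    ι = appends-label ι
      appends-rep (suc e) ι = appends-each (appends-rep e ι)

      concatMap-clock : ∀ (h : Γ → List L) → h (onTape blank) ≡ [] → List.concatMap h c ≡ List.concatMap (h ∘ inBit) w
      concatMap-clock h e = begin
        List.concatMap h ((List.map inBit w ++ replicate C (onTape blank)) ∷ʳ onTape blank) ≡⟨ Listₚ.concatMap-++ h (List.map inBit w ++ replicate C (onTape blank)) _ ⟩
        List.concatMap h (List.map inBit w ++ replicate C (onTape blank)) ++ (h (onTape blank) ++ []) ≡⟨ cong₂ _++_ (Listₚ.concatMap-++ h (List.map inBit w) _) (trans (Listₚ.++-identityʳ _) e) ⟩
        (List.concatMap h (List.map inBit w) ++ List.concatMap h (replicate C (onTape blank))) ++ [] ≡⟨ trans (Listₚ.++-identityʳ _) (cong (List.concatMap h (List.map inBit w) ++_) (pads C)) ⟩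
        List.concatMap h (List.map inBit w) ++ [] ≡⟨ trans (Listₚ.++-identityʳ _) (Listₚ.concatMap-map h inBit w) ⟩
        List.concatMap (h ∘ inBit) w ∎
        where
        open ≡-Reasoning
        pads : ∀ n → List.concatMap h (replicate n (onTape blank)) ≡ []
        pads zero    = refl
        pads (suc n) = trans (cong (_++ List.concatMap h (replicate n (onTape blank))) e) (pads n)

      appends-each′ : ∀ (g : Γ → Prog) (h : Γ → List L) → h (onTape blank) ≡ [] → (∀ b → Appends (g b) (h b)) → Appends (each g) (List.concatMap (h ∘ inBit) w)
      appends-each′ g h e f = adds λ l i z d i′ → trans (appends-foldl g h f c l i z d i′)
        (cong (λ κs → store l i (labs (κs ʳ++ i′)) (replicate (length κs) nothing ++ z) d) (concatMap-clock h e))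

      appends-forBits : ∀ {p κ q} → Appends p (replicate q κ) → Appends (forBits p) (replicate (length w * q) κ)
      appends-forBits {p} {κ} {q} f = subst (Appends (forBits p)) (concatMap-replicate w q κ)
        (appends-each′ _ (λ { (onTape (bit _)) → replicate q κ ; _ → [] }) refl
          λ { (onTape (bit _)) → f ; (onTape blank) → appends-skip ; (onTape (work _)) → appends-skip ; (ctrl _) → appends-skip ; (aux _) → appends-skip })

      appends-forBits^ : ∀ j ι → Appends (nest j forBits (pushLabel ι)) (replicate (length w ^ j) ι)
      appends-forBits^ zero    ι = appends-label ι
      appends-forBits^ (suc j) ι = appends-forBits (appends-forBits^ j ι)

      appends-bits : Appends (each pushBits ⨾ pushLabel (bitL false)) (List.map bitL (pair w []))
      appends-bits = subst (Appends (each pushBits ⨾ pushLabel (bitL false))) (spell w)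
        (appends-⨾ 
          (appends-each′ pushBits h refl λ { (onTape (bit b)) → adds λ l i z d i′ → refl ; (onTape blank) → appends-skip ; (onTape (work _)) → appends-skip ; (ctrl _) → appends-skip ; (aux _) → appends-skip })
          (appends-label (bitL false)))
        where
        h : Γ → List L
        h (onTape (bit b)) = bitL true ∷ bitL b ∷ []
        h _                = []
        spell : ∀ w → List.concatMap (h ∘ inBit) w ++ [ bitL false ] ≡ List.map bitL (pair w [])
        spell []      = refl
        spell (b ∷ w) = cong (λ κs → bitL true ∷ bitL b ∷ κs) (spell w)

      appends-guesses : Appends (nest a (pushLabel guessL ⨾_) skip ⨾ nest a (nest k forBits (pushLabel guessL) ⨾_) skip) (replicate Y guessL)
      appends-guesses = subst (Appends _) (trans (sym (replicate-+ (a * 1) (a * length w ^ k))) (cong (λ n → replicate (n + a * length w ^ k) guessL) (*-identityʳ a)))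
        (appends-⨾ 
          (appends-nest a (appends-label guessL)) (appends-nest a (appends-forBits^ k guessL)))

    label-run : ∀ l → length ιs ≤ E c → Runs labelLoop (store l [] [] [] [])
      (store l (labs ιs) [] clausePattern [])
    label-run l fits = runs (begin
      exec c (rep eE restoreLabels) (exec c marking (exec c building (store l [] [] [ just below ] [])))
        ≡⟨ cong (exec c (rep eE restoreLabels) ∘ exec c marking) (added built l [] [ just below ] [] []) ⟩
      exec c (rep eE restoreLabels) (S (labs (ιs ʳ++ []) , []))
        ≡⟨ exec-rep-as c eE restoreLabels S transfer (λ { ([] , _) → refl ; (_ ∷ _ , _) → refl }) _ ⟩
      S (iter (E c) transfer (labs (ιs ʳ++ []) , []))
        ≡⟨ cong S (iter-transfer-all (labs (ιs ʳ++ [])) [] (≤-trans (≤-reflexive (trans (Listₚ.length-map _ (ιs ʳ++ [])) (Listₚ.length-reverse ιs))) fits)) ⟩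
      S ([] , labs (ιs ʳ++ []) ʳ++ [])
        ≡⟨ cong (λ i → S ([] , i)) (trans (cong (_ʳ++ []) (Listₚ.map-ʳ++ (aux ∘ inj₁) ιs)) (trans (Listₚ.ʳ++-ʳ++ (labs ιs)) (Listₚ.++-identityʳ (labs ιs)))) ⟩
      store l (labs ιs) [] clausePattern [] ∎)
      where
      open ≡-Reasoning
      marking building : Prog
      marking = push 5F (aux (inj₂ (just above-right))) ⨾ push 5F (aux (inj₂ (just above))) ⨾ push 5F (aux (inj₂ (just above-left)))
      building = rep eH (pushLabel blankL) ⨾ pushLabel startL ⨾ (each pushBits ⨾ pushLabel (bitL false)) ⨾
        (nest a (pushLabel guessL ⨾_) skip ⨾ nest a (nest k forBits (pushLabel guessL) ⨾_) skip) ⨾ rep eH (pushLabel blankL)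
      S : List Γ × List Γ → Store
      S (i′ , i) = store l i i′ clausePattern []
      built : Appends building ιs
      built = appends-⨾ (appends-rep eH blankL) (appends-⨾ (appends-label startL)
        (appends-⨾ appends-bits (appends-⨾ appends-guesses (appends-rep eH blankL))))

    bits : G.V → List Bool
    bits x = List.map (arc x) nodes

    record Row (x : G.V) (g : List Bool) (f h : Maybe Slot → List Bool) (z d : List (Maybe Slot)) : Set where
      constructor rowOf
      field row-bits : bits x ≡ rowBits c g f h z d

    private
      matches : ∀ x g f h z d → List.map (arc x) (sink⁺ ∷ sink⁻ ∷ middle⁺ ∷ middle⁻ ∷ []) ≡ g →
                (∀ e → List.map (arc x) (variableNodes e) ≡ f (nth nothing z e)) →
                (∀ i j → List.map (arc x) (clauseNodes i j) ≡ h (nth nothing d (i * J c + j))) →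
                Row x g f h z d
      matches x g f h z d p q r = rowOf (begin
        List.map (arc x) nodes ≡⟨ cong (List.map (arc x)) nodes-≡ ⟩
        List.map (arc x) (four ++ gather (E c) variableNodes ++ gather (K c) (λ i → gather (J c) (clauseNodes i)))
          ≡⟨ trans (Listₚ.map-++ (arc x) four _) (cong₂ _++_ p (Listₚ.map-++ (arc x) (gather (E c) variableNodes) _)) ⟩
        g ++ List.map (arc x) (gather (E c) variableNodes) ++ List.map (arc x) (gather (K c) (λ i → gather (J c) (clauseNodes i)))
          ≡⟨ cong₂ (λ as bs → g ++ as ++ bs)
               (trans (gather-map (E c) (arc x) variableNodes) (gather-cong (E c) (λ {e} _ → q e)))
               (trans (gather-map (K c) (arc x) _) (trans (gather-cong (K c) (λ {i} _ → trans (gather-map (J c) (arc x) (clauseNodes i)) (gather-cong (J c) (λ {j} _ → r i j))))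
                 (sym (gather-* (K c) (J c) (h ∘ nth nothing d))))) ⟩
        rowBits c g f h z d ∎)
        where
        open ≡-Reasoning
        four = sink⁺ ∷ sink⁻ ∷ middle⁺ ∷ middle⁻ ∷ []

      per-variable : ∀ x e → List.map (arc x) (variableNodes e) ≡ List.concatMap (λ τ → arc x (variable′ e τ true) ∷ arc x (variable′ e τ false) ∷ []) squares
      per-variable x e = Listₚ.map-concatMap (arc x) (λ τ → variable′ e τ true ∷ variable′ e τ false ∷ []) squares

      per-clause : ∀ x i j → List.map (arc x) (clauseNodes i j) ≡ List.concatMap (λ τ → arc x (clause i j τ) ∷ arc x (link i j τ) ∷ []) clauses
      per-clause x i j = Listₚ.map-concatMap (arc x) (λ τ → clause i j τ ∷ link i j τ ∷ []) clauses

      sink⁺-bits : ∀ z d → Row sink⁺ toNone noVariable noClause z d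
      sink⁺-bits z d = matches sink⁺ toNone noVariable noClause z d refl (per-variable sink⁺) (per-clause sink⁺)

      sink⁻-bits : ∀ z d → Row sink⁻ toNone noVariable noClause z d
      sink⁻-bits z d = matches sink⁻ toNone noVariable noClause z d refl (per-variable sink⁻) (per-clause sink⁻)

      middle⁺-bits : ∀ z d → Row middle⁺ (true ∷ false ∷ false ∷ false ∷ []) noVariable noClause z d
      middle⁺-bits z d = matches middle⁺ (true ∷ false ∷ false ∷ false ∷ []) noVariable noClause z d refl (per-variable middle⁺) (per-clause middle⁺)

      middle⁻-bits : ∀ z d → Row middle⁻ (false ∷ true ∷ false ∷ false ∷ []) noVariable noClause z d
      middle⁻-bits z d = matches middle⁻ (false ∷ true ∷ false ∷ false ∷ []) noVariable noClause z d refl (per-variable middle⁻) (per-clause middle⁻)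

      positive-bits : ∀ e σ d → Row (variable′ e σ true) toMiddle⁺ (ownNegation σ) noClause (replicate e nothing ++ diagonal) d
      positive-bits e σ d = matches (variable′ e σ true) toMiddle⁺ (ownNegation σ) noClause (replicate e nothing ++ diagonal) d refl
        (per-variable (variable′ e σ true)) (per-clause (variable′ e σ true))

      negative-bits : ∀ e σ z d → Row (variable′ e σ false) toMiddle⁻ noVariable noClause z d
      negative-bits e σ z d = matches (variable′ e σ false) toMiddle⁻ noVariable noClause z d refl
        (per-variable (variable′ e σ false)) (per-clause (variable′ e σ false))

      clause-bits : ∀ i j κ → Row (clause i j κ) toNone (negatives (nth default ιs j) κ) (ownLink κ)
                    (replicate j nothing ++ clausePattern) (replicate (i * J c + j) nothing ++ diagonal)
      clause-bits i j κ = matches (clause i j κ) toNone (negatives (nth default ιs j) κ) (ownLink κ) (replicate j nothing ++ clausePattern) (replicate (i * J c + j) nothing ++ diagonal)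
        refl (per-variable (clause i j κ)) (per-clause (clause i j κ))

      link-bits : ∀ i j κ d → Row (link i j κ) toMiddle⁻ (positives (nth default ιs j) κ) noClause (replicate j nothing ++ clausePattern) d
      link-bits i j κ d = matches (link i j κ) toMiddle⁻ (positives (nth default ιs j) κ) noClause (replicate j nothing ++ clausePattern) d
        refl (per-variable (link i j κ)) (per-clause (link i j κ))

    row-writes : ∀ {g f h x} l i i′ z d → Row x g f h z d → exec c (row g f h) (store l i i′ z d) ≡ store (out (bits x) l) i i′ z d
    row-writes {g} {f} {h} l i i′ z d (rowOf e) = trans (row-run c g f h l i i′ z d) (cong (λ bs → store (out bs l) i i′ z d) (sym e))

    private
      two-rows : ∀ {g f h g′ f′ h′ x y} l i i′ z d → Row x g f h z d → Row y g′ f′ h′ z d →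
                 exec c (row g f h ⨾ row g′ f′ h′) (store l i i′ z d) ≡ store (out (bits x ++ bits y ++ []) l) i i′ z d
      two-rows {g′ = g′} {f′} {h′} {x} {y} l i i′ z d p q = trans (cong (exec c (row g′ f′ h′)) (row-writes {x = x} l i i′ z d p))
        (trans (row-writes {x = y} (out (bits x) l) i i′ z d q)
          (cong (λ l → store l i i′ z d) (trans (out-++ (bits x) (bits y) l) (cong (λ bs → out (bits x ++ bs) l) (sym (Listₚ.++-identityʳ (bits y)))))))

      gather-out : ∀ n (f : ℕ → List Bool) l → out (f n) (out (gather n f) l) ≡ out (gather (suc n) f) l
      gather-out n f l = trans (out-++ (gather n f) (f n) l) (cong (λ bs → out bs l) (sym (gather-suc n f)))

      concatMap-concatMap : ∀ {A B C : Set} (h : B → List C) (f : A → List B) xs → List.concatMap h (List.concatMap f xs) ≡ List.concatMap (List.concatMap h ∘ f) xs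
      concatMap-concatMap h f []       = refl
      concatMap-concatMap h f (x ∷ xs) = trans (Listₚ.concatMap-++ h (f x) _) (cong (List.concatMap h (f x) ++_) (concatMap-concatMap h f xs))

      iter-pop : ∀ n (zs : List (Maybe Slot)) → iter n (List.drop 1) (replicate n nothing ++ zs) ≡ zs
      iter-pop zero    zs = refl
      iter-pop (suc n) zs = iter-pop n zs

      pop-marks : ∀ n l i i′ z d → exec c (rep n (case 5F (λ _ → skip))) (store l i i′ (replicate (length c ^ n) nothing ++ z) d) ≡ store l i i′ z d
      pop-marks n l i i′ z d = trans
        (exec-rep-as c n (case 5F (λ _ → skip)) (λ z → store l i i′ z d) (List.drop 1) (λ { [] → refl ; (_ ∷ _) → refl }) (replicate (length c ^ n) nothing ++ z))
        (cong (λ z → store l i i′ z d) (iter-pop (length c ^ n) z))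

    global-run : ∀ l → Runs globalRows (store l [] [] [] [])
      (store (out (List.concatMap bits (sink⁺ ∷ sink⁻ ∷ middle⁺ ∷ middle⁻ ∷ [])) l) [] [] [] [])
    global-run l = runs (trans (cong (exec c (row (true ∷ false ∷ false ∷ false ∷ []) noVariable noClause ⨾ row (false ∷ true ∷ false ∷ false ∷ []) noVariable noClause))
        (two-rows {x = sink⁺} {sink⁻} l [] [] [] [] (sink⁺-bits [] []) (sink⁻-bits [] [])))
      (trans (two-rows {x = middle⁺} {middle⁻} _ [] [] [] [] (middle⁺-bits [] []) (middle⁻-bits [] []))
        (cong (λ l → store l [] [] [] []) (trans (out-++ (bits sink⁺ ++ bits sink⁻ ++ []) (bits middle⁺ ++ bits middle⁻ ++ []) l)
          (cong (λ bs → out bs l) (trans (Listₚ.++-assoc (bits sink⁺) _ _) (cong (bits sink⁺ ++_) (trans (Listₚ.++-assoc (bits sink⁻) [] _) refl))))))))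

    variable-run : ∀ l → Runs variableLoop (store l [] [] [] [])
      (store (out (gather (E c) (List.concatMap bits ∘ variableNodes)) l) [] [] [] [])
    variable-run l = runs (begin
      exec c (case 5F (λ _ → skip)) (exec c (rep eE (case 5F (λ _ → skip))) (exec c (rep eE (variableRows ⨾ push 5F (aux (inj₂ nothing)))) (state 0)))
        ≡⟨ cong (exec c (case 5F (λ _ → skip)) ∘ exec c (rep eE (case 5F (λ _ → skip)))) (exec-rep-steps c eE (variableRows ⨾ push 5F (aux (inj₂ nothing))) state (λ {e} _ → next-row e)) ⟩
      exec c (case 5F (λ _ → skip)) (exec c (rep eE (case 5F (λ _ → skip))) (state (E c)))
        ≡⟨ cong (exec c (case 5F (λ _ → skip))) (pop-marks eE _ [] [] diagonal []) ⟩
      store (out (gather (E c) rows) l) [] [] [] [] ∎)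
      where
      open ≡-Reasoning
      rows : ℕ → List Bool
      rows = List.concatMap bits ∘ variableNodes
      state : ℕ → Store
      state e = store (out (gather e rows) l) [] [] (replicate e nothing ++ diagonal) []
      next-row : ∀ e → exec c (variableRows ⨾ push 5F (aux (inj₂ nothing))) (state e) ≡ state (suc e)
      next-row e = trans
        (cong (exec c (push 5F (aux (inj₂ nothing))))
          (trans (exec-sequence c (λ l → store l [] [] (replicate e nothing ++ diagonal) []) _ (λ σ → bits (variable′ e σ true) ++ bits (variable′ e σ false) ++ [])
              (λ σ l → two-rows {x = variable′ e σ true} {variable′ e σ false} l [] [] (replicate e nothing ++ diagonal) [] (positive-bits e σ []) (negative-bits e σ _ [])) squares (out (gather e rows) l))
            (cong (λ bs → store (out bs (out (gather e rows) l)) [] [] (replicate e nothing ++ diagonal) [])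
              (sym (concatMap-concatMap bits (λ σ → variable′ e σ true ∷ variable′ e σ false ∷ []) squares)))))
        (cong (λ l → store l [] [] (replicate (suc e) nothing ++ diagonal) []) (gather-out e rows l))

    private
      clause-row : ℕ → ℕ → List Bool
      clause-row i j = List.concatMap bits (clauseNodes i j)

      clauseRows-run : ∀ i j l i₁ i₂ → exec c (clauseRows (nth default ιs j)) (store l i₁ i₂ (replicate j nothing ++ clausePattern) (replicate (i * J c + j) nothing ++ diagonal)) ≡
                       store (out (clause-row i j) l) i₁ i₂ (replicate j nothing ++ clausePattern) (replicate (i * J c + j) nothing ++ diagonal)
      clauseRows-run i j l i₁ i₂ = trans
        (exec-sequence c (λ l → store l i₁ i₂ (replicate j nothing ++ clausePattern) (replicate (i * J c + j) nothing ++ diagonal)) _ (λ κ → bits (clause i j κ) ++ bits (link i j κ) ++ [])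
          (λ κ l → two-rows {x = clause i j κ} {link i j κ} l i₁ i₂ _ _ (clause-bits i j κ) (link-bits i j κ _)) clauses l)
        (cong (λ bs → store (out bs l) i₁ i₂ (replicate j nothing ++ clausePattern) (replicate (i * J c + j) nothing ++ diagonal))
          (sym (concatMap-concatMap bits (λ κ → clause i j κ ∷ link i j κ ∷ []) clauses)))

      taken : ℕ → List L × List L
      taken j = iter j transfer (ιs , [])

      top-label : List L → L
      top-label []      = default
      top-label (ι ∷ _) = ι

      top-taken : ∀ j → top-label (proj₁ (taken j)) ≡ nth default ιs j
      top-taken j = trans (cong (top-label ∘ proj₁) (iter-transfer j ιs [])) (dropped j ιs)
        where
        dropped : ∀ j ιs → top-label (List.drop j ιs) ≡ nth default ιs j
        dropped zero    []       = refl
        dropped zero    (_ ∷ _)  = refl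
        dropped (suc j) []       = refl
        dropped (suc j) (_ ∷ ιs) = dropped j ιs

      copy-state : List Γ → ℕ → ℕ → Store
      copy-state l i j = store (out (gather j (clause-row i)) l) (labs (proj₁ (taken j))) (labs (proj₂ (taken j)))
        (replicate j nothing ++ clausePattern) (replicate (i * J c + j) nothing ++ diagonal)

      next-clause : ∀ l i j → exec c clauseStep (copy-state l i j) ≡ copy-state l i (suc j)
      next-clause l i j = trans (cong (exec c (push 5F (aux (inj₂ nothing)) ⨾ push 7F (aux (inj₂ nothing)))) (branches (proj₁ (taken j)) (proj₂ (taken j)) (top-taken j)))
        (trans (cong₂ (λ l n → store l (labs (proj₁ (transfer (taken j)))) (labs (proj₂ (transfer (taken j)))) (replicate (suc j) nothing ++ clausePattern) (replicate n nothing ++ diagonal))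
          (gather-out j (clause-row i) l) (sym (+-suc (i * J c) j)))
         (cong (λ t → store (out (gather (suc j) (clause-row i)) l) (labs (proj₁ t)) (labs (proj₂ t)) (replicate (suc j) nothing ++ clausePattern) (replicate (i * J c + suc j) nothing ++ diagonal))
           (sym (iter-suc j transfer (ιs , [])))))
        where
        l₀ = out (gather j (clause-row i)) l
        z = replicate j nothing ++ clausePattern
        d = replicate (i * J c + j) nothing ++ diagonal
        branches : ∀ κs κs′ → top-label κs ≡ nth default ιs j → exec c labelledRows (store l₀ (labs κs) (labs κs′) z d) ≡
                   store (out (clause-row i j) l₀) (labs (proj₁ (transfer (κs , κs′)))) (labs (proj₂ (transfer (κs , κs′)))) z d
        branches []       κs′ e = trans (cong (λ ι → exec c (clauseRows ι) (store l₀ [] (labs κs′) z d)) e) (clauseRows-run i j l₀ [] (labs κs′))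
        branches (κ ∷ κs) κs′ e = trans (cong (λ ι → exec c (clauseRows ι) (store l₀ (labs κs) (labs (κ ∷ κs′)) z d)) e) (clauseRows-run i j l₀ (labs κs) (labs (κ ∷ κs′)))

      copy-run : ∀ l i → exec c oneCopy (copy-state l i 0) ≡
                 store (out (gather (J c) (clause-row i)) l) (labs ιs) [] clausePattern (replicate (suc i * J c) nothing ++ diagonal)
      copy-run l i = begin
        exec c (rep eJ restoreLabels) (exec c (rep eJ (case 5F (λ _ → skip))) (exec c (rep eJ clauseStep) (copy-state l i 0)))
          ≡⟨ cong (exec c (rep eJ restoreLabels) ∘ exec c (rep eJ (case 5F (λ _ → skip)))) (exec-rep-steps c eJ clauseStep (copy-state l i) (λ {j} _ → next-clause l i j)) ⟩
        exec c (rep eJ restoreLabels) (exec c (rep eJ (case 5F (λ _ → skip))) (copy-state l i (J c)))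
          ≡⟨ cong (exec c (rep eJ restoreLabels)) (pop-marks eJ _ _ _ clausePattern _) ⟩
        exec c (rep eJ restoreLabels) (S (proj₂ (taken (J c)) , proj₁ (taken (J c))))
          ≡⟨ exec-rep-as c eJ restoreLabels S transfer (λ { ([] , _) → refl ; (_ ∷ _ , _) → refl }) _ ⟩
        S (iter (J c) transfer (proj₂ (taken (J c)) , proj₁ (taken (J c))))
          ≡⟨ cong S (trans (cong (λ t → iter (J c) transfer (proj₂ t , proj₁ t)) (iter-transfer (J c) ιs [])) (iter-restore (J c) ιs)) ⟩
        store (out (gather (J c) (clause-row i)) l) (labs ιs) [] clausePattern (replicate (i * J c + J c) nothing ++ diagonal)
          ≡⟨ cong (λ n → store (out (gather (J c) (clause-row i)) l) (labs ιs) [] clausePattern (replicate n nothing ++ diagonal)) (+-comm (i * J c) (J c)) ⟩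
        store (out (gather (J c) (clause-row i)) l) (labs ιs) [] clausePattern (replicate (suc i * J c) nothing ++ diagonal) ∎
        where
        open ≡-Reasoning
        S : List L × List L → Store
        S (κs′ , κs) = store (out (gather (J c) (clause-row i)) l) (labs κs) (labs κs′) clausePattern (replicate (i * J c + J c) nothing ++ diagonal)

    clause-run : ∀ l → Runs clauseLoop (store l (labs ιs) [] clausePattern [])
      (store (out (gather (K c) (λ i → gather (J c) (List.concatMap bits ∘ clauseNodes i))) l) (labs ιs) [] clausePattern (replicate (K c * J c) nothing ++ diagonal))
    clause-run l = runs (exec-rep-steps c eK oneCopy state (λ {i} _ → trans (cong (λ n → exec c oneCopy (store (out (gather i rows) l) (labs ιs) [] clausePattern (replicate n nothing ++ diagonal))) (sym (+-identityʳ (i * J c))))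
      (trans (copy-run (out (gather i rows) l) i)
        (cong (λ l → store l (labs ιs) [] clausePattern (replicate (suc i * J c) nothing ++ diagonal)) (gather-out i rows l)))))
      where
      rows : ℕ → List Bool
      rows i = gather (J c) (clause-row i)
      state : ℕ → Store
      state i = store (out (gather i rows) l) (labs ιs) [] clausePattern (replicate (i * J c) nothing ++ diagonal)

    order : ℕ
    order = 4 + (E c * (length squares * 2) + K c * (J c * (length clauses * 2)))

    length-nodes : length nodes ≡ order
    length-nodes = trans (cong length nodes-≡) (cong (4 +_) (trans (Listₚ.length-++ (gather (E c) variableNodes))
      (cong₂ _+_ (length-gather (E c) (λ e → length-concatMap (λ _ → refl) squares))
        (length-gather (K c) (λ i → length-gather (J c) (λ j → length-concatMap (λ _ → refl) clauses))))))

    private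
      rep-trues : ∀ e n l → exec c (rep e (emits (replicate n true))) (store l [] [] [] []) ≡ store (out (replicate (length c ^ e * n) true) l) [] [] [] []
      rep-trues e n l = trans (exec-rep-as c e _ (λ l → store l [] [] [] []) (out (replicate n true)) (λ l → exec-emits c (replicate n true) l _) l)
        (cong (λ l → store l [] [] [] []) (iter-out (length c ^ e) l))
        where
        iter-out : ∀ q l → iter q (out (replicate n true)) l ≡ out (replicate (q * n) true) l
        iter-out zero    l = refl
        iter-out (suc q) l = trans (iter-out q (out (replicate n true) l)) (trans (out-++ (replicate n true) _ l) (cong (λ bs → out bs l) (sym (replicate-+ n (q * n)))))

    unary-run : Runs unary (store [] [] [] [] [])
      (store (out (replicate order true ++ [ false ]) []) [] [] [] [])
    unary-run = runs (begin
      exec c (emits [ false ]) (exec c clausePart (exec c variablePart (store (out (replicate 4 true) []) [] [] [] [])))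
        ≡⟨ cong (exec c (emits [ false ]) ∘ exec c clausePart) (rep-trues eE (length squares * 2) _) ⟩
      exec c (emits [ false ]) (exec c clausePart (store (out (replicate m true) (out (replicate 4 true) [])) [] [] [] []))
        ≡⟨ cong (exec c (emits [ false ])) (rep-trues (eK + eJ) (length clauses * 2) _) ⟩
      exec c (emits [ false ]) (store (out (replicate n true) (out (replicate m true) (out (replicate 4 true) []))) [] [] [] [])
        ≡⟨ exec-emits c [ false ] _ _ ⟩
      store (out [ false ] (out (replicate n true) (out (replicate m true) (out (replicate 4 true) [])))) [] [] [] []
        ≡⟨ cong (λ l → store (out [ false ] l) [] [] [] []) (trans (out-++ (replicate m true) (replicate n true) (out (replicate 4 true) [])) (out-++ (replicate 4 true) (replicate m true ++ replicate n true) [])) ⟩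
      store (out [ false ] (out (replicate 4 true ++ replicate m true ++ replicate n true) [])) [] [] [] []
        ≡⟨ cong (λ l → store l [] [] [] []) (out-++ (replicate 4 true ++ replicate m true ++ replicate n true) [ false ] []) ⟩
      store (out ((replicate 4 true ++ replicate m true ++ replicate n true) ++ [ false ]) []) [] [] [] []
        ≡⟨ cong (λ bs → store (out (bs ++ [ false ]) []) [] [] [] []) (trans (cong (replicate 4 true ++_) (sym (replicate-+ m n))) (cong (λ p → replicate (4 + (m + p)) true) n≡)) ⟩
      store (out (replicate order true ++ [ false ]) []) [] [] [] [] ∎)
      where
      open ≡-Reasoning
      m = E c * (length squares * 2)
      n = length c ^ (eK + eJ) * (length clauses * 2)
      n≡ : n ≡ K c * (J c * (length clauses * 2))
      n≡ = trans (cong (_* (length clauses * 2)) (m^[eK+eJ] c)) (*-assoc (K c) (J c) _)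
      variablePart clausePart : Prog
      variablePart = rep eE (emits (replicate (length squares * 2) true))
      clausePart = rep (eK + eJ) (emits (replicate (length clauses * 2) true))

    Start : Store
    Start = store [] [] [] [] []

    Written : List (Maybe Slot) → Store
    Written d = store (out (encode G.digraph) []) (labs ιs) [] clausePattern d

    write-run : length ιs ≤ E c → Runs write-digraph Start (Written (replicate (K c * J c) nothing ++ diagonal))
    write-run fits = unary-run then global-run l₁ then variable-run l₂ then label-run l₃ fits then
      subst (λ l → Runs clauseLoop (store l₃ (labs ιs) [] clausePattern []) (store l (labs ιs) [] clausePattern (replicate (K c * J c) nothing ++ diagonal))) written (clause-run l₃)
      where
      open ≡-Reasoning
      four = sink⁺ ∷ sink⁻ ∷ middle⁺ ∷ middle⁻ ∷ []
      vs = gather (E c) (List.concatMap bits ∘ variableNodes)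
      cs = gather (K c) (λ i → gather (J c) (List.concatMap bits ∘ clauseNodes i))
      l₁ = out (replicate order true ++ [ false ]) []
      l₂ = out (List.concatMap bits four) l₁
      l₃ = out vs l₂
      l₄ = out cs l₃
      written : l₄ ≡ out (encode G.digraph) []
      written = begin
        out cs (out vs (out (List.concatMap bits four) l₁)) ≡⟨ trans (out-++ vs cs (out (List.concatMap bits four) l₁)) (out-++ (List.concatMap bits four) (vs ++ cs) l₁) ⟩
        out (List.concatMap bits four ++ vs ++ cs) l₁       ≡⟨ out-++ (replicate order true ++ [ false ]) (List.concatMap bits four ++ vs ++ cs) [] ⟩
        out ((replicate order true ++ [ false ]) ++ List.concatMap bits four ++ vs ++ cs) []
          ≡⟨ cong (λ bs → out bs []) (trans (Listₚ.++-assoc (replicate order true) _ _) (cong₂ (λ n bs → replicate n true ++ false ∷ bs) (sym length-nodes) matrix)) ⟩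
        out (replicate (length nodes) true ++ false ∷ List.concatMap bits nodes) [] ≡⟨ cong (λ bs → out bs []) (sym G.encode-digraph) ⟩
        out (encode G.digraph) [] ∎
        where
        matrix : List.concatMap bits four ++ vs ++ cs ≡ List.concatMap bits nodes
        matrix = sym (trans (cong (List.concatMap bits) nodes-≡) (trans (Listₚ.concatMap-++ bits four (gather (E c) variableNodes ++ gather (K c) (λ i → gather (J c) (clauseNodes i)))) (cong (List.concatMap bits four ++_)
          (trans (Listₚ.concatMap-++ bits (gather (E c) variableNodes) (gather (K c) (λ i → gather (J c) (clauseNodes i)))) (cong₂ _++_ (gather-concatMap (E c) bits variableNodes)
            (trans (gather-concatMap (K c) bits (λ i → gather (J c) (clauseNodes i))) (gather-cong (K c) (λ {i} _ → gather-concatMap (J c) bits (clauseNodes i)))))))))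

    private
      late : List (Maybe Slot) → List Γ → List Γ → List Γ → ℕ → Store
      late d l r q n = l ∷ r ∷ q ∷ labs ιs ∷ [] ∷ marks clausePattern ∷ [] ∷ marks d ∷ [] ∷ replicate n (onTape blank) ∷ []

      count : List (Symbol (TM.extra A)) × ℕ → List (Symbol (TM.extra A)) × ℕ
      count (bit true ∷ as , n)  = as , suc n
      count (bit false ∷ as , n) = as , n
      count (as , n)             = as , n

      count-stop : ∀ m as n → leadingBits as ≡ [] → iter m count (as , n) ≡ (as , n)
      count-stop m []            n e = iter-fixed m refl
      count-stop m (blank ∷ as)  n e = iter-fixed m refl
      count-stop m (work _ ∷ as) n e = iter-fixed m refl

      iter-count : ∀ m as n → length (leadingBits as) ≤ m → proj₂ (iter m count (as , n)) ≡ n + trues (leadingBits as)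
      iter-count m       []               n le = trans (cong proj₂ (count-stop m [] n refl)) (sym (+-identityʳ n))
      iter-count m       (blank ∷ as)     n le = trans (cong proj₂ (count-stop m (blank ∷ as) n refl)) (sym (+-identityʳ n))
      iter-count m       (work x ∷ as)    n le = trans (cong proj₂ (count-stop m (work x ∷ as) n refl)) (sym (+-identityʳ n))
      iter-count (suc m) (bit true ∷ as)  n (s≤s le) = trans (iter-count m as (suc n) le) (sym (+-suc n _))
      iter-count (suc m) (bit false ∷ as) n (s≤s le) = iter-count m as n le

      ticks : ℕ → List Γ
      ticks n = replicate n (onTape blank)

      pop-ticks : ∀ n j → iter n (List.drop 1) (ticks j) ≡ ticks (j ∸ n)
      pop-ticks zero    j       = refl
      pop-ticks (suc n) zero    = trans (pop-ticks n zero) (cong ticks (ℕₚ.0∸n≡0 n))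
      pop-ticks (suc n) (suc j) = pop-ticks n j

      move-run : ∀ eM d → length (encode G.digraph) ≤ length c ^ eM →
                 Runs (rep eM moveLetter) (Written d) (late d [] (letters (List.map bit (encode G.digraph))) [] 0)
      move-run eM d le = runs (trans
        (exec-rep-as c eM moveLetter (λ (l , r) → late d l r [] 0) transfer (λ { ([] , _) → refl ; (_ ∷ _ , _) → refl }) (out (encode G.digraph) [] , []))
        (cong (λ (l , r) → late d l r [] 0) (trans (iter-transfer-all (out (encode G.digraph) []) [] (≤-trans (≤-reflexive (trans (Listₚ.length-reverse (List.map inBit (encode G.digraph))) (Listₚ.length-map inBit (encode G.digraph)))) le))
          (cong ([] ,_) (trans (Listₚ.ʳ++-ʳ++ (List.map inBit (encode G.digraph))) (trans (Listₚ.++-identityʳ _) (Listₚ.map-∘ (encode G.digraph))))))))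

      simulate-run : ∀ eT d {t q s} → HaltsFrom A (initial A (encode G.digraph)) t (q , s) → t ≤ length c ^ eT →
                     Runs (start ⨾ rep eT simulate) (late d [] (letters (List.map bit (encode G.digraph))) [] 0)
                       (late d (letters (Tape.before s)) (letters (Tape.here s ∷ Tape.after s)) [ ctrl q ] 0)
      simulate-run eT d h le = runs (run-simulation c eT {w = encode G.digraph} (labs ιs ∷ [] ∷ marks clausePattern ∷ [] ∷ marks d ∷ [] ∷ [] ∷ []) h le)

      count-run : ∀ eM d l as q → length (leadingBits as) ≤ length c ^ eM →
                  ∃[ as′ ] Runs (rep eM countTrue) (late d l (letters as) q 0) (late d l (letters as′) q (trues (leadingBits as)))
      count-run eM d l as q le = proj₁ end , runs (trans
        (exec-rep-as c eM countTrue (λ (as , n) → late d l (letters as) q n) count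
          (λ { ([] , _) → refl ; (blank ∷ _ , _) → refl ; (bit true ∷ _ , _) → refl ; (bit false ∷ _ , _) → refl ; (work _ ∷ _ , _) → refl }) (as , 0))
        (cong (late d l (letters (proj₁ end)) q) (iter-count (length c ^ eM) as 0 le)))
        where end = iter (length c ^ eM) count (as , 0)

      pop-run : ∀ d l r q n → Runs (tick ⨾ rep eK popCount) (late d l r q n) (late d l r q (suc n ∸ K c))
      pop-run d l r q n = runs (trans
        (exec-rep-as c eK popCount (λ ts → l ∷ r ∷ q ∷ labs ιs ∷ [] ∷ marks clausePattern ∷ [] ∷ marks d ∷ [] ∷ ts ∷ []) (List.drop 1)
          (λ { [] → refl ; (_ ∷ _) → refl }) (replicate (suc n) (onTape blank)))
        (cong (λ ts → l ∷ r ∷ q ∷ labs ιs ∷ [] ∷ marks clausePattern ∷ [] ∷ marks d ∷ [] ∷ ts ∷ []) (pop-ticks (K c) (suc n))))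

    abstract
      solve-run : ∀ {eM eT t o} → length ιs ≤ E c → length (encode G.digraph) ≤ length c ^ eM → length o ≤ length c ^ eM → t ≤ length c ^ eT →
                  Computes A (encode G.digraph) t o → lookup (exec c (solve eM eT) Start) 9F ≡ replicate (suc (trues o) ∸ K c) (onTape blank)
      solve-run {eM} {eT} fits enc-fits out-fits t≤ (q , s , halts , refl) =
        ends (write-run fits then move-run eM d enc-fits then simulate-run eT d halts t≤ then proj₂ (count-run eM d _ (Tape.here s ∷ Tape.after s) _ out-fits) then pop-run d _ _ _ _)
        where
        d : List (Maybe Slot)
        d = replicate (K c * J c) nothing ++ diagonal
        ends : ∀ {p l r q n} → Runs p Start (late d l r q n) → lookup (exec c p Start) 9F ≡ replicate n (onTape blank)
        ends (runs e) = cong (λ v → lookup v 9F) e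

    private
      m : ℕ
      m = length c

    HoldsAll : (Tr Fa : ℕ → Square → Set) → ℕ → Clause → Set
    HoldsAll Tr Fa j κ = Holds (lit (nth default ιs j) κ) Tr Fa (length ιs) j

    module Verdict (Member : Set) (eM eT aA kA : ℕ)
      (inside : 3 + length ιs + m ^ eJ ≤ m ^ eE)
      (encoding≤ : order + suc (order * order) ≤ m ^ eM)
      (simulation≤ : ∀ {x : ℕ} → x ≤ m ^ eM → poly aA kA x ≤ m ^ eT)
      (gap : ∀ {x : ℕ} → x * x ≤ 2 * order * ((2 + m ^ eE * length squares) * (2 + m ^ eE * length squares)) → x < m ^ eK)
      (sound : (Tr Fa : ℕ → Square → Set) → (∀ {e : ℕ} {σ : Square} → Tr e σ → Fa e σ → ⊥) → (∀ (j : ℕ) (κ : Clause) → j < m ^ eJ → HoldsAll Tr Fa j κ) → Member)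
      (complete : Member → Σ (ℕ → Square → Bool) λ holds → ∀ (j : ℕ) (κ : Clause) → HoldsAll (λ e σ → T (holds e σ)) (λ e σ → T (not (holds e σ))) j κ)
      where

      Answer : Set
      Answer = ∃[ t ] ∃[ o ] t ≤ poly aA kA (length (encode G.digraph)) × Computes A (encode G.digraph) t o × IsApproximation (LogFactor 1ℚ) G.digraph o

      Decided : Set
      Decided = let as = lookup (exec c (solve eM eT) Start) 9F in (as ≡ [] × Member) ⊎ (as ≢ [] × ¬ Member)

      private
        N : ℕ
        N = Digraph.order G.digraph

        enc-fits : length (encode G.digraph) ≤ m ^ eM
        enc-fits = ≤-trans (≤-reflexive (trans (length-encode G.digraph) (cong (λ n → n + suc (n * n)) length-nodes))) encoding≤

        SmallKernel : Set
        SmallKernel = ∃[ Q ] IsQuasiKernel G.digraph Q × ∣ Q ∣ ≡ 2 + m ^ eE * length squares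

        small-kernel : Member → SmallKernel
        small-kernel member = from-assignment (complete member)
          where
          from-assignment : (∃[ holds ] ∀ j κ → HoldsAll (λ e σ → T (holds e σ)) (λ e σ → T (not (holds e σ))) j κ) → SmallKernel
          from-assignment (holds , all) =
            G.ToQuasiKernel.kernel holds inside all , G.ToQuasiKernel.quasi-kernel holds inside all , G.ToQuasiKernel.size-kernel holds inside all

        module _ (t : ℕ) (Q : Subset (length nodes)) (t≤ : t ≤ poly aA kA (length (encode G.digraph)))
          (computed : Computes A (encode G.digraph) t (Vec.toList Q)) where

          out-fits : length (Vec.toList Q) ≤ m ^ eM
          out-fits = ≤-trans (≤-reflexive (trans (Vecₚ.length-toList Q) length-nodes)) (≤-trans (m≤m+n order (suc (order * order))) encoding≤)

          ℓ≤E : length ιs ≤ m ^ eE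
          ℓ≤E = ≤-trans (≤-trans (m≤n+m (length ιs) 3) (m≤m+n (3 + length ιs) (m ^ eJ))) inside

          result : lookup (exec c (solve eM eT) Start) 9F ≡ replicate (suc ∣ Q ∣ ∸ K c) (onTape blank)
          result = trans (solve-run {eM} {eT} ℓ≤E enc-fits out-fits (≤-trans t≤ (simulation≤ enc-fits)) computed)
            (cong (λ n → replicate (suc n ∸ K c) (onTape blank)) (sym (∣∣-trues Q)))

          -- A member of the language has a satisfying assignment and hence a small quasi-kernel.
          -- That bounds the optimum μ, and the factor then keeps the answer below K; so an answer
          -- of size at least K refutes membership.
          too-large : ∀ {μ} → (∀ Q → IsQuasiKernel G.digraph Q → μ ≤ ∣ Q ∣) → WithinFactor (LogFactor 1ℚ N) ∣ Q ∣ μ → SmallKernel → ∣ Q ∣ < K c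
          too-large {μ} minimal within (Q₁ , qk₁ , size) = gap (begin
            ∣ Q ∣ * ∣ Q ∣                       ≤⟨ within-square {N} {∣ Q ∣} {μ} positive within ⟩
            2 * N * (μ * μ)                     ≤⟨ *-monoʳ-≤ (2 * N) (*-mono-≤ μ≤ μ≤) ⟩
            2 * N * (q * q)                     ≡⟨ cong (λ n → 2 * n * (q * q)) length-nodes ⟩
            2 * order * (q * q)                 ∎)
            where
            open ≤-Reasoning
            q : ℕ
            q = 2 + m ^ eE * length squares
            positive : 1 ≤ N
            positive = ≤-trans (s≤s z≤n) (≤-reflexive (sym length-nodes))
            μ≤ : μ ≤ q
            μ≤ = ≤-trans (minimal Q₁ qk₁) (≤-reflexive size)

          verdict : ∀ {μ} → IsQuasiKernel G.digraph Q → (∀ Q → IsQuasiKernel G.digraph Q → μ ≤ ∣ Q ∣) →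
                    WithinFactor (LogFactor 1ℚ N) ∣ Q ∣ μ → Dec (∣ Q ∣ < K c) → Decided
          verdict qk minimal within (yes small) = inj₁
            (trans result (cong (λ n → replicate n (onTape blank)) (ℕₚ.m≤n⇒m∸n≡0 small)) ,
             sound (G.FromQuasiKernel.Tr Q qk small) (G.FromQuasiKernel.Fa Q qk small) (G.FromQuasiKernel.consistent Q qk small) (G.FromQuasiKernel.satisfied Q qk small))
          verdict qk minimal within (no large) = inj₂
            ((λ e → nonempty (suc ∣ Q ∣ ∸ K c) (ℕₚ.m<n⇒0<n∸m (s≤s (ℕₚ.≮⇒≥ large))) (trans (sym result) e)) ,
             λ member → large (too-large minimal within (small-kernel member)))
            where
            nonempty : ∀ {B : Set} {b : B} n → 0 < n → replicate n b ≢ []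
            nonempty (suc n) _ ()

      decided : Answer → Decided
      decided (t , _ , t≤ , computed , Q , refl , qk , _ , (_ , minimal) , within) = verdict t Q t≤ computed qk minimal within (∣ Q ∣ ℕₚ.<? K c)

  in-P : ∀ (L′ : Language) (C eM eT aA kA : ℕ) →
    (∀ w → 3 + length (ιs w C) + length (c w C) ^ eJ ≤ length (c w C) ^ eE) →
    (∀ w → order w C + suc (order w C * order w C) ≤ length (c w C) ^ eM) →
    (∀ w {x} → x ≤ length (c w C) ^ eM → poly aA kA x ≤ length (c w C) ^ eT) →
    (∀ w {x} → x * x ≤ 2 * order w C * ((2 + length (c w C) ^ eE * length squares) * (2 + length (c w C) ^ eE * length squares)) → x < length (c w C) ^ eK) →
    (∀ w Tr Fa → (∀ {e σ} → Tr e σ → Fa e σ → ⊥) → (∀ j κ → j < length (c w C) ^ eJ → HoldsAll w C Tr Fa j κ) → L′ w) →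
    (∀ w → L′ w → ∃[ holds ] ∀ j κ → HoldsAll w C (λ e σ → T (holds e σ)) (λ e σ → T (not (holds e σ))) j κ) →
    ((i : ∃ AcyclicBipartiteOrientation) → ∃[ t ] ∃[ o ] t ≤ poly aA kA (length (encode (proj₁ i))) × Computes A (encode (proj₁ i)) t o × IsApproximation (LogFactor 1ℚ) (proj₁ i) o) →
    P L′
  in-P L′ C eM eT aA kA inside encoding≤ simulation≤ gap sound complete answer =
    program-P Γ FΓ 10 inBit (onTape blank) L′ C (solve eM eT) 9F λ w →
      Verdict.decided w C (L′ w) eM eT aA kA (inside w) (encoding≤ w) (simulation≤ w) (gap w) (sound w) (complete w) (answer (G.digraph w C , G.bipartite w C))

-- The parameters of the reduction, as powers of the length m of the clock

length-pair : ∀ w y → length (pair w y) ≡ 2 * length w + 1 + length y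
length-pair []      y = refl
length-pair (b ∷ w) y = trans (cong (2 +_) (length-pair w y)) (shift-two (length w) (length y))
  where
  shift-two : ∀ n l → 2 + (2 * n + 1 + l) ≡ 2 * (1 + n) + 1 + l
  shift-two = solve-∀

module Exponents (a k aV kV aA kA s κ : ℕ) where

  -- In this order they belong to the certificate's length, the length of the verifier's input, its
  -- running time, the margin of the rows, their length, the numbers of clause indices, of squares
  -- and of copies, the order of the digraph, the length of its encoding, and the running time of
  -- the simulated machine. A leading `suc` is a factor m that absorbs the coefficients of the
  -- respective estimate.
  eY eX eT₀ eH eW eJ eE eK eN eM eT : ℕ
  eY  = suc (1 * k)
  eX  = suc eY
  eT₀ = suc (eX * kV)
  eH  = suc eT₀
  eW  = suc (eH + eX)
  eJ  = suc (eT₀ + eW)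
  eE  = suc eJ
  -- With F = m ^ suc eE this makes K = m F ^ 3. Twice the order is at most F K and the small
  -- quasi-kernel has at most F vertices, so an answer x for a member satisfies x ^ 2 ≤ F ^ 3 K < K
  -- ^ 2.
  eK  = suc (suc eE + (suc eE + suc eE))
  eN  = suc (eE + eK)
  eM  = suc (eN + eN)
  eT  = suc (eM * kA)

  C : ℕ
  -- The first three summands meet the condition of `poly-≤` for the certificate, the verifier and
  -- the simulated machine. The last bounds the coefficients in twice the order, and its 8 also
  -- covers the small numbers in the other estimates.
  C = 2 * a + (2 * aV + (2 * aA + (8 + 4 * s + 4 * κ)))

  module _ {m n : ℕ} (C≤m : C ≤ m) (n≤m : n ≤ m) where

    private
      2a≤m : 2 * a ≤ m
      2a≤m = ≤-trans (m≤m+n (2 * a) _) C≤m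
      2aV≤m : 2 * aV ≤ m
      2aV≤m = ≤-trans (≤-trans (m≤m+n (2 * aV) _) (m≤n+m _ (2 * a))) C≤m
      2aA≤m : 2 * aA ≤ m
      2aA≤m = ≤-trans (≤-trans (≤-trans (m≤m+n (2 * aA) _) (m≤n+m _ (2 * aV))) (m≤n+m _ (2 * a))) C≤m
      nodes≤m : 8 + 4 * s + 4 * κ ≤ m
      nodes≤m = ≤-trans (≤-trans (≤-trans (m≤n+m _ (2 * aA)) (m≤n+m _ (2 * aV))) (m≤n+m _ (2 * a))) C≤m
      8+4s≤m : 8 + 4 * s ≤ m
      8+4s≤m = ≤-trans (m≤m+n _ (4 * κ)) nodes≤m

      small : ∀ {q} → q ≤ 8 → q ≤ m
      small q≤8 = ≤-trans q≤8 (≤-trans (m≤m+n 8 (4 * s)) 8+4s≤m)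

      1≤m : 1 ≤ m
      1≤m = small (s≤s z≤n)

      1≤^ : ∀ e → 1 ≤ m ^ e
      1≤^ e = ≤-trans (≤-reflexive (sym (ℕₚ.^-zeroˡ e))) (^-monoˡ-≤ e 1≤m)

      ^-mono : ∀ {e f} → e ≤ f → m ^ e ≤ m ^ f
      ^-mono = ^-monoʳ-≤ m {{ℕ.>-nonZero 1≤m}}

      grow : ∀ {q} x → 1 ≤ x → q ≤ q * x
      grow {q} x 1≤x = ≤-trans (≤-reflexive (sym (*-identityʳ q))) (*-monoʳ-≤ q 1≤x)

      absorb : ∀ {q} e → q ≤ 8 → q * m ^ e ≤ m ^ suc e
      absorb e q≤8 = *-monoˡ-≤ (m ^ e) (small q≤8)

    open ≤-Reasoning

    Y≤ : poly a k n ≤ m ^ eY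
    Y≤ = poly-≤ {a} {k} 1 2a≤m 1≤m (≤-trans n≤m (≤-reflexive (sym (*-identityʳ m))))

    X≤ : 2 * n + 1 + poly a k n ≤ m ^ eX
    X≤ = begin
      2 * n + 1 + poly a k n            ≤⟨ +-mono-≤ (+-mono-≤ (*-monoʳ-≤ 2 n≤m^eY) (1≤^ eY)) Y≤ ⟩
      2 * m ^ eY + m ^ eY + m ^ eY      ≡⟨ four (m ^ eY) ⟩
      4 * m ^ eY                        ≤⟨ absorb eY (s≤s (s≤s (s≤s (s≤s z≤n)))) ⟩
      m ^ eX                            ∎
      where
      n≤m^eY : n ≤ m ^ eY
      n≤m^eY = ≤-trans n≤m (grow (m ^ (1 * k)) (1≤^ (1 * k)))
      four : ∀ x → 2 * x + x + x ≡ 4 * x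
      four = solve-∀

    time-bound : ∀ {x} → x ≤ 2 * n + 1 + poly a k n → poly aV kV x ≤ m ^ eT₀
    time-bound le = poly-≤ {aV} {kV} eX 2aV≤m 1≤m (≤-trans le X≤)

    margin : 2 * m ^ eT₀ + 3 ≤ m ^ eH
    margin = begin
      2 * m ^ eT₀ + 3             ≤⟨ +-monoʳ-≤ (2 * m ^ eT₀) (grow {3} (m ^ eT₀) (1≤^ eT₀)) ⟩
      2 * m ^ eT₀ + 3 * m ^ eT₀   ≡⟨ sym (ℕₚ.*-distribʳ-+ (m ^ eT₀) 2 3) ⟩
      5 * m ^ eT₀                 ≤⟨ absorb eT₀ (s≤s (s≤s (s≤s (s≤s (s≤s z≤n))))) ⟩
      m ^ eH                      ∎

    module _ {ℓ : ℕ} (ℓ≡ : ℓ ≡ m ^ eH + suc ((2 * n + 1) + (poly a k n + m ^ eH))) where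

      W≤ : 2 + ℓ ≤ m ^ eW
      W≤ = begin
        2 + ℓ                                                   ≡⟨ cong (2 +_) ℓ≡ ⟩
        2 + (m ^ eH + suc ((2 * n + 1) + (poly a k n + m ^ eH))) ≡⟨ arrange (m ^ eH) (2 * n + 1) (poly a k n) ⟩
        2 * m ^ eH + (2 * n + 1 + poly a k n) + 3               ≤⟨ +-mono-≤ (+-mono-≤ (*-monoʳ-≤ 2 (^-mono (m≤m+n eH eX))) (≤-trans X≤ (^-mono (m≤n+m eX eH)))) (grow {3} x (1≤^ (eH + eX))) ⟩
        2 * x + x + 3 * x                                       ≡⟨ six x ⟩
        6 * x                                                   ≤⟨ absorb (eH + eX) (s≤s (s≤s (s≤s (s≤s (s≤s (s≤s z≤n)))))) ⟩
        m ^ eW                                                  ∎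
        where
        x = m ^ (eH + eX)
        arrange : ∀ h b y → 2 + (h + suc (b + (y + h))) ≡ 2 * h + (b + y) + 3
        arrange = solve-∀
        six : ∀ x → 2 * x + x + 3 * x ≡ 6 * x
        six = solve-∀

      rows : suc (m ^ eT₀) * (2 + ℓ) ≤ m ^ eJ
      rows = begin
        suc (m ^ eT₀) * (2 + ℓ)     ≤⟨ *-mono-≤ (≤-trans (+-monoˡ-≤ (m ^ eT₀) (1≤^ eT₀)) (≤-reflexive (cong (m ^ eT₀ +_) (sym (+-identityʳ (m ^ eT₀)))))) W≤ ⟩
        2 * m ^ eT₀ * m ^ eW        ≡⟨ trans (*-assoc 2 (m ^ eT₀) (m ^ eW)) (cong (2 *_) (sym (ℕₚ.^-distribˡ-+-* m eT₀ eW))) ⟩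
        2 * m ^ (eT₀ + eW)          ≤⟨ absorb (eT₀ + eW) (s≤s (s≤s z≤n)) ⟩
        m ^ eJ                      ∎

      inside : 3 + ℓ + m ^ eJ ≤ m ^ eE
      inside = begin
        1 + (2 + ℓ) + m ^ eJ              ≤⟨ +-monoˡ-≤ (m ^ eJ) (+-mono-≤ (1≤^ eJ) (≤-trans (m≤m+n (2 + ℓ) (m ^ eT₀ * (2 + ℓ))) rows)) ⟩
        m ^ eJ + m ^ eJ + m ^ eJ          ≡⟨ three (m ^ eJ) ⟩
        3 * m ^ eJ                        ≤⟨ absorb eJ (s≤s (s≤s (s≤s z≤n))) ⟩
        m ^ eE                            ∎
        where
        three : ∀ x → x + x + x ≡ 3 * x
        three = solve-∀

      ℓ≤E : ℓ ≤ m ^ eE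
      ℓ≤E = ≤-trans (≤-trans (m≤n+m ℓ 3) (m≤m+n (3 + ℓ) (m ^ eJ))) inside

    private
      E J K F : ℕ
      E = m ^ eE
      J = m ^ eJ
      K = m ^ eK
      F = m ^ suc eE

    order : ℕ
    order = 4 + (E * (s * 2) + K * (J * (κ * 2)))

    private
      K≡ : K ≡ m * (F * (F * F))
      K≡ = cong (m *_) (trans (ℕₚ.^-distribˡ-+-* m (suc eE) (suc eE + suc eE)) (cong (F *_) (ℕₚ.^-distribˡ-+-* m (suc eE) (suc eE))))

      double-order : 2 * order ≤ F * K
      double-order = begin
        2 * (4 + (E * (s * 2) + K * (J * (κ * 2))))   ≡⟨ expand E J K s κ ⟩
        8 * 1 + 4 * s * E + 4 * κ * (J * K)           ≤⟨ +-mono-≤ (+-mono-≤ (*-monoʳ-≤ 8 (*-mono-≤ (1≤^ eE) (1≤^ eK))) (*-monoʳ-≤ (4 * s) (grow {E} K (1≤^ eK))))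
                                                           (*-monoʳ-≤ (4 * κ) (*-monoˡ-≤ K (^-mono (n≤1+n eJ)))) ⟩
        8 * (E * K) + 4 * s * (E * K) + 4 * κ * (E * K) ≡⟨ collect (E * K) s κ ⟩
        (8 + 4 * s + 4 * κ) * (E * K)                 ≤⟨ *-monoˡ-≤ (E * K) nodes≤m ⟩
        m * (E * K)                                   ≡⟨ sym (*-assoc m E K) ⟩
        F * K                                         ∎
        where
        expand : ∀ E J K s κ → 2 * (4 + (E * (s * 2) + K * (J * (κ * 2)))) ≡ 8 * 1 + 4 * s * E + 4 * κ * (J * K)
        expand = solve-∀
        collect : ∀ x s κ → 8 * x + 4 * s * x + 4 * κ * x ≡ (8 + 4 * s + 4 * κ) * x
        collect = solve-∀

      kernel≤F : 2 + E * s ≤ F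
      kernel≤F = begin
        2 + E * s             ≤⟨ +-monoˡ-≤ (E * s) (grow {2} E (1≤^ eE)) ⟩
        2 * E + E * s         ≡⟨ cong (2 * E +_) (*-comm E s) ⟩
        2 * E + s * E         ≡⟨ sym (ℕₚ.*-distribʳ-+ E 2 s) ⟩
        (2 + s) * E           ≤⟨ *-monoˡ-≤ E (≤-trans (+-mono-≤ (s≤s (s≤s (z≤n {6}))) (≤-trans (m≤m+n s (3 * s)) (≤-reflexive refl))) 8+4s≤m) ⟩
        F                     ∎

    gap : ∀ {x} → x * x ≤ 2 * order * ((2 + E * s) * (2 + E * s)) → x < K
    gap {x} le = ℕₚ.≰⇒> λ K≤x → ℕₚ.<-irrefl refl (begin-strict
      K * K                                       ≤⟨ *-mono-≤ K≤x K≤x ⟩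
      x * x                                       ≤⟨ le ⟩
      2 * order * ((2 + E * s) * (2 + E * s))     ≤⟨ *-mono-≤ double-order (*-mono-≤ kernel≤F kernel≤F) ⟩
      F * K * (F * F)                             ≡⟨ rotate F K ⟩
      F * (F * F) * K                             <⟨ ℕₚ.*-monoˡ-< K {{ℕ.>-nonZero (1≤^ eK)}} F³<K ⟩
      K * K                                       ∎)
      where
      rotate : ∀ F K → F * K * (F * F) ≡ F * (F * F) * K
      rotate = solve-∀
      F³<K : F * (F * F) < K
      F³<K = begin-strict
        F * (F * F)               <⟨ ℕₚ.m<m+n (F * (F * F)) (*-mono-≤ (1≤^ (suc eE)) (*-mono-≤ (1≤^ (suc eE)) (1≤^ (suc eE)))) ⟩
        F * (F * F) + F * (F * F) ≡⟨ cong (F * (F * F) +_) (sym (+-identityʳ _)) ⟩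
        2 * (F * (F * F))         ≤⟨ *-monoˡ-≤ (F * (F * F)) (small (s≤s (s≤s z≤n))) ⟩
        m * (F * (F * F))         ≡⟨ K≡ ⟨
        K                         ∎

    order≤ : order ≤ m ^ eN
    order≤ = begin
      order               ≤⟨ m≤m+n order (order + 0) ⟩
      2 * order           ≤⟨ double-order ⟩
      F * K               ≡⟨ trans (*-assoc m E K) (cong (m *_) (sym (ℕₚ.^-distribˡ-+-* m eE eK))) ⟩
      m ^ eN              ∎

    encoding≤ : order + suc (order * order) ≤ m ^ eM
    encoding≤ = begin
      order + suc (order * order) ≤⟨ +-mono-≤ (≤-trans order≤ (grow {p} p (1≤^ eN))) (+-mono-≤ (*-mono-≤ (1≤^ eN) (1≤^ eN)) (*-mono-≤ order≤ order≤)) ⟩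
      p * p + (p * p + p * p)     ≡⟨ three (p * p) ⟩
      3 * (p * p)                 ≡⟨ cong (3 *_) (sym (ℕₚ.^-distribˡ-+-* m eN eN)) ⟩
      3 * m ^ (eN + eN)           ≤⟨ absorb (eN + eN) (s≤s (s≤s (s≤s z≤n))) ⟩
      m ^ eM                      ∎
      where
      p = m ^ eN
      three : ∀ x → x + (x + x) ≡ 3 * x
      three = solve-∀

    simulation-bound : ∀ {x} → x ≤ m ^ eM → poly aA kA x ≤ m ^ eT
    simulation-bound le = poly-≤ {aA} {kA} eM 2aA≤m 1≤m le

-- Hardness

module _ {Γ : Set} {inBit : Bool → Γ} {pad : Γ} where

  padding≤clock : ∀ C w → C ≤ length (paddedClock inBit pad C w)
  padding≤clock C w = ≤-trans (≤-trans (n≤1+n C) (m≤n+m (suc C) (length w))) (≤-reflexive (sym (length-paddedClock inBit pad C w)))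

  word≤clock : ∀ C w → length w ≤ length (paddedClock inBit pad C w)
  word≤clock C w = ≤-trans (m≤m+n (length w) (suc C)) (≤-reflexive (sym (length-paddedClock inBit pad C w)))

module Hardness (aA kA : ℕ) {L : Language} (np : NP L) where

  V : Language
  V = proj₁ np

  M : TM
  M = proj₁ (proj₁ (proj₂ np))

  aV kV a k : ℕ
  aV = proj₁ (proj₂ (proj₁ (proj₂ np)))
  kV = proj₁ (proj₂ (proj₂ (proj₁ (proj₂ np))))
  a = proj₁ (proj₂ (proj₂ np))
  k = proj₁ (proj₂ (proj₂ (proj₂ np)))

  open Tableau M using (Square; finite-Square; blankSquare; startSquare; rejecting)
  open Clauses M using (literal; bitSquare; labels)
  open Finite using (elements)

  module Ex = Exponents a k aV kV aA kA (length (elements finite-Square)) (length (elements (finite-Kind finite-Square)))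
  open Ex using (C; eT₀; eH; eJ; eE; eK; eM; eT)

  module At (w : Word) (m : ℕ) (C≤m : C ≤ m) (n≤m : length w ≤ m) where

    H Y : ℕ
    H = m ^ eH
    Y = poly a k (length w)

    ιs : List (Label Square)
    ιs = labelList (fixed blankSquare) (fixed startSquare) guess (fixed ∘ bitSquare) H Y w

    -- The program produces one flat list, whereas the proofs about the tableau group the labels
    -- into the known prefix, the guesses and the right margin.
    labels≡ : ιs ≡ labels H Y w
    labels≡ = sym (begin
      List.map fixed (replicate H blankSquare ++ startSquare ∷ List.map bitSquare (pair w [])) ++ replicate Y guess ++ List.map fixed (replicate H blankSquare)
        ≡⟨ cong₂ (λ as bs → as ++ replicate Y guess ++ bs)
             (trans (Listₚ.map-++ fixed (replicate H blankSquare) _) (cong₂ (λ as bs → as ++ fixed startSquare ∷ bs) (Listₚ.map-replicate fixed H blankSquare) (sym (Listₚ.map-∘ (pair w [])))))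
             (Listₚ.map-replicate fixed H blankSquare) ⟩
      (replicate H (fixed blankSquare) ++ fixed startSquare ∷ List.map (fixed ∘ bitSquare) (pair w [])) ++ replicate Y guess ++ replicate H (fixed blankSquare)
        ≡⟨ Listₚ.++-assoc (replicate H (fixed blankSquare)) _ _ ⟩
      ιs ∎)
      where open ≡-Reasoning

    length-ιs : length ιs ≡ H + suc ((2 * length w + 1) + (Y + H))
    length-ιs = trans (Listₚ.length-++ (replicate H (fixed blankSquare)))
      (cong₂ (λ p q → p + suc q) (Listₚ.length-replicate H) (trans (Listₚ.length-++ (List.map (fixed ∘ bitSquare) (pair w [])))
        (cong₂ _+_ (trans (Listₚ.length-map (fixed ∘ bitSquare) (pair w [])) (trans (length-pair w []) (+-identityʳ _)))
          (trans (Listₚ.length-++ (replicate Y guess)) (cong₂ _+_ (Listₚ.length-replicate Y) (Listₚ.length-replicate H))))))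

    length-labels : length (labels H Y w) ≡ H + suc ((2 * length w + 1) + (Y + H))
    length-labels = trans (cong length (sym labels≡)) length-ιs

    Runs : Word → Set
    Runs y = ∃[ t ] ∃[ o ] t ≤ m ^ eT₀ × Computes M (pair w y) t o × Decision V (pair w y) o

    runs-within : ∀ y → length y ≤ Y → Runs y
    runs-within y y≤ =
      let (t , o , t≤ , rest) = proj₂ (proj₂ (proj₂ (proj₁ (proj₂ np)))) (pair w y)
      in t , o , ≤-trans t≤ (Ex.time-bound C≤m n≤m (≤-trans (≤-reflexive (length-pair w y)) (+-monoʳ-≤ (2 * length w + 1) y≤))) , rest

    Certified : Set
    Certified = ∃[ y ] length y ≤ Y × V (pair w y)

    certified : L w ⇔ Certified
    certified = proj₂ (proj₂ (proj₂ (proj₂ np))) w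

    margin : 2 * m ^ eT₀ + 3 ≤ H
    margin = Ex.margin C≤m n≤m

    rows : suc (m ^ eT₀) * Clauses.W M H Y w ≤ m ^ eJ
    rows = Ex.rows C≤m n≤m {length (labels H Y w)} length-labels

    inside : 3 + length ιs + m ^ eJ ≤ m ^ eE
    inside = Ex.inside C≤m n≤m {length ιs} length-ιs

    Sat : (Tr Fa : ℕ → Square → Set) → List (Label Square) → ℕ → Kind Square → Set
    Sat Tr Fa ιs j κ = Holds (literal (nth free ιs j) κ) Tr Fa (length ιs) j

    sound : ∀ Tr Fa → (∀ {e σ} → Tr e σ → Fa e σ → ⊥) → (∀ j κ → j < m ^ eJ → Sat Tr Fa ιs j κ) → L w
    sound Tr Fa consistent satisfied = Equivalence.from certified
      (Clauses.Soundness.sound M H Y w V (m ^ eT₀) (m ^ eJ) runs-within margin rows Tr Fa consistent satisfied-labels)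
      where
      satisfied-labels : ∀ j κ → j < m ^ eJ → Sat Tr Fa (labels H Y w) j κ
      satisfied-labels j κ j< = subst (λ ιs → Sat Tr Fa ιs j κ) labels≡ (satisfied j κ j<)

    Assignment : Set
    Assignment = Σ (ℕ → Square → Bool) λ holds → ∀ j κ → Sat (λ e σ → T (holds e σ)) (λ e σ → T (not (holds e σ))) ιs j κ

    complete : L w → Assignment
    complete l = from-certificate (Equivalence.to certified l)
      where
      of-run : ∀ y → length y ≤ Y → (∀ t p → rejecting (Rows.row M (pair w y) (suc H) t p) ≡ false) → Assignment
      of-run y y≤ accepting = holds , λ j κ →
        subst (λ ιs → Sat (λ e σ → T (holds e σ)) (λ e σ → T (not (holds e σ))) ιs j κ) (sym labels≡) (Clauses.Completeness.complete M H Y w y y≤ accepting j κ)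
        where
        holds : ℕ → Square → Bool
        holds = Clauses.Completeness.holds M H Y w y y≤ accepting
      from-run : ∀ y → length y ≤ Y → V (pair w y) → Runs y → Assignment
      from-run y y≤ v (_ , _ , _ , _ , inj₂ (¬v , _))                     = contradiction v ¬v
      from-run y y≤ v (_ , _ , _ , (q , t , halts , out) , inj₁ (_ , o≡)) = of-run y y≤ (Rows.accepted M (pair w y) (suc H) halts (trans out o≡))
      from-certificate : Certified → Assignment
      from-certificate (y , y≤ , v) = from-run y y≤ v (runs-within y y≤)

-- Because of the gap, a single simulated call of `A` decides membership. The time bound of `A`
-- enters only the padding `C` and the last exponent `eT`, so the choice of the other exponents is
-- not circular.
NP⊆P : MinQuasiKernelApproximable AcyclicBipartiteOrientation (LogFactor 1ℚ) → ∀ {L} → NP L → P L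
NP⊆P (A , aA , kA , answer) {L} np = Writer.in-P A Square (Kind Square) (Label Square) finite-Square (finite-Kind finite-Square) (finite-Label finite-Square)
  literal free (fixed blankSquare) (fixed startSquare) guess (fixed ∘ bitSquare) a k eH eE eJ eK
  L C eM eT aA kA
  (λ w → At.inside w _ (padding≤clock C w) (word≤clock C w))
  (λ w → Ex.encoding≤ (padding≤clock C w) (word≤clock C w))
  (λ w → Ex.simulation-bound (padding≤clock C w) (word≤clock C w))
  (λ w → Ex.gap (padding≤clock C w) (word≤clock C w))
  (λ w → At.sound w _ (padding≤clock C w) (word≤clock C w))
  (λ w → At.complete w _ (padding≤clock C w) (word≤clock C w))
  answer
  where
  open Hardness aA kA {L} np
  open Tableau M using (Square; finite-Square; blankSquare; startSquare)
  open Clauses M using (literal; bitSquare)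
  open Ex using (C; eH; eE; eJ; eK; eM; eT)

theorem3p6 : ∃[ c ] 0ℚ ℚ.< c ×
    (¬ P=NP →
    ¬ MinQuasiKernelApproximable U (LogFactor c) ×
    ¬ MinQuasiKernelApproximable AcyclicBipartiteOrientation (LogFactor c))
theorem3p6 = 1ℚ , ℚₚ.positive⁻¹ 1ℚ , λ P≠NP →
  -- An algorithm for all digraphs also serves on the restricted class, since the encoding forgets
  -- the proof of membership in it.
  (λ (M , a , k , solves) → P≠NP (collapse (M , a , k , λ (D , _) → solves (D , tt)))) ,
  (λ approx → P≠NP (collapse approx))
  where
  collapse : MinQuasiKernelApproximable AcyclicBipartiteOrientation (LogFactor 1ℚ) → P=NP
  collapse approx = P⊆NP , NP⊆P approx
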